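{- Let $d>1$ be a squarefree integer and let $m,n$ be nonzero integers with $m^2-dn^2=4$, $9\nmid m$, $27\nmid (m-2)$, and $\mathrm{ord}_3(m-2)\ge \mathrm{ord}_3 n$, where $\mathrm{ord}_3$ denotes the $3$-adic order. Let $p$ be a prime with $p\nmid n$ and $p=x^2+3dy^2$, where $x,y$ are integers with $3\nmid y$ and $x\equiv y\pmod 3$. Then modulo $p$, $$\Big(\frac{m+n\sqrt d}{2}\Big)^{\frac{p-1}{3}}\equiv \begin{cases} \frac12\Big(-1+\big(\frac{(m-2)n/3}{3}\big)\frac{x}{dy}\sqrt d\Big) & \text{if } m\equiv 5,8\pmod 9,\\ \frac12\Big(-1-\big(\frac{(m-2)n/27}{3}\big)\frac{x}{dy}\sqrt d\Big) & \text{if } m\equiv 11,20\pmod{27},\\ \frac12\Big(-1+\big(\frac{mn/3}{3}\big)\frac{x}{dy}\sqrt d\Big) & \text{if } m\equiv 0\pmod 3,\\ \frac12\Big(-1+\big(\frac{(m+2)n/3}{3}\big)\frac{x}{dy}\sqrt d\Big) & \text{if } m\equiv 1\pmod 3,\end{cases}$$ where $\big(\frac{\cdot}{3}\big)$ is the Legendre symbol.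
   Context: For such a prime $p$, $d$ is a nonzero square modulo $p$. In the congruence, $\sqrt d$ is interpreted as an integer $s$ with $s^2\equiv d\pmod p$, the same choice of $s$ being used on both sides (the congruence holds for either choice), and the denominators $2$ and $dy$, which are prime to $p$, are inverted modulo $p$. -}

module Defs where

open import Data.Bool.Base using (if_then_else_)
open import Data.Fin.Base using (toℕ)
open import Data.Fin.Properties using (any?)
open import Data.Integer.Base using (ℤ; +_; -_; _-_; _*_; ∣_∣; 0ℤ; 1ℤ)
open import Data.Integer.Divisibility using (_∣_)
open import Data.Nat.Base as ℕ using (ℕ; zero; suc)
import Data.Nat.Divisibility as ℕ
open import Relation.Binary.PropositionalEquality using (_≡_)
open import Relation.Nullary.Decidable using (Dec; does)

infix 4 _≡_[mod_] _≡?_[mod_]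

_≡_[mod_] : ℤ → ℤ → ℕ → Set
a ≡ b [mod n ] = + n ∣ a - b

_≡?_[mod_] : ∀ a b n → Dec (a ≡ b [mod n ])
a ≡? b [mod n ] = n ℕ.∣? ∣ a - b ∣

-- i represents 1/a modulo n.
IsInverseMod : ℕ → ℤ → ℤ → Set
IsInverseMod n a i = a * i ≡ 1ℤ [mod n ]

SquareFree : ℤ → Set
SquareFree d = ∀ k → k * k ∣ d → ∣ k ∣ ≡ 1

-- The largest e ≤ b with p ^ e ∣ a.
greatestExponent≤ : (b p : ℕ) → ℤ → ℕ
greatestExponent≤ zero    p a = zero
greatestExponent≤ (suc b) p a =
  if does (p ℕ.^ suc b ℕ.∣? ∣ a ∣) then suc b else greatestExponent≤ b p a

-- The p-adic order of a nonzero integer, for p ≥ 2: if p ^ e ∣ a and a ≢ 0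
-- then e < p ^ e ≤ ∣ a ∣, so the search bound loses nothing.  The value
-- ord p 0 = 0 is a junk value.
ord : ℕ → ℤ → ℕ
ord p a = greatestExponent≤ ∣ a ∣ p a

-- The Legendre symbol (a / p), for an odd prime p.
legendre : ℤ → ℕ → ℤ
legendre a p =
  if does (a ≡? 0ℤ [mod p ]) then 0ℤ
  else if does (any? {n = p} λ k → + toℕ k * + toℕ k ≡? a [mod p ]) then 1ℤ
  else - 1ℤ

-- Put u = m ± 2, so that u² − d n² = ± 4 u and ε = ± α / α′ for α = u + n √d.  Modulo p one has
-- √−3 = r := x √d / (d y), hence α y r = n x + u y √−3: up to sign ε is the quotient of the
-- Eisenstein integer β = n x + u y √−3 and its conjugate, and ε ^ ((p − 1) / 3) is the rational
-- cubic residue symbol of β at p.  After removing common factors, d N(β) = p u² − h x² with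
-- h = u² − d n² a divisor of 4 u.  By cubic reciprocity the symbol of β, corrected by a character
-- modulo 9 that makes β primary, is a cubic character modulo N(β) that is trivial at 2 and at the
-- primes dividing u or x; so p u² ≡ h x² (mod N(β)) evaluates it, up to that character at p u⁴ x⁴.
--
-- Reciprocity itself comes from Gauss sums.  In the convolution algebra of ℤ[ω]-valued functions
-- on ℤ/q a cubic character g satisfies g² = J ḡ and g⁴ = q J g, J being its Jacobi sum, so that
-- g ^ ℓ is known exactly, while modulo a prime ℓ its value at ℓ t is g(t) ^ ℓ.

module Submission where

open import Level using () renaming (zero to 0ℓ)
open import Algebra.Bundles using (CommutativeRing)
open import Data.Bool.Base using (Bool; true; false; if_then_else_)
open import Data.Empty using (⊥; ⊥-elim)
open import Data.Fin.Base as Fin using (Fin; toℕ; fromℕ; fromℕ<; inject₁; punchIn)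
import Data.Fin.Properties as Fin
open import Data.Fin.Permutation using (Permutation′; permutation)
open import Data.Nat using (ℕ; zero; suc; _∸_; _≥_; NonZero; s≤s; z≤n; _!)
import Data.Nat as ℕ
import Data.Nat.Properties as ℕ
import Data.Nat.Divisibility as ℕ
import Data.Nat.DivMod as ℕ
import Data.Nat.GCD as ℕ
open import Data.Nat.Combinatorics using (nCn≡1; nCk≡n!/k![n-k]!; k![n∸k]!∣n!) renaming (_C_ to _choose_)
open import Data.Nat.Induction using (<-wellFounded; Acc; acc)
open import Data.Nat.Primality using (Prime; euclidsLemma; prime⇒nonTrivial; prime⇒nonZero; prime⇒irreducible; prime?)
open import Data.Product using (∃; _,_; _×_; proj₁; proj₂)
open import Data.Sum using (_⊎_; inj₁; inj₂; [_,_]′)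
open import Data.Vec.Functional using (Vector; removeAt)
open import Function.Base using (_∘_; case_of_)
open import Relation.Binary.PropositionalEquality as ≡ using (_≡_; _≢_)
open import Relation.Nullary using (¬_; contradiction; Dec; yes; no)

-- Symbols are needed only between Eisenstein integers and rational integers, so reciprocity is
-- stated without prime ideals of ℤ[ω].
--
-- The convolution algebra has zero divisors, so g³ = q J fails there. Every relation keeps a factor
-- g, and this factor disappears only when a value is read off at a point.
--
-- The sign in u = m ± 2 is chosen so that 3 does not divide u. If 3 divides n, then β is divisible
-- by √-3 and has no primary associate. Dividing by √-3 interchanges the two coordinates and negates
-- one of them, which is the origin of the minus sign in that case. The sign between ε and α / α′ is
-- harmless because (p - 1) / 3 is even, so that only ε² enters.

-- Frobenius in commutative rings of prime characteristic

p∤k! : ∀ {p} → Prime p → ∀ k → k ℕ.< p → ¬ (p ℕ.∣ k !)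
p∤k! {p} pr zero k<p p∣ = contradiction (ℕ.∣⇒≤ p∣) (ℕ.<⇒≱ (ℕ.nonTrivial⇒n>1 p {{prime⇒nonTrivial pr}}))
p∤k! pr (suc k) k<p p∣ with euclidsLemma (suc k) (k !) pr p∣
... | inj₁ q = contradiction (ℕ.∣⇒≤ q) (ℕ.<⇒≱ k<p)
... | inj₂ q = p∤k! pr k (ℕ.<-trans (ℕ.n<1+n k) k<p) q

p∣pCk : ∀ {p} → Prime p → ∀ k → 0 ℕ.< k → k ℕ.< p → p ℕ.∣ p choose k
p∣pCk {p} pr k 0<k k<p with euclidsLemma (p choose k) (k ! ℕ.* (p ℕ.∸ k) !) pr p∣prod
  where
  instance _ = k !≢0 where open import Data.Nat.Properties using (_!≢0)
           _ = ℕ._!*_!≢0 k (p ℕ.∸ k)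
           _ = prime⇒nonZero pr
  k≤p = ℕ.<⇒≤ k<p
  eq : (p choose k) ℕ.* (k ! ℕ.* (p ℕ.∸ k) !) ≡ p !
  eq = ≡.trans (≡.cong (ℕ._* (k ! ℕ.* (p ℕ.∸ k) !)) (nCk≡n!/k![n-k]! k≤p)) (ℕ.m/n*n≡m (k![n∸k]!∣n! k≤p))
  n∣n! : ∀ n → .{{NonZero n}} → n ℕ.∣ n !
  n∣n! (suc n) = ℕ.m∣m*n (n !)
  p∣prod = ≡.subst (p ℕ.∣_) (≡.sym eq) (n∣n! p)
... | inj₁ d = d
... | inj₂ d with euclidsLemma (k !) ((p ℕ.∸ k) !) pr d
...   | inj₁ e = contradiction e (p∤k! pr k k<p)
...   | inj₂ e = contradiction e (p∤k! pr (p ℕ.∸ k) (ℕ.∸-monoʳ-< 0<k (ℕ.<⇒≤ k<p)))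

module Frobenius (R : CommutativeRing 0ℓ 0ℓ) {p : ℕ} (pr : Prime p) where
  open CommutativeRing R
  open import Algebra.Properties.CommutativeSemiring.Binomial commutativeSemiring using (theorem; binomialTerm)
  open import Algebra.Properties.Semiring.Exp semiring
  open import Algebra.Properties.Semiring.Mult semiring renaming (_×_ to _·_)
  open import Algebra.Properties.Semiring.Sum semiring
  open import Relation.Binary.Reasoning.Setoid setoid

  module _ (char : ∀ x → p · x ≈ 0#) where
    char∣ : ∀ {k} → p ℕ.∣ k → ∀ x → k · x ≈ 0#
    char∣ (ℕ.divides q ≡.refl) x = begin
      (q ℕ.* p) · x ≈⟨ sym (×-assocˡ x q p) ⟩
      q · (p · x)   ≈⟨ ×-congʳ q (char x) ⟩
      q · 0#        ≈⟨ sum-replicate q ⟨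
      _             ≈⟨ sum-replicate-zero q ⟩
      0#            ∎

    sum-zero : ∀ {n} (t : Vector Carrier n) → (∀ i → t i ≈ 0#) → sum t ≈ 0#
    sum-zero {n} t h = trans (sum-cong-≋ h) (sum-replicate-zero n)

    expansion : ∀ m x y → p ≡ suc m → (x + y) ^ suc m ≈ x ^ suc m + y ^ suc m
    expansion m x y eq = begin
      (x + y) ^ suc m                  ≈⟨ theorem (suc m) x y ⟩
      T Fin.zero + sum (T ∘ Fin.suc)   ≈⟨ +-cong first (sum-init-last (T ∘ Fin.suc)) ⟩
      y ^ suc m + (sum (λ i → T (Fin.suc (inject₁ i))) + T (Fin.suc (fromℕ m)))
                                       ≈⟨ +-congˡ (+-cong (sum-zero _ middle) (last″ (suc (toℕ (fromℕ m))) (≡.cong suc (Fin.toℕ-fromℕ m)))) ⟩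
      y ^ suc m + (0# + x ^ suc m)     ≈⟨ +-comm _ _ ⟩
      0# + x ^ suc m + y ^ suc m       ≈⟨ +-congʳ (+-identityˡ _) ⟩
      x ^ suc m + y ^ suc m            ∎
      where
      T : Vector Carrier (suc (suc m))
      T = binomialTerm x y (suc m)
      first : T Fin.zero ≈ y ^ suc m
      first = trans (×-homo-1 _) (*-identityˡ _)
      middle : ∀ i → T (Fin.suc (inject₁ i)) ≈ 0#
      middle i = char∣ (≡.subst (λ n → p ℕ.∣ n choose suc (toℕ (inject₁ i))) eq (p∣pCk pr _ (s≤s z≤n)
        (≡.subst (suc (toℕ (inject₁ i)) ℕ.<_) (≡.sym eq) (s≤s (≡.subst (ℕ._< m) (≡.sym (Fin.toℕ-inject₁ i)) (Fin.toℕ<n i)))))) _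
      last″ : ∀ j → j ≡ suc m → (suc m choose j) · (x ^ j * y ^ (suc m ℕ.∸ j)) ≈ x ^ suc m
      last″ j ≡.refl = begin
        (suc m choose suc m) · (x ^ suc m * y ^ (m ℕ.∸ m)) ≈⟨ ×-cong (nCn≡1 (suc m)) (*-congˡ (^-congʳ y (ℕ.n∸n≡0 m))) ⟩
        1 · (x ^ suc m * 1#) ≈⟨ ×-homo-1 _ ⟩
        x ^ suc m * 1# ≈⟨ *-identityʳ _ ⟩
        x ^ suc m ∎

    frobenius-+ : ∀ x y → (x + y) ^ p ≈ x ^ p + y ^ p
    frobenius-+ x y = go p ≡.refl
      where
      go : ∀ n → p ≡ n → (x + y) ^ n ≈ x ^ n + y ^ n
      go zero eq = contradiction eq (ℕ.≢-nonZero⁻¹ p {{prime⇒nonZero pr}})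
      go (suc m) eq = expansion m x y eq

    0^p : 0# ^ p ≈ 0#
    0^p = go p ≡.refl
      where
      go : ∀ n → p ≡ n → 0# ^ n ≈ 0#
      go zero eq = contradiction eq (ℕ.≢-nonZero⁻¹ p {{prime⇒nonZero pr}})
      go (suc m) _ = zeroˡ _

    frobenius-sum : ∀ {n} (t : Vector Carrier n) → sum t ^ p ≈ sum (λ i → t i ^ p)
    frobenius-sum {zero} t = 0^p
    frobenius-sum {suc n} t = trans (frobenius-+ _ _) (+-congˡ (frobenius-sum (t ∘ Fin.suc)))

-- Quotients of a commutative ring by a principal ideal

module _ (R : CommutativeRing 0ℓ 0ℓ) where
  open CommutativeRing R
  private
    open import Algebra.Properties.Ring ring using (-‿+-comm; -‿distribʳ-*)
    open import Algebra.Solver.Ring.NaturalCoefficients.Default commutativeSemiring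
      using (solve; _:+_; _:*_; _:=_)
    add-step : ∀ m x y z w → (x + m * z) + (y + m * w) ≈ (x + y) + m * (z + w)
    add-step = solve 5 (λ m x y z w → ((x :+ m :* z) :+ (y :+ m :* w)) := ((x :+ y) :+ m :* (z :+ w))) refl
    sub-step : ∀ m x z → x ≈ (x + m * z) + m * (- z)
    sub-step m x z = sym (trans (+-assoc _ _ _) (trans (+-congˡ (trans (sym (distribˡ m z (- z)))
      (trans (*-congˡ (-‿inverseʳ z)) (zeroʳ m)))) (+-identityʳ x)))
    trans-step : ∀ m x z w → (x + m * z) + m * w ≈ x + m * (w + z)
    trans-step = solve 4 (λ m x z w → ((x :+ m :* z) :+ m :* w) := (x :+ m :* (w :+ z))) refl
    neg-step : ∀ m x z → - (x + m * z) ≈ - x + m * (- z)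
    neg-step m x z = trans (sym (-‿+-comm x (m * z))) (+-congˡ (-‿distribʳ-* m z))
    mul-step : ∀ m x y z w → (x + m * z) * (y + m * w) ≈ x * y + m * (x * w + y * z + m * z * w)
    mul-step = solve 5 (λ m x y z w → ((x :+ m :* z) :* (y :+ m :* w)) := (x :* y :+ m :* (x :* w :+ y :* z :+ m :* z :* w))) refl
    refl-step : ∀ m x → x ≈ x + m * 0#
    refl-step m x = sym (trans (+-congˡ (zeroʳ m)) (+-identityʳ x))

  infix 4 _≈_[mod_]
  -- A congruence carries its quotient, so that matching on `_by_` yields an exact equation. The
  -- same relation serves ℤ, ℤ[ω] and the convolution algebra.
  record _≈_[mod_] (x y m : Carrier) : Set where
    constructor _by_
    field
      quotient : Carrier
      equation : x ≈ y + m * quotient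

  infixl 7 _/⟨_⟩
  -- Only equality is coarsened. Carrier and operations stay those of R, so elements pass to the
  -- quotient without a projection.
  _/⟨_⟩ : Carrier → CommutativeRing 0ℓ 0ℓ
  _/⟨_⟩ m = record
    { Carrier = Carrier ; _≈_ = λ x y → x ≈ y [mod m ] ; _+_ = _+_ ; _*_ = _*_ ; -_ = -_ ; 0# = 0# ; 1# = 1#
    ; isCommutativeRing = record
      { isRing = record
        { +-isAbelianGroup = record
          { isGroup = record
            { isMonoid = record
              { isSemigroup = record
                { isMagma = record
                  { isEquivalence = record { refl = up refl ; sym = ~sym ; trans = ~trans }
                  ; ∙-cong = λ (z by p) (w by q) → (z + w) by trans (+-cong p q) (add-step _ _ _ _ _) }
                ; assoc = λ x y z → up (+-assoc x y z) }
              ; identity = (λ x → up (+-identityˡ x)) , (λ x → up (+-identityʳ x)) }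
            ; inverse = (λ x → up (-‿inverseˡ x)) , (λ x → up (-‿inverseʳ x))
            ; ⁻¹-cong = λ (z by p) → (- z) by trans (-‿cong p) (neg-step _ _ _) }
          ; comm = λ x y → up (+-comm x y) }
        ; *-cong = λ (z by p) (w by q) → _ by trans (*-cong p q) (mul-step _ _ _ _ _)
        ; *-assoc = λ x y z → up (*-assoc x y z)
        ; *-identity = (λ x → up (*-identityˡ x)) , (λ x → up (*-identityʳ x))
        ; distrib = (λ x y z → up (distribˡ x y z)) , (λ x y z → up (distribʳ x y z)) }
      ; *-comm = λ x y → up (*-comm x y) } }
    where
    infix 4 _~_
    _~_ : Carrier → Carrier → Set
    x ~ y = x ≈ y [mod m ]
    up : ∀ {x y} → x ≈ y → x ~ y
    up e = 0# by trans e (refl-step _ _)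
    ~sym : ∀ {x y} → x ~ y → y ~ x
    ~sym (z by e) = (- z) by trans (sub-step _ _ _) (+-congʳ (sym e))
    ~trans : ∀ {x y z} → x ~ y → y ~ z → x ~ z
    ~trans (a by p) (b by q) = _ by trans p (trans (+-congʳ q) (trans-step _ _ _ _))

module Quotient (R : CommutativeRing 0ℓ 0ℓ) (m : CommutativeRing.Carrier R) where
  private
    module R where
      open CommutativeRing R public
      open import Algebra.Properties.Semiring.Exp semiring public
      open import Algebra.Properties.Semiring.Mult semiring public renaming (_×_ to _·_)
      open import Algebra.Properties.Semiring.Sum semiring public
    module Q where
      open CommutativeRing (R /⟨ m ⟩) public
      open import Algebra.Properties.Semiring.Exp semiring public
      open import Algebra.Properties.Semiring.Mult semiring public renaming (_×_ to _·_)
      open import Algebra.Properties.Semiring.Sum semiring public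

    -- The operations of the quotient ring agree with those of R only propositionally.
    ^-quotient : ∀ x n → x Q.^ n ≡ x R.^ n
    ^-quotient x zero = ≡.refl
    ^-quotient x (suc n) = ≡.cong (x R.*_) (^-quotient x n)

    ·-quotient : ∀ n x → n Q.· x ≡ n R.· x
    ·-quotient zero x = ≡.refl
    ·-quotient (suc n) x = ≡.cong (x R.+_) (·-quotient n x)

    sum-quotient : ∀ {n} (t u : Vector R.Carrier n) → (∀ i → t i ≡ u i) → Q.sum t ≡ R.sum u
    sum-quotient {zero} t u e = ≡.refl
    sum-quotient {suc n} t u e = ≡.cong₂ R._+_ (e Fin.zero) (sum-quotient _ _ (e ∘ Fin.suc))

  open CommutativeRing (R /⟨ m ⟩) public

  ≈-reflexive : ∀ {x y} → x R.≈ y → x ≈ y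
  ≈-reflexive {x} {y} e = 0# by R.trans e (R.sym (R.trans (R.+-congˡ (R.zeroʳ m)) (R.+-identityʳ y)))

  ^-cong-≈ : ∀ {x y} n → x ≈ y → x R.^ n ≈ y R.^ n
  ^-cong-≈ {x} {y} n e = ≡.subst₂ _≈_ (^-quotient x n) (^-quotient y n) (Q.^-congˡ n e)

  module _ {p : ℕ} (pr : Prime p) (char : ∀ x → p R.· x R.≈ m R.* x) where
    private
      char′ : ∀ x → p Q.· x ≈ 0#
      char′ x = x by R.trans (R.reflexive (·-quotient p x)) (R.trans (char x) (R.sym (R.+-identityˡ _)))

    -- By `char` multiplication by m is multiplication by p, so the quotient by m has characteristic
    -- p.
    freshman : ∀ x y → (x + y) R.^ p ≈ x R.^ p + y R.^ p
    freshman x y = ≡.subst₂ _≈_ (^-quotient _ p) (≡.cong₂ _+_ (^-quotient x p) (^-quotient y p))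
      (Frobenius.frobenius-+ (R /⟨ m ⟩) pr char′ x y)

    freshman-sum : ∀ {n} (t : Vector Carrier n) → R.sum t R.^ p ≈ R.sum (λ i → t i R.^ p)
    freshman-sum t = ≡.subst₂ _≈_
      (≡.trans (^-quotient _ p) (≡.cong (R._^ p) (sum-quotient t t (λ _ → ≡.refl))))
      (sum-quotient _ _ (λ i → ^-quotient (t i) p))
      (Frobenius.frobenius-sum (R /⟨ m ⟩) pr char′ t)

open import Defs
open import Data.Integer using (ℤ; +_; -[1+_]; -_; _+_; _-_; _*_; _^_; _<_; ∣_∣; 0ℤ; 1ℤ)
import Data.Integer as ℤ
import Data.Integer.Properties as ℤ
open import Data.Integer.Divisibility using (_∣_)
import Data.Integer.Divisibility.Signed as Signed
import Data.Integer.DivMod as ℤ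
open import Data.Integer.DivMod using (_/_)
open import Data.Integer.Tactic.RingSolver using () renaming (solve-∀ to ℤ-solve)
open import Data.Maybe.Base using (just; nothing)
open import Relation.Binary.PropositionalEquality using (refl; sym; trans; cong; cong₂; subst; subst₂; module ≡-Reasoning)
open import Relation.Nullary.Decidable using (does; ¬?; decidable-stable; toWitness; dec-true; dec-false)
open import Tactic.RingSolver using (solve-∀)
open import Tactic.RingSolver.Core.AlmostCommutativeRing using (fromCommutativeRing; AlmostCommutativeRing)
open import Data.Nat.Primality.Factorisation using (PrimeFactorisation; factorise)
open import Data.List.Base using ([]; _∷_)
open import Data.Nat.ListAction using (product)
open import Data.List.Relation.Unary.All using (All; []; _∷_)

-- Eisenstein integers

-- ⟨ a , b ⟩ is a + b ω with ω² = - 1 - ω. The fields are coordinates in the basis 1, ω; in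
-- particular `im` is not an imaginary part.
record Eisenstein : Set where
  no-eta-equality
  pattern
  constructor ⟨_,_⟩
  field re im : ℤ
open Eisenstein public

infixl 6 _⊕_
infixl 7 _⊗_
infix 8 ⊖_

_⊕_ _⊗_ : Eisenstein → Eisenstein → Eisenstein
⟨ a , b ⟩ ⊕ ⟨ c , d ⟩ = ⟨ a + c , b + d ⟩
⟨ a , b ⟩ ⊗ ⟨ c , d ⟩ = ⟨ a * c - b * d , a * d + b * c - b * d ⟩

⊖_ conj : Eisenstein → Eisenstein
⊖ ⟨ a , b ⟩ = ⟨ - a , - b ⟩
conj ⟨ a , b ⟩ = ⟨ a - b , - b ⟩

ι : ℤ → Eisenstein
ι a = ⟨ a , 0ℤ ⟩

𝟘 𝟙 ω : Eisenstein
𝟘 = ι 0ℤ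
𝟙 = ι 1ℤ
ω = ⟨ 0ℤ , 1ℤ ⟩

norm : Eisenstein → ℤ
norm ⟨ a , b ⟩ = a * a - a * b + b * b

private
  mul-assoc-re : ∀ a b c d e f → (a * c - b * d) * e - (a * d + b * c - b * d) * f
    ≡ a * (c * e - d * f) - b * (c * f + d * e - d * f)
  mul-assoc-re = ℤ-solve
  mul-assoc-im : ∀ a b c d e f →
    (a * c - b * d) * f + (a * d + b * c - b * d) * e - (a * d + b * c - b * d) * f
    ≡ a * (c * f + d * e - d * f) + b * (c * e - d * f) - b * (c * f + d * e - d * f)
  mul-assoc-im = ℤ-solve
  mul-comm-re : ∀ a b c d → a * c - b * d ≡ c * a - d * b
  mul-comm-re = ℤ-solve
  mul-comm-im : ∀ a b c d → a * d + b * c - b * d ≡ c * b + d * a - d * b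
  mul-comm-im = ℤ-solve
  dist-re : ∀ a b c d e f → a * (c + e) - b * (d + f) ≡ (a * c - b * d) + (a * e - b * f)
  dist-re = ℤ-solve
  dist-im : ∀ a b c d e f → a * (d + f) + b * (c + e) - b * (d + f)
    ≡ (a * d + b * c - b * d) + (a * f + b * e - b * f)
  dist-im = ℤ-solve
  one-re : ∀ a b → 1ℤ * a - 0ℤ * b ≡ a
  one-re = ℤ-solve
  one-im : ∀ a b → 1ℤ * b + 0ℤ * a - 0ℤ * b ≡ b
  one-im = ℤ-solve

⊗-comm : ∀ x y → x ⊗ y ≡ y ⊗ x
⊗-comm ⟨ a , b ⟩ ⟨ c , d ⟩ = cong₂ ⟨_,_⟩ (mul-comm-re a b c d) (mul-comm-im a b c d)

⊗-distribˡ : ∀ x y z → x ⊗ (y ⊕ z) ≡ x ⊗ y ⊕ x ⊗ z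
⊗-distribˡ ⟨ a , b ⟩ ⟨ c , d ⟩ ⟨ e , f ⟩ = cong₂ ⟨_,_⟩ (dist-re a b c d e f) (dist-im a b c d e f)

⊗-identityˡ : ∀ x → 𝟙 ⊗ x ≡ x
⊗-identityˡ ⟨ a , b ⟩ = cong₂ ⟨_,_⟩ (one-re a b) (one-im a b)

𝔼 : CommutativeRing 0ℓ 0ℓ
𝔼 = record
  { Carrier = Eisenstein ; _≈_ = _≡_ ; _+_ = _⊕_ ; _*_ = _⊗_ ; -_ = ⊖_ ; 0# = 𝟘 ; 1# = 𝟙
  ; isCommutativeRing = record
    { isRing = record
      { +-isAbelianGroup = record
        { isGroup = record
          { isMonoid = record
            { isSemigroup = record
              { isMagma = record { isEquivalence = Relation.Binary.PropositionalEquality.isEquivalence ; ∙-cong = cong₂ _⊕_ }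
              ; assoc = λ { ⟨ a , b ⟩ ⟨ c , d ⟩ ⟨ e , f ⟩ → cong₂ ⟨_,_⟩ (ℤ.+-assoc a c e) (ℤ.+-assoc b d f) } }
            ; identity = (λ { ⟨ a , b ⟩ → cong₂ ⟨_,_⟩ (ℤ.+-identityˡ a) (ℤ.+-identityˡ b) })
                       , (λ { ⟨ a , b ⟩ → cong₂ ⟨_,_⟩ (ℤ.+-identityʳ a) (ℤ.+-identityʳ b) }) }
          ; inverse = (λ { ⟨ a , b ⟩ → cong₂ ⟨_,_⟩ (ℤ.+-inverseˡ a) (ℤ.+-inverseˡ b) })
                    , (λ { ⟨ a , b ⟩ → cong₂ ⟨_,_⟩ (ℤ.+-inverseʳ a) (ℤ.+-inverseʳ b) })
          ; ⁻¹-cong = cong ⊖_ }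
        ; comm = λ { ⟨ a , b ⟩ ⟨ c , d ⟩ → cong₂ ⟨_,_⟩ (ℤ.+-comm a c) (ℤ.+-comm b d) } }
      ; *-cong = cong₂ _⊗_
      ; *-assoc = λ { ⟨ a , b ⟩ ⟨ c , d ⟩ ⟨ e , f ⟩ →
          cong₂ ⟨_,_⟩ (mul-assoc-re a b c d e f) (mul-assoc-im a b c d e f) }
      ; *-identity = ⊗-identityˡ , (λ x → trans (⊗-comm x 𝟙) (⊗-identityˡ x))
      ; distrib = ⊗-distribˡ , (λ x y z → trans (⊗-comm (y ⊕ z) x)
          (trans (⊗-distribˡ x y z) (cong₂ _⊕_ (⊗-comm x y) (⊗-comm x z)))) }
    ; *-comm = ⊗-comm } }

𝔼-acr : AlmostCommutativeRing 0ℓ 0ℓ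
𝔼-acr = fromCommutativeRing 𝔼 λ { ⟨ + 0 , + 0 ⟩ → just refl ; _ → nothing }


-- Convolution of functions on ℤ/q

module E where
  open CommutativeRing 𝔼 public
  open import Algebra.Properties.Semiring.Exp semiring public
  open import Algebra.Properties.CommutativeSemiring.Exp commutativeSemiring public using (^-distrib-*)
  open import Algebra.Properties.Semiring.Sum semiring public

infix 4 _≋_[_]
_≋_[_] : ℤ → ℤ → ℤ → Set
a ≋ b [ q ] = _≈_[mod_] ℤ.+-*-commutativeRing a b q

module ℤ/ (q : ℤ) = Quotient ℤ.+-*-commutativeRing q

residue-unique : ∀ {q r r′} → r ℕ.< q → r′ ℕ.< q → + r ≋ + r′ [ + q ] → r ≡ r′
residue-unique {q} {r} {r′} r<q r′<q ((+ zero) by e) =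
  ℤ.+-injective (trans e (trans (cong (_+_ (+ r′)) (ℤ.*-zeroʳ (+ q))) (ℤ.+-identityʳ (+ r′))))
residue-unique {q} {r} {r′} r<q r′<q ((+ suc z) by e) = contradiction r<q (ℕ.≤⇒≯ (subst (q ℕ.≤_) (sym eq) (ℕ.≤-trans (ℕ.m≤m*n q (suc z)) (ℕ.m≤n+m _ r′))))
  where
  eq : r ≡ r′ ℕ.+ q ℕ.* suc z
  eq = ℤ.+-injective (trans e (cong (_+_ (+ r′)) (sym (ℤ.pos-* q (suc z)))))
residue-unique {q} {r} {r′} r<q r′<q (-[1+ z ] by e) = contradiction r′<q (ℕ.≤⇒≯ (subst (q ℕ.≤_) (sym eq) (ℕ.≤-trans (ℕ.m≤m*n q (suc z)) (ℕ.m≤n+m _ r))))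
  where
  flip : ∀ a b c → b ≡ (b + a * (- c)) + a * c
  flip = ℤ-solve
  eq : r′ ≡ r ℕ.+ q ℕ.* suc z
  eq = ℤ.+-injective (trans (flip (+ q) (+ r′) (+ suc z)) (trans (cong (_+ + q * + suc z) (sym e)) (cong (_+_ (+ r)) (sym (ℤ.pos-* q (suc z))))))

sum-single : ∀ {n} (t : Vector Eisenstein n) j → (∀ i → i ≢ j → t i ≡ 𝟘) → E.sum t ≡ t j
sum-single {suc n} t j h = begin
  E.sum t                       ≡⟨ E.sum-remove {i = j} t ⟩
  t j ⊕ E.sum (removeAt t j)    ≡⟨ cong (t j ⊕_) (trans (E.sum-cong-≗ (λ i → h (punchIn j i) (λ e → Fin.punchInᵢ≢i j i e))) (E.sum-replicate-zero n)) ⟩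
  t j ⊕ 𝟘                       ≡⟨ E.+-identityʳ (t j) ⟩
  t j ∎
  where open ≡-Reasoning

module Residues (q : ℕ) .{{q≢0 : NonZero q}} where
  open ℤ/ (+ q) using () renaming (_≈_ to _~_; refl to ~refl; sym to ~sym; trans to ~trans; +-cong to ~+; -‿cong to ~neg)

  res : ℤ → Fin q
  res a = fromℕ< (ℤ.n%ℕd<d a q)

  rep : Fin q → ℤ
  rep i = + toℕ i

  rep-res : ∀ a → a ~ rep (res a)
  rep-res a = (a ℤ./ℕ q) by trans (ℤ.a≡a%ℕn+[a/ℕn]*n a q) (cong₂ _+_ (cong +_ (sym (Fin.toℕ-fromℕ< _))) (ℤ.*-comm (a ℤ./ℕ q) (+ q)))

  rep-injective : ∀ {i j} → rep i ~ rep j → i ≡ j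
  rep-injective {i} {j} e = Fin.toℕ-injective (residue-unique (Fin.toℕ<n i) (Fin.toℕ<n j) e)

  res-cong : ∀ {a b} → a ~ b → res a ≡ res b
  res-cong {a} {b} e = rep-injective (~trans (~sym (rep-res a)) (~trans e (rep-res b)))

  res-inj : ∀ {a b} → res a ≡ res b → a ~ b
  res-inj {a} {b} e = ~trans (rep-res a) (subst (λ i → rep i ~ b) (sym e) (~sym (rep-res b)))

  res-rep : ∀ i → res (rep i) ≡ i
  res-rep i = rep-injective (~sym (rep-res (rep i)))

  sub-congˡ : ∀ c {a b} → a ~ b → a - c ~ b - c
  sub-congˡ c e = ~+ e (~refl { - c})

  sub-congʳ : ∀ c {a b} → a ~ b → c - a ~ c - b
  sub-congʳ c {a} {b} e = ~+ {c} {c} { - a} { - b} ~refl (~neg e)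

  Periodic : ∀ {A : Set} → (ℤ → A) → Set
  Periodic f = ∀ {a b} → a ~ b → f a ≡ f b

  residue-permutation : (σ τ : ℤ → ℤ) → (∀ {a b} → a ~ b → σ a ~ σ b) → (∀ {a b} → a ~ b → τ a ~ τ b) →
    (∀ a → σ (τ a) ~ a) → (∀ a → τ (σ a) ~ a) → Permutation′ q
  residue-permutation σ τ σ-cong τ-cong στ τσ = permutation (res ∘ σ ∘ rep) (res ∘ τ ∘ rep)
    (λ i → trans (res-cong (~trans (σ-cong (~sym (rep-res (τ (rep i))))) (στ (rep i)))) (res-rep i))
    (λ i → trans (res-cong (~trans (τ-cong (~sym (rep-res (σ (rep i))))) (τσ (rep i)))) (res-rep i))

  _~?_ : ∀ a b → Dec (a ~ b)
  a ~? b with res a Fin.≟ res b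
  ... | yes e = yes (res-inj e)
  ... | no ne = no (λ e → ne (res-cong e))

  opaque
    ∑ : (ℤ → Eisenstein) → Eisenstein
    ∑ f = E.sum (f ∘ rep)

    ∑-cong : ∀ {f g} → (∀ a → f a ≡ g a) → ∑ f ≡ ∑ g
    ∑-cong h = E.sum-cong-≗ (λ i → h (rep i))

    ∑-+ : ∀ f g → ∑ (λ a → f a ⊕ g a) ≡ ∑ f ⊕ ∑ g
    ∑-+ f g = E.∑-distrib-+ (f ∘ rep) (g ∘ rep)

    ∑-*ˡ : ∀ c f → c ⊗ ∑ f ≡ ∑ (λ a → c ⊗ f a)
    ∑-*ˡ c f = E.*-distribˡ-sum c (f ∘ rep)

    ∑-*ʳ : ∀ c f → ∑ f ⊗ c ≡ ∑ (λ a → f a ⊗ c)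
    ∑-*ʳ c f = E.*-distribʳ-sum c (f ∘ rep)

    ∑-swap : ∀ (f : ℤ → ℤ → Eisenstein) → ∑ (λ a → ∑ (λ b → f a b)) ≡ ∑ (λ b → ∑ (λ a → f a b))
    ∑-swap f = E.∑-comm (λ i j → f (rep i) (rep j))

    ∑-single : ∀ {f} → Periodic f → ∀ c → (∀ a → ¬ a ~ c → f a ≡ 𝟘) → ∑ f ≡ f c
    ∑-single {f} pf c h = trans (sum-single (f ∘ rep) (res c)
      (λ i i≢ → h (rep i) λ e → i≢ (trans (sym (res-rep i)) (res-cong e)))) (pf (~sym (rep-res c)))

    ∑-reindex : ∀ {f} → Periodic f → (σ τ : ℤ → ℤ) → (∀ {a b} → a ~ b → σ a ~ σ b) → (∀ {a b} → a ~ b → τ a ~ τ b) →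
      (∀ a → σ (τ a) ~ a) → (∀ a → τ (σ a) ~ a) → ∑ f ≡ ∑ (f ∘ σ)
    ∑-reindex {f} pf σ τ σ-cong τ-cong στ τσ = trans (E.sum-permute (f ∘ rep) (residue-permutation σ τ σ-cong τ-cong στ τσ))
      (E.sum-cong-≗ (λ i → pf (~sym (rep-res (σ (rep i))))))

  ∑-shift : ∀ {f} → Periodic f → ∀ c → ∑ f ≡ ∑ (λ a → f (a - c))
  ∑-shift pf c = ∑-reindex pf (_- c) (_+ c) (sub-congˡ c) (λ e → ~+ e (~refl {c}))
    (λ a → ℤ/.reflexive (+ q) (lem₁ a c)) (λ a → ℤ/.reflexive (+ q) (lem₂ a c))
    where
    lem₁ : ∀ a c → (a + c) - c ≡ a
    lem₁ = ℤ-solve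
    lem₂ : ∀ a c → (a - c) + c ≡ a
    lem₂ = ℤ-solve

  ∑-reflect : ∀ {f} → Periodic f → ∀ c → ∑ f ≡ ∑ (λ a → f (c - a))
  ∑-reflect pf c = ∑-reindex pf (λ a → c - a) (λ a → c - a) (sub-congʳ c) (sub-congʳ c)
    (λ a → ℤ/.reflexive (+ q) (lem a c)) (λ a → ℤ/.reflexive (+ q) (lem a c))
    where
    lem : ∀ a c → c - (c - a) ≡ a
    lem = ℤ-solve

  opaque
    δ : ℤ → ℤ → Eisenstein
    δ c a = if does (res a Fin.≟ res c) then 𝟙 else 𝟘

    δ-yes : ∀ {c a} → a ~ c → δ c a ≡ 𝟙
    δ-yes {c} {a} e with res a Fin.≟ res c
    ... | yes _ = refl
    ... | no ne = contradiction (res-cong e) ne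

    δ-no : ∀ {c a} → ¬ a ~ c → δ c a ≡ 𝟘
    δ-no {c} {a} ne with res a Fin.≟ res c
    ... | yes e = contradiction (res-inj e) ne
    ... | no _ = refl

    δ-periodic : ∀ c → Periodic (δ c)
    δ-periodic c {a} {b} e = cong (λ i → if does (i Fin.≟ res c) then 𝟙 else 𝟘) (res-cong e)

  δ-sym : ∀ a b → δ a b ≡ δ b a
  δ-sym a b with a ~? b
  ... | yes e = trans (δ-yes (~sym e)) (sym (δ-yes e))
  ... | no ne = trans (δ-no (λ e → ne (~sym e))) (sym (δ-no ne))

  -- A function on ℤ/q is kept as a q-periodic function on ℤ, so that arguments such as t - a need
  -- no reduction.
  record Fun : Set where
    constructor fun
    field
      at       : ℤ → Eisenstein
      periodic : Periodic at
  open Fun public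

  infixl 7 _⋆_
  opaque
    _⋆_ : Fun → Fun → Fun
    f ⋆ g = fun (λ t → ∑ (λ a → at f a ⊗ at g (t - a)))
      (λ e → ∑-cong (λ a → cong (at f a ⊗_) (periodic g (sub-congˡ a e))))

    at-⋆ : ∀ f g t → at (f ⋆ g) t ≡ ∑ (λ a → at f a ⊗ at g (t - a))
    at-⋆ f g t = refl

  δᶠ : ℤ → Fun
  δᶠ c = fun (δ c) (δ-periodic c)

  infixl 6 _⊞_
  _⊞_ : Fun → Fun → Fun
  f ⊞ g = fun (λ t → at f t ⊕ at g t) (λ e → cong₂ _⊕_ (periodic f e) (periodic g e))

  ⊟_ : Fun → Fun
  ⊟ f = fun (λ t → ⊖ at f t) (λ e → cong ⊖_ (periodic f e))

  0ᶠ : Fun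
  0ᶠ = fun (λ _ → 𝟘) (λ _ → refl)

  infix 4 _≗_
  record _≗_ (f g : Fun) : Set where
    constructor pw
    field
      at≡ : ∀ t → at f t ≡ at g t
  open _≗_ public

  shift-periodic : ∀ (f : Fun) c → Periodic (λ a → at f (c - a))
  shift-periodic f c e = periodic f (sub-congʳ c e)

  product-periodic : ∀ {f g : ℤ → Eisenstein} → Periodic f → Periodic g → Periodic (λ a → f a ⊗ g a)
  product-periodic pf pg e = cong₂ _⊗_ (pf e) (pg e)

  opaque
    unfolding _⋆_

    ⋆-comm : ∀ f g → f ⋆ g ≗ g ⋆ f
    at≡ (⋆-comm f g) t = trans (∑-reflect (product-periodic (periodic f) (shift-periodic g t)) t)
      (∑-cong λ a → trans (⊗-comm _ _) (cong (λ b → at g b ⊗ at f (t - a)) (lem t a)))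
      where
      lem : ∀ t a → t - (t - a) ≡ a
      lem = ℤ-solve

    δ-⋆ : ∀ c f t → at (δᶠ c ⋆ f) t ≡ at f (t - c)
    δ-⋆ c f t = trans (∑-single (product-periodic (periodic (δᶠ c)) (shift-periodic f t)) c
      (λ a ne → trans (cong (_⊗ at f (t - a)) (δ-no ne)) (E.zeroˡ _)))
      (trans (cong (_⊗ at f (t - c)) (δ-yes ~refl)) (⊗-identityˡ _))

    ⋆-assoc : ∀ f g h → (f ⋆ g) ⋆ h ≗ f ⋆ (g ⋆ h)
    at≡ (⋆-assoc f g h) t = begin
      ∑ (λ b → ∑ (λ a → at f a ⊗ at g (b - a)) ⊗ at h (t - b))
        ≡⟨ ∑-cong (λ b → trans (∑-*ʳ _ _) (∑-cong (λ a → E.*-assoc _ _ _))) ⟩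
      ∑ (λ b → ∑ (λ a → at f a ⊗ (at g (b - a) ⊗ at h (t - b))))
        ≡⟨ ∑-swap _ ⟩
      ∑ (λ a → ∑ (λ b → at f a ⊗ (at g (b - a) ⊗ at h (t - b))))
        ≡⟨ ∑-cong (λ a → sym (trans (cong (at f a ⊗_) (inner a)) (∑-*ˡ _ _))) ⟩
      ∑ (λ a → at f a ⊗ ∑ (λ c → at g c ⊗ at h (t - a - c))) ∎
      where
      open ≡-Reasoning
      lem : ∀ t a b → t - a - (b - a) ≡ t - b
      lem = ℤ-solve
      inner : ∀ a → ∑ (λ c → at g c ⊗ at h (t - a - c)) ≡ ∑ (λ b → at g (b - a) ⊗ at h (t - b))
      inner a = trans (∑-shift (product-periodic (periodic g) (shift-periodic h (t - a))) a)
        (∑-cong (λ b → cong (λ s → at g (b - a) ⊗ at h s) (lem t a b)))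

  ⋆-identityˡ : ∀ f → δᶠ 0ℤ ⋆ f ≗ f
  at≡ (⋆-identityˡ f) t = trans (δ-⋆ 0ℤ f t) (cong (at f) (ℤ.+-identityʳ t))

  opaque
    unfolding _⋆_

    ⋆-distribˡ : ∀ f g h → f ⋆ (g ⊞ h) ≗ f ⋆ g ⊞ f ⋆ h
    at≡ (⋆-distribˡ f g h) t = trans (∑-cong (λ a → ⊗-distribˡ (at f a) _ _)) (∑-+ _ _)

    ⋆-cong : ∀ {f f′ g g′} → f ≗ f′ → g ≗ g′ → f ⋆ g ≗ f′ ⋆ g′
    at≡ (⋆-cong e e′) t = ∑-cong (λ a → cong₂ _⊗_ (at≡ e a) (at≡ e′ (t - a)))

  groupRing : CommutativeRing 0ℓ 0ℓ
  groupRing = record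
    { Carrier = Fun ; _≈_ = _≗_ ; _+_ = _⊞_ ; _*_ = _⋆_ ; -_ = ⊟_ ; 0# = 0ᶠ ; 1# = δᶠ 0ℤ
    ; isCommutativeRing = record
      { isRing = record
        { +-isAbelianGroup = record
          { isGroup = record
            { isMonoid = record
              { isSemigroup = record
                { isMagma = record
                  { isEquivalence = record
                    { refl = pw λ _ → refl ; sym = λ e → pw λ t → sym (at≡ e t)
                    ; trans = λ e e′ → pw λ t → trans (at≡ e t) (at≡ e′ t) }
                  ; ∙-cong = λ e e′ → pw λ t → cong₂ _⊕_ (at≡ e t) (at≡ e′ t) }
                ; assoc = λ f g h → pw λ t → E.+-assoc (at f t) _ _ }
              ; identity = (λ f → pw λ t → E.+-identityˡ _) , (λ f → pw λ t → E.+-identityʳ _) }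
            ; inverse = (λ f → pw λ t → E.-‿inverseˡ (at f t)) , (λ f → pw λ t → E.-‿inverseʳ (at f t))
            ; ⁻¹-cong = λ e → pw λ t → cong ⊖_ (at≡ e t) }
          ; comm = λ f g → pw λ t → E.+-comm (at f t) _ }
        ; *-cong = ⋆-cong
        ; *-assoc = ⋆-assoc
        ; *-identity = ⋆-identityˡ , (λ f → pw λ t → trans (at≡ (⋆-comm f (δᶠ 0ℤ)) t) (at≡ (⋆-identityˡ f) t))
        ; distrib = ⋆-distribˡ , (λ f g h → pw λ t → trans (at≡ (⋆-comm (g ⊞ h) f) t)
            (trans (at≡ (⋆-distribˡ f g h) t) (cong₂ _⊕_ (at≡ (⋆-comm f g) t) (at≡ (⋆-comm f h) t)))) }
      ; *-comm = ⋆-comm } }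

  opaque
    unfolding _⋆_

    -- Scalars enter the convolution algebra as multiples of its unit `δᶠ 0ℤ`. Congruence modulo
    -- `κ (ι (+ ℓ))` then implies pointwise congruence modulo ℓ.
    κ : Eisenstein → Fun
    κ c = fun (λ t → c ⊗ δ 0ℤ t) (λ e → cong (c ⊗_) (periodic (δᶠ 0ℤ) e))

    κ-⋆ : ∀ c f t → at (κ c ⋆ f) t ≡ c ⊗ at f t
    κ-⋆ c f t = trans (∑-cong (λ a → E.*-assoc c _ _)) (trans (sym (∑-*ˡ c _)) (cong (c ⊗_) (at≡ (⋆-identityˡ f) t)))

    κ-1 : ∀ t → δ 0ℤ t ≡ at (κ 𝟙) t
    κ-1 t = sym (⊗-identityˡ _)

    κ-⊗ : ∀ x y → κ x ⋆ κ y ≗ κ (x ⊗ y)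
    at≡ (κ-⊗ x y) t = trans (κ-⋆ x (κ y) t) (sym (E.*-assoc x y _))

  module G where
    open CommutativeRing groupRing public
    open import Algebra.Properties.Semiring.Exp semiring public
    open import Algebra.Properties.Semiring.Sum semiring public
    open import Algebra.Properties.Semiring.Mult semiring public using () renaming (_×_ to _·_)
    open import Algebra.Properties.CommutativeSemiring.Exp commutativeSemiring public using (^-distrib-*)

  at-sum : ∀ {n} (F : Vector Fun n) t → at (G.sum F) t ≡ E.sum (λ i → at (F i) t)
  at-sum {zero} F t = refl
  at-sum {suc n} F t = cong (at (F Fin.zero) t ⊕_) (at-sum (F ∘ Fin.suc) t)

  opaque
    unfolding ∑
    at-∑ : ∀ (F : ℤ → Fun) t → at (G.sum (λ (i : Fin q) → F (rep i))) t ≡ ∑ (λ a → at (F a) t)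
    at-∑ F t = at-sum (λ i → F (rep i)) t

  -- `δᶠ c` is the class of c as a group element, so powers multiply c. This is how an ℓ-th power
  -- moves a value from a to ℓ a.
  δ^ : ∀ c n → δᶠ c G.^ n ≗ δᶠ (+ n * c)
  at≡ (δ^ c zero) t = cong (λ z → δ z t) (sym (ℤ.*-zeroˡ c))
  at≡ (δ^ c (suc n)) t = trans (δ-⋆ c (δᶠ c G.^ n) t) (trans (at≡ (δ^ c n) (t - c)) δ-shift)
    where
    lem : ∀ t c n → c + (n * c) ≡ (1ℤ + n) * c
    lem t = ℤ-solve
    lem₂ : ∀ t c → t ≡ (t - c) + c
    lem₂ = ℤ-solve
    lem₃ : ∀ c n → c + n * c - c ≡ n * c
    lem₃ = ℤ-solve
    up : t - c ~ + n * c → t ~ + suc n * c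
    up e = ~trans (ℤ/.reflexive (+ q) (trans (lem₂ t c) (ℤ.+-comm _ c))) (~trans (~+ (~refl {c}) e) (ℤ/.reflexive (+ q) (lem t c (+ n))))
    down : t ~ + suc n * c → t - c ~ + n * c
    down e = ~trans (~+ (~trans e (ℤ/.reflexive (+ q) (sym (lem t c (+ n))))) ~refl) (ℤ/.reflexive (+ q) (lem₃ c (+ n)))
    δ-shift : δ (+ n * c) (t - c) ≡ δ (+ suc n * c) t
    δ-shift with (t - c) ~? (+ n * c)
    ... | yes e = trans (δ-yes e) (sym (δ-yes (up e)))
    ... | no ne = trans (δ-no ne) (sym (δ-no (ne ∘ down)))

  κ^ : ∀ c n → κ c G.^ n ≗ κ (c E.^ n)
  at≡ (κ^ c zero) t = κ-1 t
  κ^ c (suc n) = G.trans (G.*-cong (G.refl {κ c}) (κ^ c n)) (κ-⊗ c (c E.^ n))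

  at-× : ∀ n f t → at (n G.· f) t ≡ ι (+ n) ⊗ at f t
  at-× zero f t = sym (E.zeroˡ _)
  at-× (suc n) f t = trans (cong₂ _⊕_ (sym (⊗-identityˡ _)) (at-× n f t)) (sym (E.distribʳ (at f t) 𝟙 (ι (+ n))))

  fun-decompose : ∀ f → f ≗ G.sum (λ (i : Fin q) → κ (at f (rep i)) ⋆ δᶠ (rep i))
  at≡ (fun-decompose f) t = sym (trans (at-∑ (λ a → κ (at f a) ⋆ δᶠ a) t)
    (trans (∑-cong {g = λ a → at f a ⊗ δ t a} (λ a → trans (κ-⋆ (at f a) (δᶠ a) t) (cong (at f a ⊗_) (δ-sym a t))))
    (trans (∑-single (product-periodic (periodic f) (δ-periodic t)) t
      (λ a ne → trans (cong (at f a ⊗_) (δ-no ne)) (E.zeroʳ _)))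
    (trans (cong (at f t ⊗_) (δ-yes ~refl)) (E.*-identityʳ _)))))

  module _ {ℓ : ℕ} (ℓ-prime : Prime ℓ) where
    power-sum : Fun → Fun
    power-sum f = G.sum (λ (i : Fin q) → κ (at f (rep i) E.^ ℓ) ⋆ δᶠ (+ ℓ * rep i))

    -- A function is the sum of its values times group elements, and modulo ℓ its ℓ-th power may be
    -- taken term by term.
    frobenius : ∀ f → _≈_[mod_] groupRing (f G.^ ℓ) (power-sum f) (κ (ι (+ ℓ)))
    frobenius f = M.trans (M.≈-reflexive (G.^-congˡ ℓ (fun-decompose f)))
      (M.trans (M.freshman-sum ℓ-prime char F) (M.≈-reflexive (G.sum-cong-≋ {n = q} λ i →
      G.trans (G.^-distrib-* (κ (at f (rep i))) (δᶠ (rep i)) ℓ) (G.*-cong (κ^ (at f (rep i)) ℓ) (δ^ (rep i) ℓ)))))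
      where
      module M = Quotient groupRing (κ (ι (+ ℓ)))
      char : ∀ x → ℓ G.· x ≗ κ (ι (+ ℓ)) ⋆ x
      at≡ (char x) t = trans (at-× ℓ x t) (sym (κ-⋆ (ι (+ ℓ)) x t))
      F : Vector Fun q
      F i = κ (at f (rep i)) ⋆ δᶠ (rep i)

    at-quotient : ∀ {f g} → _≈_[mod_] groupRing f g (κ (ι (+ ℓ))) → ∀ t → _≈_[mod_] 𝔼 (at f t) (at g t) (ι (+ ℓ))
    at-quotient {f} {g} (z by e) t = at z t by trans (at≡ e t) (cong (at g t ⊕_) (κ-⋆ (ι (+ ℓ)) z t))

    -- Since ℓ can be cancelled modulo q, the term a = t is the only one of `power-sum` that
    -- contributes at ℓ t.
    frobenius-at : ∀ f t → (∀ {a b} → + ℓ * a ~ + ℓ * b → a ~ b) →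
      _≈_[mod_] 𝔼 (at (f G.^ ℓ) (+ ℓ * t)) (at f t E.^ ℓ) (ι (+ ℓ))
    frobenius-at f t cancel = subst (λ x → _≈_[mod_] 𝔼 (at (f G.^ ℓ) s) x (ι (+ ℓ))) main (at-quotient (frobenius f) s)
      where
      s = + ℓ * t
      f^ : Fun
      f^ = fun (λ a → at f a E.^ ℓ) (λ e → cong (E._^ ℓ) (periodic f e))
      δℓ : ℤ → Eisenstein
      δℓ a = δ (+ ℓ * a) s
      δℓ-periodic : Periodic δℓ
      δℓ-periodic {a} {b} e = trans (δ-sym (+ ℓ * a) s) (trans (δ-periodic s (ℤ/.*-cong (+ q) (~refl {+ ℓ}) e)) (δ-sym s (+ ℓ * b)))
      main : at (power-sum f) s ≡ at f t E.^ ℓ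
      main = trans (at-∑ (λ a → κ (at f a E.^ ℓ) ⋆ δᶠ (+ ℓ * a)) s)
        (trans (∑-cong {g = λ a → at f^ a ⊗ δℓ a} (λ a → κ-⋆ (at f a E.^ ℓ) (δᶠ (+ ℓ * a)) s))
        (trans (∑-single (product-periodic (periodic f^) δℓ-periodic) t
          (λ a ne → trans (cong (at f^ a ⊗_) (δ-no (λ e → ne (~sym (cancel e))))) (E.zeroʳ _)))
        (trans (cong (at f^ t ⊗_) (δ-yes ~refl)) (E.*-identityʳ _))))


-- Integers modulo a prime

module _ {m : ℤ} where
  open ℤ/ m using () renaming (_≈_ to _~_; refl to ~refl; sym to ~sym; trans to ~trans)

  ∣⇒≋0 : ∀ {a} → m ∣ a → a ≋ 0ℤ [ m ]
  ∣⇒≋0 {a} m∣a with Signed.∣ᵤ⇒∣ m∣a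
  ... | Signed.divides k e = k by trans e (lem k m)
    where
    lem : ∀ k m → k * m ≡ 0ℤ + m * k
    lem = ℤ-solve

  ≋0⇒∣ : ∀ {a} → a ≋ 0ℤ [ m ] → m ∣ a
  ≋0⇒∣ (k by e) = Signed.∣⇒∣ᵤ (Signed.divides k (trans e (lem k m)))
    where
    lem : ∀ k m → 0ℤ + m * k ≡ k * m
    lem = ℤ-solve

  ∣-⇒≋ : ∀ {a b} → m ∣ a - b → a ≋ b [ m ]
  ∣-⇒≋ {a} {b} m∣ with ∣⇒≋0 m∣
  ... | k by e = k by trans (lem a b) (trans (cong (_+_ b) e) (cong (_+_ b) (ℤ.+-identityˡ (m * k))))
    where
    lem : ∀ a b → a ≡ b + (a - b)
    lem = ℤ-solve

  ≋⇒∣- : ∀ {a b} → a ≋ b [ m ] → m ∣ a - b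
  ≋⇒∣- {a} {b} (k by e) = ≋0⇒∣ (k by trans (cong (_- b) e) (lem b (m * k)))
    where
    lem : ∀ b x → b + x - b ≡ 0ℤ + x
    lem = ℤ-solve

  ≋-sub : ∀ {a b} → a ≋ b [ m ] → a - b ≋ 0ℤ [ m ]
  ≋-sub e = ∣⇒≋0 (≋⇒∣- e)

  ≋-add : ∀ {a b} → a - b ≋ 0ℤ [ m ] → a ≋ b [ m ]
  ≋-add e = ∣-⇒≋ (≋0⇒∣ e)

  multiple-≋0 : ∀ n → m * n ≋ 0ℤ [ m ]
  multiple-≋0 n = n by sym (ℤ.+-identityˡ (m * n))

  ≋-mul0ˡ : ∀ {a} b → a ≋ 0ℤ [ m ] → a * b ≋ 0ℤ [ m ]
  ≋-mul0ˡ b e = ~trans (ℤ/.*-cong m e (~refl {b})) (ℤ/.reflexive m (ℤ.*-zeroˡ b))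

  ≋-mul0ʳ : ∀ {a} b → a ≋ 0ℤ [ m ] → b * a ≋ 0ℤ [ m ]
  ≋-mul0ʳ {a} b e = ~trans (ℤ/.reflexive m (ℤ.*-comm b a)) (≋-mul0ˡ b e)

module ℤᴿ where
  open CommutativeRing ℤ.+-*-commutativeRing public
  open import Algebra.Properties.Semiring.Exp semiring public using () renaming (_^_ to _^ᴿ_)
  open import Algebra.Properties.Semiring.Mult semiring public using () renaming (_×_ to _·_)
  open import Algebra.Properties.CommutativeSemiring.Exp commutativeSemiring public using (^-distrib-*)

open ℤᴿ using (_^ᴿ_)

^ᴿ≡^ : ∀ a n → a ^ᴿ n ≡ a ^ n
^ᴿ≡^ a zero = refl
^ᴿ≡^ a (suc n) = cong (a *_) (^ᴿ≡^ a n)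

^-congᵐ : ∀ {m a b} n → a ≋ b [ m ] → a ^ n ≋ b ^ n [ m ]
^-congᵐ {m} {a} {b} n e = subst₂ _≋_[ m ] (^ᴿ≡^ a n) (^ᴿ≡^ b n) (ℤ/.^-cong-≈ m n e)

^-*-distrib : ∀ a b n → (a * b) ^ n ≡ a ^ n * b ^ n
^-*-distrib a b n = trans (sym (^ᴿ≡^ (a * b) n)) (trans (ℤᴿ.^-distrib-* a b n) (cong₂ _*_ (^ᴿ≡^ a n) (^ᴿ≡^ b n)))

prime≢0 : ∀ {p} → Prime p → ∀ {a} → ∣ a ∣ ≡ 1 → ¬ a ≋ 0ℤ [ + p ]
prime≢0 {p} pr e h = ℕ.<⇒≢ (ℕ.nonTrivial⇒n>1 p {{prime⇒nonTrivial pr}}) (sym (ℕ.∣1⇒≡1 (subst (p ℕ.∣_) e (≋0⇒∣ h))))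

prime-cancel : ∀ {p} → Prime p → ∀ a b → a * b ≋ 0ℤ [ + p ] → a ≋ 0ℤ [ + p ] ⊎ b ≋ 0ℤ [ + p ]
prime-cancel {p} pr a b h with euclidsLemma ∣ a ∣ ∣ b ∣ pr (subst (p ℕ.∣_) (ℤ.abs-* a b) (≋0⇒∣ h))
... | inj₁ d = inj₁ (∣⇒≋0 d)
... | inj₂ d = inj₂ (∣⇒≋0 d)

prime-∣prime : ∀ {p q} → Prime p → Prime q → + q ≋ 0ℤ [ + p ] → p ≡ q
prime-∣prime {p} {q} pp qp h with prime⇒irreducible qp (≋0⇒∣ h)
... | inj₁ p≡1 = contradiction p≡1 (ℕ.nonTrivial⇒≢1 {{prime⇒nonTrivial pp}})
... | inj₂ p≡q = p≡q

prime-^ : ∀ {p} → Prime p → ∀ a n → a ^ n ≋ 0ℤ [ + p ] → a ≋ 0ℤ [ + p ]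
prime-^ pr a zero h = contradiction h (prime≢0 pr refl)
prime-^ pr a (suc n) h with prime-cancel pr a (a ^ n) h
... | inj₁ z = z
... | inj₂ z = prime-^ pr a n z

module _ {p : ℕ} (pr : Prime p) where
  private
    instance _ = prime⇒nonZero pr
    module M = ℤ/ (+ p)
  open Residues p using (rep-res; res; rep; _~?_)

  _≋?_ : ∀ a b → Dec (a ≋ b [ + p ])
  _≋?_ = _~?_

  fermat : ∀ a → a ^ p ≋ a [ + p ]
  fermat a = M.trans (^-congᵐ p (rep-res a)) (M.trans (M.trans (M.reflexive (sym (^ᴿ≡^ (rep (res a)) p))) (nat (toℕ (res a)))) (M.sym (rep-res a)))
    where
    ·≡* : ∀ n x → n ℤᴿ.· x ≡ + n * x
    ·≡* zero x = refl
    ·≡* (suc n) x = trans (cong (_+_ x) (·≡* n x)) (lem x (+ n))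
      where
      lem : ∀ x n → x + n * x ≡ (1ℤ + n) * x
      lem = ℤ-solve
    nat : ∀ n → (+ n) ^ᴿ p ≋ + n [ + p ]
    nat zero = M.reflexive (zero^ p (ℕ.>-nonZero⁻¹ p))
      where
      zero^ : ∀ n → 0 ℕ.< n → 0ℤ ^ᴿ n ≡ 0ℤ
      zero^ (suc n) _ = ℤ.*-zeroˡ (0ℤ ^ᴿ n)
    nat (suc n) = M.trans (M.freshman pr (·≡* p) 1ℤ (+ n))
      (M.+-cong (M.reflexive (trans (^ᴿ≡^ 1ℤ p) (ℤ.^-zeroˡ p))) (nat n))

  fermat-unit : ∀ {n} → p ≡ suc n → ∀ a → ¬ a ≋ 0ℤ [ + p ] → a ^ n ≋ 1ℤ [ + p ]
  fermat-unit {n} e a ne = [ (λ h → contradiction h ne) , ≋-add ]′ (prime-cancel pr a (a ^ n - 1ℤ)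
    (M.trans (M.reflexive (trans (lem a (a ^ n)) (cong (λ k → a ^ k - a) (sym e)))) (≋-sub (fermat a))))
    where
    lem : ∀ a b → a * (b - 1ℤ) ≡ a * b - a
    lem = ℤ-solve

-- Horner form: a polynomial is its function together with a recipe, indexed by the degree, so that
-- division by x - a needs no polynomial arithmetic.
data Monic : ℕ → (ℤ → ℤ) → Set where
  unit : ∀ {f} → (∀ x → f x ≡ 1ℤ) → Monic 0 f
  step : ∀ {n f} g c → Monic n g → (∀ x → f x ≡ x * g x + c) → Monic (suc n) f

synthetic-division : ∀ {n f} → Monic (suc n) f → ∀ a →
  ∃ λ g → Monic n g × (∀ x → f x ≡ (x - a) * g x + f a)
synthetic-division {zero} {f} (step g c (unit g≡1) f≡) a = g , unit g≡1 , λ x →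
  trans (f≡ x) (trans (lem x a c (g x) (g a)) (cong₂ (λ u v → (x - a) * g x + u + a * v) (sym (f≡ a)) (cong₂ _-_ (g≡1 x) (g≡1 a)))
   ⟨⟩ lem₂ ((x - a) * g x) (f a) a)
  where
  infixl 1 _⟨⟩_
  _⟨⟩_ : ∀ {x y z : ℤ} → x ≡ y → y ≡ z → x ≡ z
  _⟨⟩_ = trans
  lem : ∀ x a c u v → x * u + c ≡ (x - a) * u + (a * v + c) + a * (u - v)
  lem = ℤ-solve
  lem₂ : ∀ x y a → x + y + a * 0ℤ ≡ x + y
  lem₂ = ℤ-solve
synthetic-division {suc n} {f} (step g c mg f≡) a with synthetic-division mg a
... | h , mh , g≡ = (λ x → x * h x + g a) , step h (g a) mh (λ _ → refl) , λ x →
  trans (f≡ x) (trans (cong (λ y → x * y + c) (g≡ x)) (trans (lem x a c (h x) (g a)) (cong (_+_ ((x - a) * (x * h x + g a))) (sym (f≡ a)))))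
  where
  lem : ∀ x a c h g → x * ((x - a) * h + g) + c ≡ (x - a) * (x * h + g) + (a * g + c)
  lem = ℤ-solve

power-monic : ∀ n → Monic n (_^ n)
power-monic zero = unit (λ _ → refl)
power-monic (suc n) = step (_^ n) 0ℤ (power-monic n) (λ x → sym (ℤ.+-identityʳ _))

module _ {p : ℕ} (pr : Prime p) where
  -- Dividing by the linear factor of the last of the points 1, ..., n + 1 lowers the degree. The
  -- other points remain roots of the quotient, because below p they are distinct modulo p.
  lagrange : ∀ {n f} → Monic n f → suc n ℕ.< p → ¬ (∀ i → i ℕ.≤ n → f (+ suc i) ≋ 0ℤ [ + p ])
  lagrange {f = f} (unit f≡1) _ h = prime≢0 pr refl (subst (_≋ 0ℤ [ + p ]) (f≡1 1ℤ) (h 0 z≤n))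
  lagrange {suc n} {f} mf n<p h with synthetic-division mf (+ suc (suc n))
  ... | g , mg , f≡ = lagrange mg (ℕ.<-trans (ℕ.n<1+n _) n<p) λ i i≤n → case
      prime-cancel pr (+ suc i - + suc (suc n)) (g (+ suc i)) (M.trans (M.reflexive (lem (f≡ (+ suc i))))
        (M.+-cong (h i (ℕ.m≤n⇒m≤1+n i≤n)) (M.-‿cong (h (suc n) ℕ.≤-refl)))) of λ where
      (inj₁ e) → contradiction (residue-unique (ℕ.≤-trans (s≤s (s≤s i≤n)) (ℕ.<⇒≤ n<p)) n<p (≋-add e))
                   (ℕ.<⇒≢ (s≤s (s≤s i≤n)))
      (inj₂ e) → e
    where
    module M = ℤ/ (+ p)
    lem : ∀ {x a b} → x ≡ a + b → a ≡ x - b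
    lem {a = a} {b} refl = lem′ a b
      where
      lem′ : ∀ a b → a ≡ a + b - b
      lem′ = ℤ-solve

  opaque
    -- x^(n+1) - 1 cannot vanish at all of 1, ..., n + 2, so a finite search succeeds. With the
    -- exponent (q - 1) / 3 it yields a cubic non-residue modulo q.
    power-nontrivial : ∀ n → suc (suc n) ℕ.< p → ∃ λ c → ¬ c ≋ 0ℤ [ + p ] × ¬ c ^ suc n ≋ 1ℤ [ + p ]
    power-nontrivial n n<p with ℕ.anyUpTo? (λ i → ¬? (_≋?_ pr ((+ suc i) ^ suc n) 1ℤ)) (suc (suc n))
    ... | yes (i , i< , ne) = + suc i , (λ e → contradiction (residue-unique (ℕ.≤-<-trans i< n<p) (ℕ.≤-<-trans z≤n n<p) e) λ ()) , ne
    ... | no all = contradiction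
        (λ i i≤ → ≋-sub (decidable-stable (_≋?_ pr ((+ suc i) ^ suc n) 1ℤ) (λ ne → all (i , s≤s i≤ , ne))))
        (lagrange (step (_^ n) (- 1ℤ) (power-monic n) (λ _ → refl)) n<p)


-- Cubic characters

infix 4 _≋ᴱ_[_]
_≋ᴱ_[_] : Eisenstein → Eisenstein → ℤ → Set
x ≋ᴱ y [ m ] = _≈_[mod_] 𝔼 x y (ι m)

module 𝔼/ (m : ℤ) = Quotient 𝔼 (ι m)

ω² : Eisenstein
ω² = ω ⊗ ω

norm-⊗ : ∀ x y → norm (x ⊗ y) ≡ norm x * norm y
norm-⊗ ⟨ a , b ⟩ ⟨ c , d ⟩ = lem a b c d
  where
  lem : ∀ a b c d → (a * c - b * d) * (a * c - b * d) - (a * c - b * d) * (a * d + b * c - b * d)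
    + (a * d + b * c - b * d) * (a * d + b * c - b * d) ≡ (a * a - a * b + b * b) * (c * c - c * d + d * d)
  lem = ℤ-solve

⊗-conj : ∀ x → x ⊗ conj x ≡ ι (norm x)
⊗-conj ⟨ a , b ⟩ = cong₂ ⟨_,_⟩ (lem₁ a b) (lem₂ a b)
  where
  lem₁ : ∀ a b → a * (a - b) - b * (- b) ≡ a * a - a * b + b * b
  lem₁ = ℤ-solve
  lem₂ : ∀ a b → a * (- b) + b * (a - b) - b * (- b) ≡ 0ℤ
  lem₂ = ℤ-solve

conj-⊕ : ∀ x y → conj (x ⊕ y) ≡ conj x ⊕ conj y
conj-⊕ ⟨ a , b ⟩ ⟨ c , d ⟩ = cong₂ ⟨_,_⟩ (lem a b c d) (ℤ.neg-distrib-+ b d)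
  where
  lem : ∀ a b c d → a + c - (b + d) ≡ a - b + (c - d)
  lem = ℤ-solve

conj-⊗ : ∀ x y → conj (x ⊗ y) ≡ conj x ⊗ conj y
conj-⊗ ⟨ a , b ⟩ ⟨ c , d ⟩ = cong₂ ⟨_,_⟩ (lem₁ a b c d) (lem₂ a b c d)
  where
  lem₁ : ∀ a b c d → a * c - b * d - (a * d + b * c - b * d) ≡ (a - b) * (c - d) - (- b) * (- d)
  lem₁ = ℤ-solve
  lem₂ : ∀ a b c d → - (a * d + b * c - b * d) ≡ (a - b) * (- d) + (- b) * (c - d) - (- b) * (- d)
  lem₂ = ℤ-solve

ι-⊗ : ∀ a b → ι a ⊗ ι b ≡ ι (a * b)
ι-⊗ a b = cong₂ ⟨_,_⟩ (lem₁ a b) (lem₂ a b)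
  where
  lem₁ : ∀ a b → a * b - 0ℤ * 0ℤ ≡ a * b
  lem₁ = ℤ-solve
  lem₂ : ∀ a b → a * 0ℤ + 0ℤ * b - 0ℤ * 0ℤ ≡ 0ℤ
  lem₂ = ℤ-solve

ι-⊗-⟨⟩ : ∀ a c d → ι a ⊗ ⟨ c , d ⟩ ≡ ⟨ a * c , a * d ⟩
ι-⊗-⟨⟩ a c d = cong₂ ⟨_,_⟩ (lem₁ a c d) (lem₂ a c d)
  where
  lem₁ : ∀ a c d → a * c - 0ℤ * d ≡ a * c
  lem₁ = ℤ-solve
  lem₂ : ∀ a c d → a * d + 0ℤ * c - 0ℤ * d ≡ a * d
  lem₂ = ℤ-solve

norm-≋ᴱ0 : ∀ {m x} → x ≋ᴱ 𝟘 [ m ] → norm x ≋ 0ℤ [ m ]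
norm-≋ᴱ0 {m} {x} (z by e) = (m * norm z) by trans (cong norm (trans e (E.+-identityˡ _)))
  (trans (norm-⊗ (ι m) z) (lem m (norm z)))
  where
  lem : ∀ m n → (m * m - m * 0ℤ + 0ℤ * 0ℤ) * n ≡ 0ℤ + m * (m * n)
  lem = ℤ-solve

-- The possible values of a cubic character, listed so that identities between values reduce to
-- computation.
data Cubic : Eisenstein → Set where
  ζ₀ : Cubic 𝟙
  ζ₁ : Cubic ω
  ζ₂ : Cubic ω²
  zr : Cubic 𝟘

Cubic-⊗ : ∀ {x y} → Cubic x → Cubic y → Cubic (x ⊗ y)
Cubic-⊗ ζ₀ ζ₀ = ζ₀
Cubic-⊗ ζ₀ ζ₁ = ζ₁
Cubic-⊗ ζ₀ ζ₂ = ζ₂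
Cubic-⊗ ζ₁ ζ₀ = ζ₁
Cubic-⊗ ζ₁ ζ₁ = ζ₂
Cubic-⊗ ζ₁ ζ₂ = ζ₀
Cubic-⊗ ζ₂ ζ₀ = ζ₂
Cubic-⊗ ζ₂ ζ₁ = ζ₀
Cubic-⊗ ζ₂ ζ₂ = ζ₁
Cubic-⊗ {y = y} zr c = subst Cubic (sym (E.zeroˡ y)) zr
Cubic-⊗ {x} c zr = subst Cubic (sym (E.zeroʳ x)) zr

Cubic-conj : ∀ {x} → Cubic x → Cubic (conj x)
Cubic-conj ζ₀ = ζ₀
Cubic-conj ζ₁ = ζ₂
Cubic-conj ζ₂ = ζ₁
Cubic-conj zr = zr

conj≡square : ∀ {x} → Cubic x → conj x ≡ x ⊗ x
conj≡square ζ₀ = refl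
conj≡square ζ₁ = refl
conj≡square ζ₂ = refl
conj≡square zr = refl

-- Distinct values differ by an element of norm 1 or 3, so a congruence between values modulo a
-- prime other than 3 is an equality. This turns the congruences of reciprocity into equations.
cubic-difference : ∀ {x y} → Cubic x → Cubic y →
  x ≡ y ⊎ norm (x ⊕ ⊖ y) ≡ + 1 ⊎ norm (x ⊕ ⊖ y) ≡ + 3
cubic-difference ζ₀ ζ₀ = inj₁ refl
cubic-difference ζ₀ ζ₁ = inj₂ (inj₂ refl)
cubic-difference ζ₀ ζ₂ = inj₂ (inj₂ refl)
cubic-difference ζ₀ zr = inj₂ (inj₁ refl)
cubic-difference ζ₁ ζ₀ = inj₂ (inj₂ refl)
cubic-difference ζ₁ ζ₁ = inj₁ refl
cubic-difference ζ₁ ζ₂ = inj₂ (inj₂ refl)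
cubic-difference ζ₁ zr = inj₂ (inj₁ refl)
cubic-difference ζ₂ ζ₀ = inj₂ (inj₂ refl)
cubic-difference ζ₂ ζ₁ = inj₂ (inj₂ refl)
cubic-difference ζ₂ ζ₂ = inj₁ refl
cubic-difference ζ₂ zr = inj₂ (inj₁ refl)
cubic-difference zr ζ₀ = inj₂ (inj₁ refl)
cubic-difference zr ζ₁ = inj₂ (inj₁ refl)
cubic-difference zr ζ₂ = inj₂ (inj₁ refl)
cubic-difference zr zr = inj₁ refl

𝟙^ : ∀ n → 𝟙 E.^ n ≡ 𝟙
𝟙^ zero = refl
𝟙^ (suc n) = trans (⊗-identityˡ _) (𝟙^ n)

prime-2 : Prime 2
prime-2 = toWitness {a? = prime? 2} _

prime-3 : Prime 3
prime-3 = toWitness {a? = prime? 3} _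

cubic-unique : ∀ {p x y} → Prime p → p ≢ 3 → Cubic x → Cubic y → norm (x ⊕ ⊖ y) ≋ 0ℤ [ + p ] → x ≡ y
cubic-unique pr p≢3 cx cy h with cubic-difference cx cy
... | inj₁ e = e
... | inj₂ (inj₁ e) = contradiction (subst (_≋ 0ℤ [ _ ]) e h) (prime≢0 pr refl)
... | inj₂ (inj₂ e) = contradiction (prime-∣prime pr prime-3 (subst (_≋ 0ℤ [ _ ]) e h)) p≢3

cubic-unique-≋ᴱ : ∀ {p x y} → Prime p → p ≢ 3 → Cubic x → Cubic y → x ≋ᴱ y [ + p ] → x ≡ y
cubic-unique-≋ᴱ {p} {x} {y} pr p≢3 cx cy e = cubic-unique pr p≢3 cx cy
  (norm-≋ᴱ0 (M.trans (M.+-cong e (M.refl {⊖ y})) (M.≈-reflexive (E.-‿inverseʳ y))))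
  where module M = 𝔼/ (+ p)

module Evaluation (q : ℕ) (w : ℤ) (root : w * w + w + 1ℤ ≋ 0ℤ [ + q ]) where
  private module M = ℤ/ (+ q)

  -- Reduction modulo q with ω sent to the root w of w² + w + 1. For prime q its kernel takes the
  -- place of a prime ideal above q.
  ev : Eisenstein → ℤ
  ev ⟨ a , b ⟩ = a + b * w

  ev-⊕ : ∀ x y → ev (x ⊕ y) ≡ ev x + ev y
  ev-⊕ ⟨ a , b ⟩ ⟨ c , d ⟩ = lem a b c d w
    where
    lem : ∀ a b c d w → a + c + (b + d) * w ≡ a + b * w + (c + d * w)
    lem = ℤ-solve

  ev-⊖ : ∀ x → ev (⊖ x) ≡ - ev x
  ev-⊖ ⟨ a , b ⟩ = lem a b w
    where
    lem : ∀ a b w → - a + (- b) * w ≡ - (a + b * w)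
    lem = ℤ-solve

  ev-⊗ : ∀ x y → ev (x ⊗ y) ≋ ev x * ev y [ + q ]
  ev-⊗ ⟨ a , b ⟩ ⟨ c , d ⟩ = M.sym (M.trans (M.reflexive (lem a b c d w))
    (M.trans (M.+-cong (M.refl {a * c - b * d + (a * d + b * c - b * d) * w}) (≋-mul0ʳ (b * d) root)) (M.reflexive (ℤ.+-identityʳ _))))
    where
    lem : ∀ a b c d w → (a + b * w) * (c + d * w) ≡ a * c - b * d + (a * d + b * c - b * d) * w + b * d * (w * w + w + 1ℤ)
    lem = ℤ-solve

  ev-ι : ∀ a → ev (ι a) ≡ a
  ev-ι a = lem a w
    where
    lem : ∀ a w → a + 0ℤ * w ≡ a
    lem = ℤ-solve

  ev-^ : ∀ x n → ev (x E.^ n) ≋ ev x ^ n [ + q ]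
  ev-^ x zero = M.reflexive (ev-ι 1ℤ)
  ev-^ x (suc n) = M.trans (ev-⊗ x (x E.^ n)) (M.*-cong (M.refl {ev x}) (ev-^ x n))

  ev-conj : ∀ x → ev x * ev (conj x) ≋ norm x [ + q ]
  ev-conj x = M.trans (M.sym (ev-⊗ x (conj x))) (M.reflexive (trans (cong ev (⊗-conj x)) (ev-ι (norm x))))

  ev-≋ : ∀ {x y} → x ≋ᴱ y [ + q ] → ev x ≋ ev y [ + q ]
  ev-≋ {x} {y} (z by e) = M.trans (M.reflexive (trans (cong ev e) (ev-⊕ y (ι (+ q) ⊗ z))))
    (M.trans (M.+-cong (M.refl {ev y}) (M.trans (ev-⊗ (ι (+ q)) z) (M.trans (M.*-cong (M.reflexive (ev-ι (+ q))) (M.refl {ev z}))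
      (ev z by sym (ℤ.+-identityˡ _))))) (M.reflexive (ℤ.+-identityʳ (ev y))))

record CubicCharacter (q : ℕ) : Set where
  field
    χ          : ℤ → Eisenstein
    cubic      : ∀ a → Cubic (χ a)
    χ-*        : ∀ a b → χ (a * b) ≡ χ a ⊗ χ b
    χ-periodic : ∀ {a b} → a ≋ b [ + q ] → χ a ≡ χ b
    χ-zero     : ∀ {a} → a ≋ 0ℤ [ + q ] → χ a ≡ 𝟘
    χ-unit     : ∀ {a} → ¬ a ≋ 0ℤ [ + q ] → χ a ≢ 𝟘
    c          : ℤ
    χ-c≢0      : χ c ≢ 𝟘
    χ-c≢1      : χ c ≢ 𝟙

conjugate : ∀ {q} → CubicCharacter q → CubicCharacter q
conjugate C = record
  { χ = λ a → conj (χ a)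
  ; cubic = λ a → Cubic-conj (cubic a)
  ; χ-* = λ a b → trans (cong conj (χ-* a b)) (conj-⊗ (χ a) (χ b))
  ; χ-periodic = λ e → cong conj (χ-periodic e)
  ; χ-zero = λ e → cong conj (χ-zero e)
  ; χ-unit = λ ne e → χ-unit ne (conj-0 (cubic _) e)
  ; c = c
  ; χ-c≢0 = λ e → χ-c≢0 (conj-0 (cubic c) e)
  ; χ-c≢1 = λ e → χ-c≢1 (conj-1 (cubic c) e) }
  where
  open CubicCharacter C
  conj-0 : ∀ {x} → Cubic x → conj x ≡ 𝟘 → x ≡ 𝟘
  conj-0 zr _ = refl
  conj-1 : ∀ {x} → Cubic x → conj x ≡ 𝟙 → x ≡ 𝟙
  conj-1 ζ₀ _ = refl

module _ {q k : ℕ} (pr : Prime q) (q≡ : q ≡ suc (3 ℕ.* suc k))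
         {w : ℤ} (root : w * w + w + 1ℤ ≋ 0ℤ [ + q ]) where
  private
    module M = ℤ/ (+ q)
    K = suc k
    q≢3 : q ≢ 3
    q≢3 e = case ℕ.suc-injective (trans (sym q≡) e) of λ 3K≡2 → 3∤2 (ℕ.divides K (trans (sym 3K≡2) (ℕ.*-comm 3 K)))
      where
      3∤2 : ¬ 3 ℕ.∣ 2
      3∤2 d = contradiction (ℕ.∣⇒≤ d) (ℕ.<⇒≱ (s≤s (s≤s (s≤s z≤n))))
  open Evaluation q w root

  -- Modulo q the polynomial t³ - 1 splits with roots 1, w and - 1 - w, the images of 1, ω and ω².
  cube-roots : ∀ t → t * t * t ≋ 1ℤ [ + q ] → ∃ λ z → Cubic z × ev z ≋ t [ + q ]
  cube-roots t t³≋1 = [ (λ h → 𝟙 , ζ₀ , M.trans (M.reflexive (ev-ι 1ℤ)) (M.sym (≋-add h)))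
                      , (λ h → [ case-ω , case-ω² ]′ (prime-cancel pr (t - w) (t - (- 1ℤ - w)) h)) ]′
    (prime-cancel pr (t - 1ℤ) ((t - w) * (t - (- 1ℤ - w)))
      (M.trans (M.reflexive (factor t w)) (M.+-cong (≋-sub t³≋1) (≋-mul0ʳ (1ℤ - t) root))))
    where
    factor : ∀ t w → (t - 1ℤ) * ((t - w) * (t - (- 1ℤ - w))) ≡ t * t * t - 1ℤ + (1ℤ - t) * (w * w + w + 1ℤ)
    factor = ℤ-solve
    ev-ω : ∀ w → 0ℤ + 1ℤ * w ≡ w
    ev-ω = ℤ-solve
    ev-ω² : ∀ w → - 1ℤ + (- 1ℤ) * w ≡ - 1ℤ - w
    ev-ω² = ℤ-solve
    case-ω : t - w ≋ 0ℤ [ + q ] → ∃ λ z → Cubic z × ev z ≋ t [ + q ]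
    case-ω h = ω , ζ₁ , M.trans (M.reflexive (ev-ω w)) (M.sym (≋-add h))
    case-ω² : t - (- 1ℤ - w) ≋ 0ℤ [ + q ] → ∃ λ z → Cubic z × ev z ≋ t [ + q ]
    case-ω² h = ω² , ζ₂ , M.trans (M.reflexive (ev-ω² w)) (M.sym (≋-add h))

  opaque
    -- Here K = (q - 1) / 3, so a^K is 0 or, by Fermat, a cube root of unity. The lift z is the
    -- cubic residue symbol at the prime above q for which ω ≡ w.
    power-residue : ∀ a → ∃ λ z → Cubic z × ev z ≋ a ^ K [ + q ]
    power-residue a = residue (_≋?_ pr a 0ℤ)
      where
      t³ : ∀ t → t * t * t ≡ t * (t * (t * 1ℤ))
      t³ = ℤ-solve
      residue : Dec (a ≋ 0ℤ [ + q ]) → ∃ λ z → Cubic z × ev z ≋ a ^ K [ + q ]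
      residue (yes e) = 𝟘 , zr , M.sym (≋-mul0ˡ (a ^ k) e)
      residue (no ne) = cube-roots (a ^ K) (M.trans (M.reflexive (trans (t³ (a ^ K))
        (trans (ℤ.^-*-assoc a K 3) (cong (a ^_) (ℕ.*-comm K 3))))) (fermat-unit pr q≡ a ne))

  ev-injective : ∀ {x y} → Cubic x → Cubic y → ev x ≋ ev y [ + q ] → x ≡ y
  ev-injective {x} {y} cx cy e = cubic-unique pr q≢3 cx cy
    (M.trans (M.sym (ev-conj (x ⊕ ⊖ y))) (≋-mul0ˡ _ (M.trans (M.reflexive (trans (ev-⊕ x (⊖ y)) (cong (_+_ (ev x)) (ev-⊖ y)))) (≋-sub e))))

  power-residue-character : CubicCharacter q
  power-residue-character = record
    { χ = χ
    ; cubic = cubic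
    ; χ-* = λ a b → ev-injective (cubic (a * b)) (Cubic-⊗ (cubic a) (cubic b))
        (M.trans (ev-χ (a * b)) (M.trans (M.reflexive (^-*-distrib a b K))
          (M.trans (M.*-cong (M.sym (ev-χ a)) (M.sym (ev-χ b))) (M.sym (ev-⊗ (χ a) (χ b))))))
    ; χ-periodic = λ {a} {b} e → ev-injective (cubic a) (cubic b)
        (M.trans (ev-χ a) (M.trans (^-congᵐ K e) (M.sym (ev-χ b))))
    ; χ-zero = λ {a} e → ev-injective (cubic a) zr (M.trans (ev-χ a) (≋-mul0ˡ (a ^ k) e))
    ; χ-unit = λ {a} ne e → ne (χ≡0 a e)
    ; c = proj₁ nontrivial
    ; χ-c≢0 = λ e → proj₁ (proj₂ nontrivial) (χ≡0 (proj₁ nontrivial) e)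
    ; χ-c≢1 = λ e → proj₂ (proj₂ nontrivial) (M.trans (M.sym (ev-χ (proj₁ nontrivial))) (M.reflexive (trans (cong ev e) (ev-ι 1ℤ)))) }
    where
    χ : ℤ → Eisenstein
    χ a = proj₁ (power-residue a)
    cubic : ∀ a → Cubic (χ a)
    cubic a = proj₁ (proj₂ (power-residue a))
    ev-χ : ∀ a → ev (χ a) ≋ a ^ K [ + q ]
    ev-χ a = proj₂ (proj₂ (power-residue a))
    χ≡0 : ∀ a → χ a ≡ 𝟘 → a ≋ 0ℤ [ + q ]
    χ≡0 a e = prime-^ pr a K (M.trans (M.sym (ev-χ a)) (M.reflexive (trans (cong ev e) (ev-ι 0ℤ))))
    nontrivial = power-nontrivial pr k (subst (suc K ℕ.<_) (sym q≡)
      (s≤s (s≤s (ℕ.≤-trans (ℕ.m≤m+n (suc k) _) (ℕ.m≤n+m (2 ℕ.* suc k) k)))))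


-- Gauss and Jacobi sums

ι-cancel : ∀ {m x y} → m ≢ 0ℤ → ι m ⊗ x ≡ ι m ⊗ y → x ≡ y
ι-cancel {m} {⟨ a , b ⟩} {⟨ c , d ⟩} m≢0 e = cong₂ ⟨_,_⟩
  (ℤ.*-cancelˡ-≡ m a c (trans (sym (lem₁ m a b)) (trans (cong re e) (lem₁ m c d))))
  (ℤ.*-cancelˡ-≡ m b d (trans (sym (lem₂ m a b)) (trans (cong im e) (lem₂ m c d))))
  where
  instance _ = ℤ.≢-nonZero m≢0
  lem₁ : ∀ m a b → m * a - 0ℤ * b ≡ m * a
  lem₁ = ℤ-solve
  lem₂ : ∀ m a b → m * b + 0ℤ * a - 0ℤ * b ≡ m * b
  lem₂ = ℤ-solve

cubic-idempotent : ∀ {x} → Cubic x → x ≢ 𝟘 → x ⊗ x ≡ x → x ≡ 𝟙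
cubic-idempotent ζ₀ _ _ = refl
cubic-idempotent ζ₁ _ ()
cubic-idempotent ζ₂ _ ()
cubic-idempotent zr ne _ = contradiction refl ne

cubic-square-1 : ∀ {x} → Cubic x → x ⊗ x ≡ 𝟙 → x ≡ 𝟙
cubic-square-1 ζ₀ _ = refl
cubic-square-1 ζ₁ ()
cubic-square-1 ζ₂ ()
cubic-square-1 zr ()

cubic-⊗-conj : ∀ {x} → Cubic x → x ≢ 𝟘 → x ⊗ conj x ≡ 𝟙
cubic-⊗-conj ζ₀ _ = refl
cubic-⊗-conj ζ₁ _ = refl
cubic-⊗-conj ζ₂ _ = refl
cubic-⊗-conj zr ne = contradiction refl ne

-- For a cube root of unity x ≠ 1 one has 1 + x + x² = 0, so 3 s = s + x s + x² s = 0.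
cubic-fixed : ∀ {x s} → Cubic x → x ≢ 𝟘 → x ≢ 𝟙 → x ⊗ s ≡ s → s ≡ 𝟘
cubic-fixed {x} {s} cx ne₀ ne₁ e = ι-cancel {+ 3} (λ ()) (begin
  ι (+ 3) ⊗ s               ≡⟨ sum3 s ⟩
  s ⊕ (s ⊕ s)               ≡⟨ cong (s ⊕_) (cong₂ _⊕_ e (trans (cong (x ⊗_) e) e)) ⟨
  s ⊕ (x ⊗ s ⊕ x ⊗ (x ⊗ s)) ≡⟨ factor x s ⟩
  (𝟙 ⊕ x ⊕ x ⊗ x) ⊗ s       ≡⟨ cong (_⊗ s) (vanish cx ne₀ ne₁) ⟩
  𝟘 ⊗ s                     ≡⟨ E.zeroˡ s ⟩
  𝟘                         ∎)
  where
  open ≡-Reasoning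
  vanish : ∀ {x} → Cubic x → x ≢ 𝟘 → x ≢ 𝟙 → 𝟙 ⊕ x ⊕ x ⊗ x ≡ 𝟘
  vanish ζ₀ _ ne = contradiction refl ne
  vanish ζ₁ _ _ = refl
  vanish ζ₂ _ _ = refl
  vanish zr ne _ = contradiction refl ne
  factor : ∀ x s → s ⊕ (x ⊗ s ⊕ x ⊗ (x ⊗ s)) ≡ (𝟙 ⊕ x ⊕ x ⊗ x) ⊗ s
  factor = solve-∀ 𝔼-acr
  sum3 : ∀ s → ι (+ 3) ⊗ s ≡ s ⊕ (s ⊕ s)
  sum3 s = trans (three s) (sym (triple s))
    where
    three : ∀ s → (𝟙 ⊕ (𝟙 ⊕ 𝟙)) ⊗ s ≡ (𝟙 ⊕ (𝟙 ⊕ 𝟙)) ⊗ s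
    three s = refl
    triple : ∀ s → s ⊕ (s ⊕ s) ≡ (𝟙 ⊕ (𝟙 ⊕ 𝟙)) ⊗ s
    triple = solve-∀ 𝔼-acr

module PowerRelations (R : CommutativeRing 0ℓ 0ℓ) where
  private module R = CommutativeRing R
  open R using (Carrier; setoid; commutativeSemiring; semiring; *-congˡ; *-congʳ; *-cong; *-assoc; *-comm) renaming (_≈_ to _~_; _*_ to _∙_)
  open import Algebra.Properties.Semiring.Exp semiring renaming (_^_ to _^ʳ_)
  open import Algebra.Solver.Ring.NaturalCoefficients.Default commutativeSemiring using (solve; _:*_; _:=_)
  open import Relation.Binary.Reasoning.Setoid setoid

  module _ {g ψ j j′ r : Carrier} (g² : g ∙ g ~ j ∙ ψ) (ψ² : ψ ∙ ψ ~ j′ ∙ g) (g²ψ : g ∙ (g ∙ ψ) ~ r ∙ g) where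
    -- g² ψ² is computed in two ways. The factor g ψ is kept because the convolution algebra, where
    -- this is applied, has zero divisors.
    norm-relation : (j ∙ j′) ∙ (g ∙ ψ) ~ r ∙ (g ∙ ψ)
    norm-relation = begin
      (j ∙ j′) ∙ (g ∙ ψ)   ≈⟨ solve 4 (λ j j′ g ψ → ((j :* j′) :* (g :* ψ)) := ((j :* ψ) :* (j′ :* g))) R.refl j j′ g ψ ⟩
      (j ∙ ψ) ∙ (j′ ∙ g)   ≈⟨ *-cong g² ψ² ⟨
      (g ∙ g) ∙ (ψ ∙ ψ)    ≈⟨ solve 2 (λ g ψ → ((g :* g) :* (ψ :* ψ)) := (ψ :* (g :* (g :* ψ)))) R.refl g ψ ⟩
      ψ ∙ (g ∙ (g ∙ ψ))    ≈⟨ *-congˡ g²ψ ⟩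
      ψ ∙ (r ∙ g)          ≈⟨ solve 3 (λ ψ r g → (ψ :* (r :* g)) := (r :* (g :* ψ))) R.refl ψ r g ⟩
      r ∙ (g ∙ ψ)          ∎

    fourth-power : (g ∙ g) ∙ (g ∙ g) ~ (j ∙ (j ∙ j′)) ∙ g
    fourth-power = begin
      (g ∙ g) ∙ (g ∙ g)    ≈⟨ *-cong g² g² ⟩
      (j ∙ ψ) ∙ (j ∙ ψ)    ≈⟨ solve 2 (λ j ψ → ((j :* ψ) :* (j :* ψ)) := ((j :* j) :* (ψ :* ψ))) R.refl j ψ ⟩
      (j ∙ j) ∙ (ψ ∙ ψ)    ≈⟨ *-congˡ ψ² ⟩
      (j ∙ j) ∙ (j′ ∙ g)   ≈⟨ solve 3 (λ j j′ g → ((j :* j) :* (j′ :* g)) := ((j :* (j :* j′)) :* g)) R.refl j j′ g ⟩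
      (j ∙ (j ∙ j′)) ∙ g   ∎

  module _ {g γ : Carrier} (g⁴ : (g ∙ g) ∙ (g ∙ g) ~ γ ∙ g) where
    power-3k+1 : ∀ k → g ^ʳ suc (3 ℕ.* k) ~ γ ^ʳ k ∙ g
    power-3k+1 k = begin
      g ∙ g ^ʳ (3 ℕ.* k)   ≈⟨ *-congˡ (^-assocʳ g 3 k) ⟨
      g ∙ (g ^ʳ 3) ^ʳ k    ≈⟨ *-comm _ _ ⟩
      (g ^ʳ 3) ^ʳ k ∙ g    ≈⟨ go k ⟩
      γ ^ʳ k ∙ g           ∎
      where
      go : ∀ k → (g ^ʳ 3) ^ʳ k ∙ g ~ γ ^ʳ k ∙ g
      go zero = R.refl
      go (suc k) = begin
        (g ^ʳ 3 ∙ (g ^ʳ 3) ^ʳ k) ∙ g  ≈⟨ *-assoc _ _ _ ⟩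
        g ^ʳ 3 ∙ ((g ^ʳ 3) ^ʳ k ∙ g)  ≈⟨ *-congˡ (go k) ⟩
        g ^ʳ 3 ∙ (γ ^ʳ k ∙ g)         ≈⟨ *-congʳ (*-congˡ (*-congˡ (R.*-identityʳ g))) ⟩
        (g ∙ (g ∙ g)) ∙ (γ ^ʳ k ∙ g)  ≈⟨ solve 2 (λ g c → ((g :* (g :* g)) :* (c :* g)) := (c :* ((g :* g) :* (g :* g)))) R.refl g (γ ^ʳ k) ⟩
        γ ^ʳ k ∙ ((g ∙ g) ∙ (g ∙ g))  ≈⟨ *-congˡ g⁴ ⟩
        γ ^ʳ k ∙ (γ ∙ g)              ≈⟨ solve 3 (λ c γ g → (c :* (γ :* g)) := ((γ :* c) :* g)) R.refl (γ ^ʳ k) γ g ⟩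
        (γ ∙ γ ^ʳ k) ∙ g              ∎

module CharacterSums {q : ℕ} (pr : Prime q) where
  instance q≢0 = prime⇒nonZero pr
  open Residues q public
  private module M = ℤ/ (+ q)

  inverse : ∀ t → ¬ t ≋ 0ℤ [ + q ] → ∃ λ t′ → t * t′ ≋ 1ℤ [ + q ]
  inverse t ne = go q refl
    where
    go : ∀ n → q ≡ n → ∃ λ t′ → t * t′ ≋ 1ℤ [ + q ]
    go 0 e = contradiction e (ℕ.≢-nonZero⁻¹ q)
    go 1 e = contradiction e (ℕ.nonTrivial⇒≢1 {{prime⇒nonTrivial pr}})
    go (suc (suc n)) e = t ^ n , fermat-unit pr e t ne

  ∑-scale : ∀ {f} → Periodic f → ∀ {t} → ¬ t ≋ 0ℤ [ + q ] → ∑ f ≡ ∑ (λ a → f (t * a))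
  ∑-scale pf {t} ne = ∑-reindex pf (t *_) (t′ *_) (M.*-cong (M.refl {t})) (M.*-cong (M.refl {t′}))
    (λ a → M.trans (M.reflexive (sym (ℤ.*-assoc t t′ a))) (M.trans (M.*-cong tt′ (M.refl {a})) (M.reflexive (ℤ.*-identityˡ a))))
    (λ a → M.trans (M.reflexive (lem t t′ a)) (M.trans (M.*-cong tt′ (M.refl {a})) (M.reflexive (ℤ.*-identityˡ a))))
    where
    t′ = proj₁ (inverse t ne)
    tt′ = proj₂ (inverse t ne)
    lem : ∀ t t′ a → t′ * (t * a) ≡ t * t′ * a
    lem = ℤ-solve

  module _ (C : CubicCharacter q) where
    open CubicCharacter C

    -- Replacing a by c a multiplies the sum by χ c, which is a cube root of unity other than 1.
    ∑χ≡0 : ∑ χ ≡ 𝟘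
    ∑χ≡0 = cubic-fixed (cubic c) χ-c≢0 χ-c≢1 (sym (trans (∑-scale χ-periodic (λ e → χ-c≢0 (χ-zero e)))
      (trans (∑-cong (χ-* c)) (sym (∑-*ˡ (χ c) χ)))))

    χ-1 : χ 1ℤ ≡ 𝟙
    χ-1 = cubic-idempotent (cubic 1ℤ) (χ-unit (prime≢0 pr refl)) (sym (χ-* 1ℤ 1ℤ))

    χ-−1 : χ (- 1ℤ) ≡ 𝟙
    χ-−1 = cubic-square-1 (cubic _) (trans (sym (χ-* (- 1ℤ) (- 1ℤ))) χ-1)

    χ-neg : ∀ a → χ (0ℤ - a) ≡ χ a
    χ-neg a = trans (cong χ (lem a)) (trans (χ-* (- 1ℤ) a) (trans (cong (_⊗ χ a) χ-−1) (⊗-identityˡ _)))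
      where
      lem : ∀ a → 0ℤ - a ≡ - 1ℤ * a
      lem = ℤ-solve

    gauss : Fun
    gauss = fun χ χ-periodic

  open CubicCharacter

  jacobi : CubicCharacter q → Eisenstein
  jacobi C = ∑ (λ a → χ C a ⊗ χ C (1ℤ - a))

  module _ (C D : CubicCharacter q) where
    correlation : Eisenstein
    correlation = ∑ (λ a → χ C a ⊗ χ D (1ℤ - a))

    gauss⋆gauss-0 : ∀ {t} → t ≋ 0ℤ [ + q ] → at (gauss C ⋆ gauss D) t ≡ ∑ (λ a → χ C a ⊗ χ D a)
    gauss⋆gauss-0 {t} e = trans (at-⋆ (gauss C) (gauss D) t) (∑-cong λ a → cong (χ C a ⊗_) (trans (χ-periodic D (sub-congˡ a e)) (χ-neg D a)))

    -- The substitution a ↦ t a takes both character values at t out of the sum.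
    gauss⋆gauss-unit : ∀ {t} → ¬ t ≋ 0ℤ [ + q ] → at (gauss C ⋆ gauss D) t ≡ (χ C t ⊗ χ D t) ⊗ correlation
    gauss⋆gauss-unit {t} ne = trans (at-⋆ (gauss C) (gauss D) t) (trans (∑-scale (product-periodic (χ-periodic C) (shift-periodic (gauss D) t)) ne)
      (trans (∑-cong λ a → trans (cong₂ _⊗_ (χ-* C t a) (trans (cong (χ D) (lem t a)) (χ-* D t (1ℤ - a))))
        (lem₂ (χ C t) (χ C a) (χ D t) (χ D (1ℤ - a)))) (sym (∑-*ˡ _ _))))
      where
      lem : ∀ t a → t - t * a ≡ t * (1ℤ - a)
      lem = ℤ-solve
      lem₂ : ∀ x y z w → (x ⊗ y) ⊗ (z ⊗ w) ≡ (x ⊗ z) ⊗ (y ⊗ w)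
      lem₂ = solve-∀ 𝔼-acr

  ∑-conj : ∀ f → conj (∑ f) ≡ ∑ (λ a → conj (f a))
  ∑-conj f = go
    where
    opaque
      unfolding ∑
      sum-conj : ∀ {n} (t : Vector Eisenstein n) → conj (E.sum t) ≡ E.sum (λ i → conj (t i))
      sum-conj {zero} t = refl
      sum-conj {suc n} t = trans (conj-⊕ _ _) (cong (conj (t Fin.zero) ⊕_) (sum-conj (t ∘ Fin.suc)))
      go : conj (∑ f) ≡ ∑ (λ a → conj (f a))
      go = sum-conj (f ∘ rep)

  jacobi-conj : ∀ C → jacobi (conjugate C) ≡ conj (jacobi C)
  jacobi-conj C = trans (∑-cong (λ a → sym (conj-⊗ (χ C a) (χ C (1ℤ - a))))) (sym (∑-conj _))

  -- The square of a cubic character is its conjugate. Away from 0 the value is χ(t)² J; at 0 it is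
  -- the sum of the conjugate character, which vanishes.
  gauss² : ∀ C → gauss C ⋆ gauss C ≗ κ (jacobi C) ⋆ gauss (conjugate C)
  at≡ (gauss² C) t with t ~? 0ℤ
  ... | yes e = trans (gauss⋆gauss-0 C C e) (trans (∑-cong (λ a → sym (conj≡square (cubic C a))))
    (trans (∑χ≡0 (conjugate C)) (sym (trans (κ-⋆ (jacobi C) (gauss (conjugate C)) t)
      (trans (cong (jacobi C ⊗_) (χ-zero (conjugate C) e)) (E.zeroʳ _))))))
  ... | no ne = trans (gauss⋆gauss-unit C C ne) (trans (cong (_⊗ jacobi C) (sym (conj≡square (cubic C t))))
    (trans (⊗-comm _ _) (sym (κ-⋆ (jacobi C) (gauss (conjugate C)) t))))


module JacobiSums {q : ℕ} (pr : Prime q) (C : CubicCharacter q) where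
  open CharacterSums pr
  open CubicCharacter C using (χ; cubic; χ-*; χ-periodic; χ-zero; χ-unit)
  open CubicCharacter (conjugate C) using () renaming (χ to ψ; χ-periodic to ψ-periodic; χ-zero to ψ-zero)
  private module M = ℤ/ (+ q)

  C̄ = conjugate C
  J = jacobi C
  J̄ = jacobi C̄
  K = correlation C C̄
  g = gauss C
  ḡ = gauss C̄

  ∑-const : ∀ x → ∑ (λ _ → x) ≡ ι (+ q) ⊗ x
  ∑-const x = go
    where
    opaque
      unfolding ∑
      replicate-sum : ∀ n → E.sum {n} (λ _ → x) ≡ ι (+ n) ⊗ x
      replicate-sum zero = sym (E.zeroˡ x)
      replicate-sum (suc n) = trans (cong₂ _⊕_ (sym (⊗-identityˡ x)) (replicate-sum n)) (sym (E.distribʳ x 𝟙 (ι (+ n))))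
      go : ∑ (λ _ → x) ≡ ι (+ q) ⊗ x
      go = replicate-sum q

  ∑-δ : ∀ x → ∑ (λ t → δ 0ℤ t ⊗ x) ≡ x
  ∑-δ x = trans (∑-single (λ e → cong (_⊗ x) (δ-periodic 0ℤ e)) 0ℤ (λ a ne → trans (cong (_⊗ x) (δ-no ne)) (E.zeroˡ x)))
    (trans (cong (_⊗ x) (δ-yes (M.refl {0ℤ}))) (⊗-identityˡ x))

  χψ : ∀ a → χ a ⊗ ψ a ≡ 𝟙 ⊕ ⊖ (δ 0ℤ a ⊗ 𝟙)
  χψ a with a ~? 0ℤ
  ... | yes e = trans (cong (_⊗ ψ a) (χ-zero e)) (trans (E.zeroˡ _) (cong (λ d → 𝟙 ⊕ ⊖ (d ⊗ 𝟙)) (sym (δ-yes e))))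
  ... | no ne = trans (cubic-⊗-conj (cubic a) (χ-unit ne)) (cong (λ d → 𝟙 ⊕ ⊖ (d ⊗ 𝟙)) (sym (δ-no ne)))

  ∑χψ : ∑ (λ a → χ a ⊗ ψ a) ≡ ι (+ q) ⊗ 𝟙 ⊕ ⊖ 𝟙
  ∑χψ = trans (∑-cong χψ) (trans (∑-+ (λ _ → 𝟙) (λ a → ⊖ (δ 0ℤ a ⊗ 𝟙))) (cong₂ _⊕_ (∑-const 𝟙)
    (trans (∑-cong (λ a → lem (δ 0ℤ a) 𝟙)) (∑-δ (⊖ 𝟙)))))
    where
    lem : ∀ x y → ⊖ (x ⊗ y) ≡ x ⊗ (⊖ y)
    lem = solve-∀ 𝔼-acr

  g⋆ḡ : ∀ t → at (g ⋆ ḡ) t ≡ δ 0ℤ t ⊗ (ι (+ q) ⊗ 𝟙 ⊕ ⊖ 𝟙 ⊕ ⊖ K) ⊕ K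
  g⋆ḡ t with t ~? 0ℤ
  ... | yes e = trans (gauss⋆gauss-0 C C̄ e) (trans ∑χψ (trans (lem _ K) (cong (λ d → d ⊗ (ι (+ q) ⊗ 𝟙 ⊕ ⊖ 𝟙 ⊕ ⊖ K) ⊕ K) (sym (δ-yes e)))))
    where
    lem : ∀ x y → x ≡ 𝟙 ⊗ (x ⊕ ⊖ y) ⊕ y
    lem = solve-∀ 𝔼-acr
  ... | no ne = trans (gauss⋆gauss-unit C C̄ ne) (trans (cong (_⊗ K) (cubic-⊗-conj (cubic t) (χ-unit ne)))
    (trans (lem (ι (+ q) ⊗ 𝟙 ⊕ ⊖ 𝟙 ⊕ ⊖ K) K) (cong (λ d → d ⊗ (ι (+ q) ⊗ 𝟙 ⊕ ⊖ 𝟙 ⊕ ⊖ K) ⊕ K) (sym (δ-no ne)))))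
    where
    lem : ∀ x y → 𝟙 ⊗ y ≡ 𝟘 ⊗ x ⊕ y
    lem = solve-∀ 𝔼-acr

  -- The sum of all values is multiplicative for convolution, and the sum of ψ is 0.
  ∑g⋆ḡ≡0 : ∑ (at (g ⋆ ḡ)) ≡ 𝟘
  ∑g⋆ḡ≡0 = trans (∑-cong (at-⋆ g ḡ)) (trans (∑-swap (λ t a → χ a ⊗ ψ (t - a)))
    (trans (∑-cong {g = λ a → χ a ⊗ 𝟘} (λ a → trans (sym (∑-*ˡ (χ a) (λ t → ψ (t - a))))
      (cong (χ a ⊗_) (trans (sym (∑-shift ψ-periodic a)) (∑χ≡0 C̄)))))
    (trans (sym (∑-*ʳ 𝟘 χ)) (E.zeroʳ _))))

  ∑g⋆ḡ : ι (+ q) ⊗ 𝟙 ⊕ ⊖ 𝟙 ⊕ ⊖ K ⊕ ι (+ q) ⊗ K ≡ 𝟘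
  ∑g⋆ḡ = trans (sym (cong₂ _⊕_ (∑-δ X) (∑-const K))) (trans (sym (∑-+ (λ t → δ 0ℤ t ⊗ X) (λ _ → K)))
    (trans (sym (∑-cong g⋆ḡ)) ∑g⋆ḡ≡0))
    where
    X : Eisenstein
    X = ι (+ q) ⊗ 𝟙 ⊕ ⊖ 𝟙 ⊕ ⊖ K

  -- g ⋆ ḡ equals q - 1 at 0 and K elsewhere, so its vanishing total is (q - 1) (1 + K).
  K≡−1 : K ≡ ⊖ 𝟙
  K≡−1 = ι-cancel {+ q - 1ℤ} q−1≢0 (affine (ι (+ q)) K ∑g⋆ḡ)
    where
    rearrange : ∀ x k → (x ⊕ ⊖ 𝟙) ⊗ k ≡ x ⊗ 𝟙 ⊕ ⊖ 𝟙 ⊕ ⊖ k ⊕ x ⊗ k ⊕ (x ⊕ ⊖ 𝟙) ⊗ (⊖ 𝟙)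
    rearrange = solve-∀ 𝔼-acr
    affine : ∀ x k → x ⊗ 𝟙 ⊕ ⊖ 𝟙 ⊕ ⊖ k ⊕ x ⊗ k ≡ 𝟘 → (x ⊕ ⊖ 𝟙) ⊗ k ≡ (x ⊕ ⊖ 𝟙) ⊗ (⊖ 𝟙)
    affine x k e = trans (rearrange x k) (trans (cong (_⊕ (x ⊕ ⊖ 𝟙) ⊗ (⊖ 𝟙)) e) (E.+-identityˡ _))
    q−1≢0 : + q - 1ℤ ≢ 0ℤ
    q−1≢0 e = ℕ.<⇒≢ (ℕ.nonTrivial⇒n>1 q {{prime⇒nonTrivial pr}}) (sym (ℤ.+-injective (ℤ.i-j≡0⇒i≡j (+ q) 1ℤ e)))

  g⋆ḡ-values : ∀ t → at (g ⋆ ḡ) t ≡ δ 0ℤ t ⊗ ι (+ q) ⊕ ⊖ 𝟙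
  g⋆ḡ-values t = trans (g⋆ḡ t) (trans (cong (λ k → δ 0ℤ t ⊗ (ι (+ q) ⊗ 𝟙 ⊕ ⊖ 𝟙 ⊕ ⊖ k) ⊕ k) K≡−1) (lem (δ 0ℤ t) (ι (+ q))))
    where
    lem : ∀ d x → d ⊗ (x ⊗ 𝟙 ⊕ ⊖ 𝟙 ⊕ ⊖ (⊖ 𝟙)) ⊕ ⊖ 𝟙 ≡ d ⊗ x ⊕ ⊖ 𝟙
    lem = solve-∀ 𝔼-acr

  -- g ⋆ ḡ is q times the unit minus the constant 1, and convolving g with a constant gives a
  -- multiple of the sum of χ, which is 0.
  g⋆g⋆ḡ : g ⋆ (g ⋆ ḡ) ≗ κ (ι (+ q)) ⋆ g
  at≡ g⋆g⋆ḡ t = begin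
    at (g ⋆ (g ⋆ ḡ)) t                                         ≡⟨ at-⋆ g (g ⋆ ḡ) t ⟩
    ∑ (λ a → χ a ⊗ at (g ⋆ ḡ) (t - a))                         ≡⟨ ∑-cong (λ a → trans (cong (χ a ⊗_) (g⋆ḡ-values (t - a))) (⊗-distribˡ (χ a) (δ 0ℤ (t - a) ⊗ ι (+ q)) (⊖ 𝟙))) ⟩
    ∑ (λ a → χ a ⊗ (δ 0ℤ (t - a) ⊗ ι (+ q)) ⊕ χ a ⊗ (⊖ 𝟙))     ≡⟨ ∑-+ (λ a → χ a ⊗ (δ 0ℤ (t - a) ⊗ ι (+ q))) (λ a → χ a ⊗ (⊖ 𝟙)) ⟩
    ∑ (λ a → χ a ⊗ (δ 0ℤ (t - a) ⊗ ι (+ q))) ⊕ ∑ (λ a → χ a ⊗ (⊖ 𝟙))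
      ≡⟨ cong₂ _⊕_ (trans (∑-cong (λ a → lem (χ a) (δ 0ℤ (t - a)) (ι (+ q)))) (trans (sym (∑-*ˡ (ι (+ q)) (λ a → χ a ⊗ δ 0ℤ (t - a))))
           (cong (ι (+ q) ⊗_) (trans (sym (at-⋆ g (δᶠ 0ℤ) t)) (trans (at≡ (⋆-comm g (δᶠ 0ℤ)) t) (at≡ (⋆-identityˡ g) t))))))
         (trans (sym (∑-*ʳ (⊖ 𝟙) χ)) (trans (cong (_⊗ (⊖ 𝟙)) (∑χ≡0 C)) (E.zeroˡ (⊖ 𝟙)))) ⟩
    ι (+ q) ⊗ χ t ⊕ 𝟘                                          ≡⟨ E.+-identityʳ _ ⟩
    ι (+ q) ⊗ χ t                                              ≡⟨ κ-⋆ (ι (+ q)) g t ⟨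
    at (κ (ι (+ q)) ⋆ g) t                                     ∎
    where
    open ≡-Reasoning
    lem : ∀ x y z → x ⊗ (y ⊗ z) ≡ z ⊗ (x ⊗ y)
    lem = solve-∀ 𝔼-acr

  ḡ² : ḡ ⋆ ḡ ≗ κ J̄ ⋆ g
  ḡ² = G.trans (gauss² C̄) (G.*-cong (G.refl {κ J̄}) (pw λ t → conj-conj (χ t)))
    where
    conj-conj : ∀ x → conj (conj x) ≡ x
    conj-conj ⟨ a , b ⟩ = cong₂ ⟨_,_⟩ (lem a b) (ℤ.neg-involutive b)
      where
      lem : ∀ a b → a - b - (- b) ≡ a
      lem = ℤ-solve

  -- `norm-relation` is read off at 1, where g ⋆ ḡ has the value - 1. This replaces the cancellation
  -- that the algebra does not permit.
  J⊗J̄ : J ⊗ J̄ ≡ ι (+ q)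
  J⊗J̄ = begin
    J ⊗ J̄                          ≡⟨ neg (J ⊗ J̄) ⟩
    ⊖ ((J ⊗ J̄) ⊗ (⊖ 𝟙))            ≡⟨ cong (λ p → ⊖ ((J ⊗ J̄) ⊗ p)) P1 ⟨
    ⊖ ((J ⊗ J̄) ⊗ at (g ⋆ ḡ) 1ℤ)    ≡⟨ cong ⊖_ (κ-⋆ (J ⊗ J̄) (g ⋆ ḡ) 1ℤ) ⟨
    ⊖ at (κ (J ⊗ J̄) ⋆ (g ⋆ ḡ)) 1ℤ  ≡⟨ cong ⊖_ (at≡ (G.trans (G.*-cong (G.sym (κ-⊗ J J̄)) (G.refl {g ⋆ ḡ})) (PowerRelations.norm-relation groupRing (gauss² C) ḡ² g⋆g⋆ḡ)) 1ℤ) ⟩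
    ⊖ at (κ (ι (+ q)) ⋆ (g ⋆ ḡ)) 1ℤ ≡⟨ cong ⊖_ (κ-⋆ (ι (+ q)) (g ⋆ ḡ) 1ℤ) ⟩
    ⊖ (ι (+ q) ⊗ at (g ⋆ ḡ) 1ℤ)    ≡⟨ cong (λ p → ⊖ (ι (+ q) ⊗ p)) P1 ⟩
    ⊖ (ι (+ q) ⊗ (⊖ 𝟙))            ≡⟨ neg (ι (+ q)) ⟨
    ι (+ q)                        ∎
    where
    open ≡-Reasoning
    neg : ∀ x → x ≡ ⊖ (x ⊗ (⊖ 𝟙))
    neg = solve-∀ 𝔼-acr
    P1 : at (g ⋆ ḡ) 1ℤ ≡ ⊖ 𝟙
    P1 = trans (g⋆ḡ-values 1ℤ) (trans (cong (λ d → d ⊗ ι (+ q) ⊕ ⊖ 𝟙) (δ-no (prime≢0 pr refl)))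
      (trans (cong (_⊕ ⊖ 𝟙) (E.zeroˡ (ι (+ q)))) (E.+-identityˡ _)))

  norm-J : norm J ≡ + q
  norm-J = cong re (trans (sym (⊗-conj J)) (trans (cong (J ⊗_) (sym (jacobi-conj C))) J⊗J̄))

  g⁴ : (g ⋆ g) ⋆ (g ⋆ g) ≗ κ (ι (+ q) ⊗ J) ⋆ g
  g⁴ = G.trans (PowerRelations.fourth-power groupRing (gauss² C) ḡ² g⋆g⋆ḡ)
    (G.*-cong (G.trans (G.*-cong (G.refl {κ J}) (κ-⊗ J J̄)) (G.trans (κ-⊗ J (J ⊗ J̄)) (G.reflexive (cong κ (trans (cong (J ⊗_) J⊗J̄) (⊗-comm J _)))))) (G.refl {g}))

  g^3k+1 : ∀ k → g G.^ suc (3 ℕ.* k) ≗ κ ((ι (+ q) ⊗ J) E.^ k) ⋆ g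
  g^3k+1 k = G.trans (PowerRelations.power-3k+1 groupRing g⁴ k) (G.*-cong (κ^ (ι (+ q) ⊗ J) k) (G.refl {g}))

  module _ {ℓ : ℕ} (ℓ-prime : Prime ℓ) (ℓ≢q : ℓ ≢ q) where
    private
      module L = 𝔼/ (+ ℓ)

      cancel : ∀ {a b} → + ℓ * a ≋ + ℓ * b [ + q ] → a ≋ b [ + q ]
      cancel {a} {b} e = [ (λ h → contradiction (sym (prime-∣prime pr ℓ-prime h)) ℓ≢q) , ≋-add ]′
        (prime-cancel pr (+ ℓ) (a - b) (M.trans (M.reflexive (lem (+ ℓ) a b)) (≋-sub e)))
        where
        lem : ∀ l a b → l * (a - b) ≡ l * a - l * b
        lem = ℤ-solve

    gauss-frobenius : at (g G.^ ℓ) (+ ℓ) ≋ᴱ 𝟙 [ + ℓ ]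
    gauss-frobenius = subst₂ _≋ᴱ_[ + ℓ ] (cong (at (g G.^ ℓ)) (ℤ.*-identityʳ (+ ℓ)))
      (trans (cong (E._^ ℓ) (χ-1 C)) (𝟙^ ℓ)) (frobenius-at ℓ-prime g 1ℤ cancel)

    jacobi-power-1 : ∀ k → ℓ ≡ suc (3 ℕ.* k) → (ι (+ q) ⊗ J) E.^ k ⊗ χ (+ ℓ) ≋ᴱ 𝟙 [ + ℓ ]
    jacobi-power-1 k e = L.trans (L.≈-reflexive (trans (sym (κ-⋆ ((ι (+ q) ⊗ J) E.^ k) g (+ ℓ)))
      (trans (sym (at≡ (g^3k+1 k) (+ ℓ))) (cong (λ n → at (g G.^ n) (+ ℓ)) (sym e))))) gauss-frobenius

    -- Here g^ℓ = (q J)^k J ḡ. Its value at ℓ contains ψ(ℓ), which is removed by multiplying with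
    -- its inverse χ(ℓ).
    jacobi-power-2 : ∀ k → ℓ ≡ suc (suc (3 ℕ.* k)) → (ι (+ q) ⊗ J) E.^ k ⊗ J ≋ᴱ χ (+ ℓ) [ + ℓ ]
    jacobi-power-2 k e = L.trans (L.≈-reflexive rearrange) (L.trans (L.*-cong (L.trans (L.≈-reflexive value) gauss-frobenius) (L.refl {χ (+ ℓ)}))
      (L.≈-reflexive (⊗-identityˡ _)))
      where
      x = (ι (+ q) ⊗ J) E.^ k
      ℓ-unit : ¬ + ℓ ≋ 0ℤ [ + q ]
      ℓ-unit h = ℓ≢q (sym (prime-∣prime pr ℓ-prime h))
      value : (x ⊗ J) ⊗ ψ (+ ℓ) ≡ at (g G.^ ℓ) (+ ℓ)
      value = sym (trans (cong (λ n → at (g G.^ n) (+ ℓ)) e) (trans (at≡ relation (+ ℓ)) (κ-⋆ (x ⊗ J) ḡ (+ ℓ))))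
        where
        relation : g ⋆ g G.^ suc (3 ℕ.* k) ≗ κ (x ⊗ J) ⋆ ḡ
        relation = G.trans (G.*-cong (G.refl {g}) (g^3k+1 k)) (G.trans (G.trans (G.sym (G.*-assoc g (κ x) g))
          (G.trans (G.*-cong (G.*-comm g (κ x)) (G.refl {g})) (G.*-assoc (κ x) g g)))
          (G.trans (G.*-cong (G.refl {κ x}) (gauss² C)) (G.trans (G.sym (G.*-assoc (κ x) (κ J) ḡ)) (G.*-cong (κ-⊗ x J) (G.refl {ḡ})))))
      rearrange : x ⊗ J ≡ ((x ⊗ J) ⊗ ψ (+ ℓ)) ⊗ χ (+ ℓ)
      rearrange = sym (trans (E.*-assoc (x ⊗ J) (ψ (+ ℓ)) (χ (+ ℓ))) (trans (cong ((x ⊗ J) ⊗_) (trans (⊗-comm _ _) (cubic-⊗-conj (cubic (+ ℓ)) (χ-unit ℓ-unit)))) (E.*-identityʳ _)))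

  -- This is Frobenius for ℓ = 3: g³ = J (g ⋆ ḡ) has the value - J at 3. It shows that Jacobi sums
  -- are primary.
  jacobi-mod-3 : q ≢ 3 → J ≋ᴱ ⊖ 𝟙 [ + 3 ]
  jacobi-mod-3 q≢3 = L.trans (L.≈-reflexive rearrange) (L.-‿cong (L.trans (L.≈-reflexive value) (gauss-frobenius prime-3 (λ e → q≢3 (sym e)))))
    where
    module L = 𝔼/ (+ 3)
    relation : g ⋆ (g ⋆ (g ⋆ δᶠ 0ℤ)) ≗ κ J ⋆ (g ⋆ ḡ)
    relation = G.trans (G.*-cong (G.refl {g}) (G.trans (G.*-cong (G.refl {g}) (G.*-identityʳ g)) (gauss² C)))
      (G.trans (G.sym (G.*-assoc g (κ J) ḡ)) (G.trans (G.*-cong (G.*-comm g (κ J)) (G.refl {ḡ})) (G.*-assoc (κ J) g ḡ)))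
    value : J ⊗ (⊖ 𝟙) ≡ at (g G.^ 3) (+ 3)
    value = sym (trans (at≡ relation (+ 3)) (trans (κ-⋆ J (g ⋆ ḡ) (+ 3)) (cong (J ⊗_) (trans (g⋆ḡ-values (+ 3))
      (trans (cong (λ d → d ⊗ ι (+ q) ⊕ ⊖ 𝟙) (δ-no (λ h → q≢3 (prime-∣prime pr prime-3 h))))
      (trans (cong (_⊕ ⊖ 𝟙) (E.zeroˡ (ι (+ q)))) (E.+-identityˡ _)))))))
    rearrange : J ≡ ⊖ (J ⊗ (⊖ 𝟙))
    rearrange = lem J
      where
      lem : ∀ x → x ≡ ⊖ (x ⊗ (⊖ 𝟙))
      lem = solve-∀ 𝔼-acr


-- Rational cubic reciprocity

-- `X` plays the cubic residue symbol modulo β on rational integers. As N(β) β = β² β̄, the power in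
-- `X-prime-1` is the inverse of the cubic symbol of β at ℓ; the power in `X-prime-2` is β^((ℓ² - 1)
-- / 3) modulo ℓ, that is, the symbol itself. Both fields therefore say that the symbols of ℓ modulo
-- β and of β modulo ℓ agree.
record RationalSymbol (β : Eisenstein) : Set where
  field
    X          : ℤ → Eisenstein
    X-cubic    : ∀ a → Cubic (X a)
    X-1        : X 1ℤ ≡ 𝟙
    X-*        : ∀ a b → X (a * b) ≡ X a ⊗ X b
    X-periodic : ∀ {a b} → a ≋ b [ norm β ] → X a ≡ X b
    X-prime-1  : ∀ {ℓ} → Prime ℓ → ℓ ≢ 3 → ¬ norm β ≋ 0ℤ [ + ℓ ] → ∀ k → ℓ ≡ suc (3 ℕ.* k) →
                 (ι (norm β) ⊗ β) E.^ k ⊗ X (+ ℓ) ≋ᴱ 𝟙 [ + ℓ ]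
    X-prime-2  : ∀ {ℓ} → Prime ℓ → ℓ ≢ 3 → ¬ norm β ≋ 0ℤ [ + ℓ ] → ∀ k → ℓ ≡ suc (suc (3 ℕ.* k)) →
                 (ι (norm β) ⊗ β) E.^ k ⊗ β ≋ᴱ X (+ ℓ) [ + ℓ ]

≋-weaken : ∀ {a b m} n → a ≋ b [ m * n ] → a ≋ b [ m ]
≋-weaken {a} {b} {m} n (z by e) = (n * z) by trans e (cong (_+_ b) (ℤ.*-assoc m n z))

-- Both reciprocity laws are multiplicative in β, because β ↦ N(β) β is.
symbol-⊗ : ∀ {β γ} → RationalSymbol β → RationalSymbol γ → RationalSymbol (β ⊗ γ)
symbol-⊗ {β} {γ} S T = record
  { X = λ a → S.X a ⊗ T.X a
  ; X-cubic = λ a → Cubic-⊗ (S.X-cubic a) (T.X-cubic a)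
  ; X-1 = cong₂ _⊗_ S.X-1 T.X-1
  ; X-* = λ a b → trans (cong₂ _⊗_ (S.X-* a b) (T.X-* a b)) (interchange (S.X a) (S.X b) (T.X a) (T.X b))
  ; X-periodic = λ {a} {b} e → cong₂ _⊗_
      (S.X-periodic (≋-weaken (norm γ) (subst (a ≋ b [_]) (norm-⊗ β γ) e)))
      (T.X-periodic (≋-weaken (norm β) (subst (a ≋ b [_]) (trans (norm-⊗ β γ) (ℤ.*-comm (norm β) (norm γ))) e)))
  ; X-prime-1 = λ {ℓ} pr ne nd k e → let module L = 𝔼/ (+ ℓ) in
      L.trans (L.≈-reflexive (trans (cong (_⊗ (S.X (+ ℓ) ⊗ T.X (+ ℓ))) (power k)) (interchange (P k) (Q k) (S.X (+ ℓ)) (T.X (+ ℓ)))))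
      (L.trans (L.*-cong (S.X-prime-1 pr ne (ndβ nd) k e) (T.X-prime-1 pr ne (ndγ nd) k e)) (L.≈-reflexive (⊗-identityˡ 𝟙)))
  ; X-prime-2 = λ {ℓ} pr ne nd k e → let module L = 𝔼/ (+ ℓ) in
      L.trans (L.≈-reflexive (trans (cong (_⊗ (β ⊗ γ)) (power k)) (interchange (P k) (Q k) β γ)))
      (L.*-cong (S.X-prime-2 pr ne (ndβ nd) k e) (T.X-prime-2 pr ne (ndγ nd) k e)) }
  where
  module S = RationalSymbol S
  module T = RationalSymbol T
  P Q : ℕ → Eisenstein
  P k = (ι (norm β) ⊗ β) E.^ k
  Q k = (ι (norm γ) ⊗ γ) E.^ k
  interchange : ∀ x y z w → (x ⊗ y) ⊗ (z ⊗ w) ≡ (x ⊗ z) ⊗ (y ⊗ w)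
  interchange = solve-∀ 𝔼-acr
  power : ∀ k → (ι (norm (β ⊗ γ)) ⊗ (β ⊗ γ)) E.^ k ≡ P k ⊗ Q k
  power k = trans (cong (E._^ k) (trans (cong (λ n → n ⊗ (β ⊗ γ)) (trans (cong ι (norm-⊗ β γ)) (sym (ι-⊗ (norm β) (norm γ)))))
    (interchange (ι (norm β)) (ι (norm γ)) β γ))) (E.^-distrib-* (ι (norm β) ⊗ β) (ι (norm γ) ⊗ γ) k)
  ndβ : ∀ {ℓ} → ¬ norm (β ⊗ γ) ≋ 0ℤ [ ℓ ] → ¬ norm β ≋ 0ℤ [ ℓ ]
  ndβ nd h = nd (subst (_≋ 0ℤ [ _ ]) (sym (norm-⊗ β γ)) (≋-mul0ˡ (norm γ) h))
  ndγ : ∀ {ℓ} → ¬ norm (β ⊗ γ) ≋ 0ℤ [ ℓ ] → ¬ norm γ ≋ 0ℤ [ ℓ ]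
  ndγ nd h = nd (subst (_≋ 0ℤ [ _ ]) (sym (norm-⊗ β γ)) (≋-mul0ʳ (norm β) h))

ι-^ : ∀ a n → ι a E.^ n ≡ ι (a ^ n)
ι-^ a zero = refl
ι-^ a (suc n) = trans (cong (ι a ⊗_) (ι-^ a n)) (ι-⊗ a (a ^ n))

ι-cong : ∀ {m a b} → a ≋ b [ m ] → ι a ≋ᴱ ι b [ m ]
ι-cong {m} {a} {b} (z by e) = ι z by trans (cong ι e) (cong (ι b ⊕_) (sym (ι-⊗ m z)))

module _ (t : ℤ) where
  private
    norm-ι : norm (ι t) ≡ t * t
    norm-ι = lem t
      where
      lem : ∀ t → t * t - t * 0ℤ + 0ℤ * 0ℤ ≡ t * t
      lem = ℤ-solve

    power : ∀ k → (ι (norm (ι t)) ⊗ ι t) E.^ k ≡ ι (t ^ (3 ℕ.* k))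
    power k = trans (cong (E._^ k) (trans (ι-⊗ (norm (ι t)) t) (cong ι (trans (cong (_* t) norm-ι) (cube t)))))
      (trans (ι-^ (t ^ 3) k) (cong ι (ℤ.^-*-assoc t 3 k)))
      where
      cube : ∀ t → t * t * t ≡ t * (t * (t * 1ℤ))
      cube = ℤ-solve

    t≢0 : ∀ {ℓ} → ¬ norm (ι t) ≋ 0ℤ [ ℓ ] → ¬ t ≋ 0ℤ [ ℓ ]
    t≢0 nd h = nd (subst (_≋ 0ℤ [ _ ]) (sym norm-ι) (≋-mul0ˡ t h))

  -- For β = t the element N(β) β is the cube t³, so by Fermat the laws hold with the constant
  -- symbol 1.
  symbol-ι : RationalSymbol (ι t)
  symbol-ι = record
    { X = λ _ → 𝟙
    ; X-cubic = λ _ → ζ₀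
    ; X-1 = refl
    ; X-* = λ _ _ → refl
    ; X-periodic = λ _ → refl
    ; X-prime-1 = λ {ℓ} pr ne nd k e → let module L = 𝔼/ (+ ℓ) in
        L.trans (L.≈-reflexive (trans (E.*-identityʳ _) (power k))) (ι-cong (fermat-unit pr e t (t≢0 nd)))
    ; X-prime-2 = λ {ℓ} pr ne nd k e → let module L = 𝔼/ (+ ℓ) in
        L.trans (L.≈-reflexive (trans (cong (_⊗ ι t) (power k)) (trans (ι-⊗ (t ^ (3 ℕ.* k)) t) (cong ι (ℤ.*-comm (t ^ (3 ℕ.* k)) t)))))
        (ι-cong (fermat-unit pr e t (t≢0 nd))) }

symbol-jacobi : ∀ {q} (pr : Prime q) (C : CubicCharacter q) → RationalSymbol (CharacterSums.jacobi pr C)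
symbol-jacobi {q} pr C = record
  { X = χ
  ; X-cubic = cubic
  ; X-1 = CharacterSums.χ-1 pr C
  ; X-* = χ-*
  ; X-periodic = λ {a} {b} e → χ-periodic (subst (a ≋ b [_]) norm-J e)
  ; X-prime-1 = λ {ℓ} ℓ-prime _ nd k e → subst (λ n → (ι n ⊗ J) E.^ k ⊗ χ (+ ℓ) ≋ᴱ 𝟙 [ + ℓ ]) (sym norm-J)
      (jacobi-power-1 ℓ-prime (ℓ≢q nd) k e)
  ; X-prime-2 = λ {ℓ} ℓ-prime _ nd k e → subst (λ n → (ι n ⊗ J) E.^ k ⊗ J ≋ᴱ χ (+ ℓ) [ + ℓ ]) (sym norm-J)
      (jacobi-power-2 ℓ-prime (ℓ≢q nd) k e) }
  where
  open JacobiSums pr C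
  open CubicCharacter C
  ℓ≢q : ∀ {ℓ} → ¬ norm J ≋ 0ℤ [ + ℓ ] → ℓ ≢ q
  ℓ≢q nd refl = nd (1ℤ by trans norm-J (lem (+ q)))
    where
    lem : ∀ q → q ≡ 0ℤ + q * 1ℤ
    lem = ℤ-solve

-- Primary elements as products of rational integers and Jacobi sums

Primary : Eisenstein → Set
Primary ⟨ a , b ⟩ = ¬ a ≋ 0ℤ [ + 3 ] × b ≋ 0ℤ [ + 3 ]

primary-norm : ∀ {β} → Primary β → ¬ norm β ≋ 0ℤ [ + 3 ]
primary-norm {⟨ a , b ⟩} (3∤a , 3∣b) h = [ 3∤a , 3∤a ]′ (prime-cancel prime-3 a a
  (M.trans (M.reflexive (lem a b)) (M.+-cong h (≋-mul0ˡ (a - b) 3∣b))))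
  where
  module M = ℤ/ (+ 3)
  lem : ∀ a b → a * a ≡ a * a - a * b + b * b + b * (a - b)
  lem = ℤ-solve

primary-factor : ∀ {β γ δ} → Primary β → β ≡ δ ⊗ γ → γ ≋ᴱ ⊖ 𝟙 [ + 3 ] → Primary δ
primary-factor {⟨ a , b ⟩} {γ} {⟨ c , d ⟩} (3∤a , 3∣b) β≡ (⟨ z , z′ ⟩ by e) =
    (λ 3∣c → 3∤a (M.trans (M.reflexive (trans (cong re β≡′) (lem₁ c d z z′))) (M.+-cong (≋-mul0ʳ (- 1ℤ) 3∣c) (multiple (c * z - d * z′)))))
  , M.trans (M.reflexive (trans (lem₂ c d z z′) (cong (λ b → - b + + 3 * (c * z′ + d * z - d * z′)) (sym (cong im β≡′)))))
      (M.+-cong (M.-‿cong 3∣b) (multiple (c * z′ + d * z - d * z′)))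
  where
  module M = ℤ/ (+ 3)
  γ′ : Eisenstein
  γ′ = ⟨ - 1ℤ + + 3 * z , + 3 * z′ ⟩
  β≡′ : ⟨ a , b ⟩ ≡ ⟨ c , d ⟩ ⊗ γ′
  β≡′ = trans β≡ (cong (⟨ c , d ⟩ ⊗_) (trans e (trans (cong (⊖ 𝟙 ⊕_) (ι-⊗-⟨⟩ (+ 3) z z′))
    (cong (λ y → ⟨ - 1ℤ + + 3 * z , y ⟩) (ℤ.+-identityˡ (+ 3 * z′))))))
  multiple : ∀ n → + 3 * n ≋ 0ℤ [ + 3 ]
  multiple n = n by sym (ℤ.+-identityˡ (+ 3 * n))
  lem₁ : ∀ c d z z′ → c * (- 1ℤ + + 3 * z) - d * (+ 3 * z′) ≡ - 1ℤ * c + + 3 * (c * z - d * z′)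
  lem₁ = ℤ-solve
  lem₂ : ∀ c d z z′ → d ≡ - (c * (+ 3 * z′) + d * (- 1ℤ + + 3 * z) - d * (+ 3 * z′)) + + 3 * (c * z′ + d * z - d * z′)
  lem₂ = ℤ-solve

module _ {q : ℕ} {w : ℤ} (root : w * w + w + 1ℤ ≋ 0ℤ [ + q ]) where
  private module M = ℤ/ (+ q)
  open Evaluation q w root using (ev)

  -- If β and γ lie in the same prime above q, then conj γ lies in the conjugate prime and the
  -- product is divisible by q. For a Jacobi sum γ, of norm q, this means that γ divides β.
  common-root : ∀ β γ → ev β ≋ 0ℤ [ + q ] → ev γ ≋ 0ℤ [ + q ] → ∃ λ δ → β ⊗ conj γ ≡ ι (+ q) ⊗ δ
  common-root ⟨ a , b ⟩ ⟨ c , d ⟩ hβ hγ = ⟨ _≈_[mod_].quotient re≋0 , _≈_[mod_].quotient im≋0 ⟩ ,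
    trans (cong₂ ⟨_,_⟩ (trans (_≈_[mod_].equation re≋0) (ℤ.+-identityˡ _)) (trans (_≈_[mod_].equation im≋0) (ℤ.+-identityˡ _)))
      (sym (ι-⊗-⟨⟩ (+ q) (_≈_[mod_].quotient re≋0) (_≈_[mod_].quotient im≋0)))
    where
    lem₁ : ∀ a b c d w → a * (c - d) - b * (- d)
      ≡ (a + b * w) * (c - d) - (b * w) * (c + d * w) + b * d * (w * w + w + 1ℤ)
    lem₁ = ℤ-solve
    lem₂ : ∀ a b c d w → a * (- d) + b * (c - d) - b * (- d) ≡ - d * (a + b * w) + b * (c + d * w)
    lem₂ = ℤ-solve
    re≋0 : a * (c - d) - b * (- d) ≋ 0ℤ [ + q ]
    re≋0 = M.trans (M.reflexive (lem₁ a b c d w)) (M.+-cong (M.+-cong (≋-mul0ˡ (c - d) hβ) (M.-‿cong (≋-mul0ʳ (b * w) hγ))) (≋-mul0ʳ (b * d) root))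
    im≋0 : a * (- d) + b * (c - d) - b * (- d) ≋ 0ℤ [ + q ]
    im≋0 = M.trans (M.reflexive (lem₂ a b c d w)) (M.+-cong (≋-mul0ʳ (- d) hβ) (≋-mul0ʳ b hγ))


mod-3-cases : ∀ n → (∃ λ k → n ≡ 3 ℕ.* k) ⊎ (∃ λ k → n ≡ suc (3 ℕ.* k)) ⊎ (∃ λ k → n ≡ suc (suc (3 ℕ.* k)))
mod-3-cases zero = inj₁ (0 , refl)
mod-3-cases (suc n) with mod-3-cases n
... | inj₁ (k , e) = inj₂ (inj₁ (k , cong suc e))
... | inj₂ (inj₁ (k , e)) = inj₂ (inj₂ (k , cong suc e))
... | inj₂ (inj₂ (k , e)) = inj₁ (suc k , trans (cong suc e) (sym (ℕ.*-suc 3 k)))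

prime-mod-3 : ∀ {p} → Prime p → p ≢ 3 → (∃ λ k → p ≡ suc (3 ℕ.* suc k)) ⊎ (∃ λ k → p ≡ suc (suc (3 ℕ.* k)))
prime-mod-3 {p} pr p≢3 with mod-3-cases p
... | inj₁ (k , e) = contradiction (sym (prime-∣prime prime-3 pr ((+ k) by trans (cong +_ e) (trans (ℤ.pos-* 3 k) (sym (ℤ.+-identityˡ _)))))) p≢3
... | inj₂ (inj₁ (zero , e)) = contradiction e (ℕ.nonTrivial⇒≢1 {{prime⇒nonTrivial pr}})
... | inj₂ (inj₁ (suc k , e)) = inj₁ (k , e)
... | inj₂ (inj₂ h) = inj₂ h

prime-divisor : ∀ n → n ≢ 0 → n ≢ 1 → ∃ λ p → Prime p × p ℕ.∣ n
prime-divisor n n≢0 n≢1 = first (factors f) (isFactorisation f) (factorsPrime f)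
  where
  open PrimeFactorisation
  f = factorise n {{ℕ.≢-nonZero n≢0}}
  first : ∀ ps → n ≡ product ps → All Prime ps → ∃ λ p → Prime p × p ℕ.∣ n
  first [] e _ = contradiction e n≢1
  first (p ∷ ps) e (pr ∷ _) = p , pr , ℕ.divides (product ps) (trans e (ℕ.*-comm p (product ps)))

square-abs : ∀ x → x * x ≡ + (∣ x ∣ ℕ.* ∣ x ∣)
square-abs (+ n) = sym (ℤ.pos-* n n)
square-abs (-[1+ n ]) = refl

-- With b = 3 c one has 4 N = 27 c² + (2 a - b)², too large for N = 1 unless c = 0. It ensures that
-- an element with b ≠ 0 still has a prime to split off.
primary-unit-im : ∀ {a b} → Primary ⟨ a , b ⟩ → ∣ norm ⟨ a , b ⟩ ∣ ≡ 1 → b ≡ 0ℤ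
primary-unit-im {a} {b} (_ , (c by e)) N≡1 = zero-c ∣ c ∣ refl
  where
  s = + 2 * a - b
  lem : ∀ a b c → b ≡ + 3 * c → + 4 * (a * a - a * b + b * b) ≡ + 27 * (c * c) + (+ 2 * a - b) * (+ 2 * a - b)
  lem a _ c refl = lem′ a c
    where
    lem′ : ∀ a c → + 4 * (a * a - a * (+ 3 * c) + + 3 * c * (+ 3 * c)) ≡ + 27 * (c * c) + (+ 2 * a - + 3 * c) * (+ 2 * a - + 3 * c)
    lem′ = ℤ-solve
  bound : 4 ≡ 27 ℕ.* (∣ c ∣ ℕ.* ∣ c ∣) ℕ.+ ∣ s ∣ ℕ.* ∣ s ∣
  bound = trans (sym (trans (ℤ.abs-* (+ 4) (norm ⟨ a , b ⟩)) (cong (4 ℕ.*_) N≡1)))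
    (cong ∣_∣ (trans (lem a b c (trans e (ℤ.+-identityˡ _))) (cong₂ _+_
      (trans (cong (+ 27 *_) (square-abs c)) (sym (ℤ.pos-* 27 (∣ c ∣ ℕ.* ∣ c ∣)))) (square-abs s))))
  zero-c : ∀ n → ∣ c ∣ ≡ n → b ≡ 0ℤ
  zero-c zero h = trans e (trans (ℤ.+-identityˡ _) (trans (cong (+ 3 *_) (ℤ.∣i∣≡0⇒i≡0 {c} h)) (ℤ.*-zeroʳ (+ 3))))
  zero-c (suc n) h = contradiction (ℕ.≤-trans (ℕ.*-monoʳ-≤ 27 (s≤s (z≤n {n ℕ.+ n ℕ.* suc n})))
    (ℕ.≤-trans (ℕ.m≤m+n (27 ℕ.* (suc n ℕ.* suc n)) (∣ s ∣ ℕ.* ∣ s ∣))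
      (ℕ.≤-reflexive (sym (trans bound (cong (λ n → 27 ℕ.* (n ℕ.* n) ℕ.+ ∣ s ∣ ℕ.* ∣ s ∣) h))))))
    (λ { (s≤s (s≤s (s≤s (s≤s ())))) })

proper-factor : ∀ {n} Q N → n ≡ Q * N → n ≢ 0ℤ → 1 ℕ.< ∣ Q ∣ → ∣ N ∣ ℕ.< ∣ n ∣
proper-factor Q N refl n≢0 1<Q = subst (∣ N ∣ ℕ.<_) (sym (trans (ℤ.abs-* Q N) (ℕ.*-comm ∣ Q ∣ ∣ N ∣)))
  (ℕ.m<m*n ∣ N ∣ ∣ Q ∣ {{ℕ.≢-nonZero λ e → n≢0 (trans (cong (Q *_) (ℤ.∣i∣≡0⇒i≡0 e)) (ℤ.*-zeroʳ Q))}} 1<Q)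

-- A root w would satisfy w³ ≡ 1, while Fermat gives w^(3k+1) ≡ 1. Then w ≡ 1, and w² + w + 1 ≡ 3.
prime-2-mod-3 : ∀ {q k w} → Prime q → q ≡ suc (suc (3 ℕ.* k)) → q ≢ 3 → ¬ w * w + w + 1ℤ ≋ 0ℤ [ + q ]
prime-2-mod-3 {q} {k} {w} pr q≡ q≢3 root = q≢3 (prime-∣prime pr prime-3 three)
  where
  module M = ℤ/ (+ q)
  w≢0 : ¬ w ≋ 0ℤ [ + q ]
  w≢0 h = prime≢0 pr {1ℤ} refl (M.trans (M.reflexive (lem w)) (M.+-cong root (M.-‿cong (≋-mul0ˡ (w + 1ℤ) h))))
    where
    lem : ∀ w → 1ℤ ≡ w * w + w + 1ℤ + - (w * (w + 1ℤ))
    lem = ℤ-solve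
  w³ : w ^ 3 ≋ 1ℤ [ + q ]
  w³ = ≋-add (M.trans (M.reflexive (lem w)) (≋-mul0ʳ (w - 1ℤ) root))
    where
    lem : ∀ w → w * (w * (w * 1ℤ)) - 1ℤ ≡ (w - 1ℤ) * (w * w + w + 1ℤ)
    lem = ℤ-solve
  w≋1 : w ≋ 1ℤ [ + q ]
  w≋1 = M.trans (M.sym (M.trans (M.*-cong (M.refl {w}) (M.trans (M.reflexive (sym (ℤ.^-*-assoc w 3 k))) (M.trans (^-congᵐ k w³)
    (M.reflexive (ℤ.^-zeroˡ k))))) (M.reflexive (ℤ.*-identityʳ w)))) (fermat-unit pr q≡ w w≢0)
  three : + 3 ≋ 0ℤ [ + q ]
  three = M.trans (M.sym (M.+-cong (M.+-cong (M.*-cong w≋1 w≋1) w≋1) (M.refl {1ℤ}))) root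

module _ {q : ℕ} (pr : Prime q) (q≢3 : q ≢ 3) where
  private module M = ℤ/ (+ q)

  IH : Eisenstein → Set
  IH β = ∀ δ → ∣ norm δ ∣ ℕ.< ∣ norm β ∣ → Primary δ → RationalSymbol δ

  content-step : ∀ {β} → Primary β → IH β → im β ≋ 0ℤ [ + q ] → re β ≋ 0ℤ [ + q ] → RationalSymbol β
  content-step {β@(⟨ a , b ⟩)} primary@(3∤a , 3∣b) ih (b′ by eb) (a′ by ea) = subst RationalSymbol (sym β≡)
    (symbol-⊗ (symbol-ι (+ q)) (ih ⟨ a′ , b′ ⟩ smaller
      ( (λ h → 3∤a (T.trans (T.reflexive a≡) (≋-mul0ʳ (+ q) h)))
      , [ (λ h → contradiction (sym (prime-∣prime prime-3 pr h)) q≢3) , (λ h → h) ]′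
          (prime-cancel prime-3 (+ q) b′ (subst (_≋ 0ℤ [ + 3 ]) b≡ 3∣b)))))
    where
    module T = ℤ/ (+ 3)
    a≡ : a ≡ + q * a′
    a≡ = trans ea (ℤ.+-identityˡ _)
    b≡ : b ≡ + q * b′
    b≡ = trans eb (ℤ.+-identityˡ _)
    β≡ : β ≡ ι (+ q) ⊗ ⟨ a′ , b′ ⟩
    β≡ = trans (cong₂ ⟨_,_⟩ a≡ b≡) (sym (ι-⊗-⟨⟩ (+ q) a′ b′))
    norm≢0 : norm β ≢ 0ℤ
    norm≢0 e = primary-norm primary (T.reflexive e)
    smaller : ∣ norm ⟨ a′ , b′ ⟩ ∣ ℕ.< ∣ norm β ∣
    smaller = proper-factor (norm (ι (+ q))) (norm ⟨ a′ , b′ ⟩) (trans (cong norm β≡) (norm-⊗ (ι (+ q)) ⟨ a′ , b′ ⟩)) norm≢0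
      (subst (1 ℕ.<_) (sym (cong ∣_∣ (trans (lem (+ q)) (sym (ℤ.pos-* q q))))) (ℕ.*-mono-< 1<q 1<q))
      where
      1<q = ℕ.nonTrivial⇒n>1 q {{prime⇒nonTrivial pr}}
      lem : ∀ t → t * t - t * 0ℤ + 0ℤ * 0ℤ ≡ t * t
      lem = ℤ-solve

  module _ {w : ℤ} (root : w * w + w + 1ℤ ≋ 0ℤ [ + q ]) where
    open Evaluation q w root

    -- β = δ J with δ = β J̄ / q. As J ≡ - 1 modulo 3, the cofactor δ is primary again, and its norm
    -- is smaller by the factor q.
    divide-jacobi : ∀ {β} → Primary β → IH β → ev β ≋ 0ℤ [ + q ] →
      (D : CubicCharacter q) → ev (CharacterSums.jacobi pr D) ≋ 0ℤ [ + q ] → RationalSymbol β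
    divide-jacobi {β} primary ih hβ D hγ = subst RationalSymbol (sym β≡δγ) (symbol-⊗ (ih δ smaller δ-primary) (symbol-jacobi pr D))
      where
      open JacobiSums pr D using (J; norm-J; jacobi-mod-3)
      module T = ℤ/ (+ 3)
      quotient : ∃ λ δ → β ⊗ conj J ≡ ι (+ q) ⊗ δ
      quotient = common-root root β J hβ hγ
      δ = proj₁ quotient
      β≡δγ : β ≡ δ ⊗ J
      β≡δγ = ι-cancel {+ q} (λ e → ℕ.≢-nonZero⁻¹ q {{prime⇒nonZero pr}} (ℤ.+-injective e)) (begin
        ι (+ q) ⊗ β       ≡⟨ cong (λ n → ι n ⊗ β) norm-J ⟨
        ι (norm J) ⊗ β    ≡⟨ cong (_⊗ β) (⊗-conj J) ⟨
        (J ⊗ conj J) ⊗ β  ≡⟨ lem₁ J (conj J) β ⟩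
        (β ⊗ conj J) ⊗ J  ≡⟨ cong (_⊗ J) (proj₂ quotient) ⟩
        (ι (+ q) ⊗ δ) ⊗ J ≡⟨ E.*-assoc (ι (+ q)) δ J ⟩
        ι (+ q) ⊗ (δ ⊗ J) ∎)
        where
        open ≡-Reasoning
        lem₁ : ∀ x y z → (x ⊗ y) ⊗ z ≡ (z ⊗ y) ⊗ x
        lem₁ = solve-∀ 𝔼-acr
      δ-primary : Primary δ
      δ-primary = primary-factor primary β≡δγ (jacobi-mod-3 q≢3)
      smaller : ∣ norm δ ∣ ℕ.< ∣ norm β ∣
      smaller = proper-factor (+ q) (norm δ)
        (trans (cong norm β≡δγ) (trans (norm-⊗ δ J) (trans (cong (norm δ *_) norm-J) (ℤ.*-comm (norm δ) (+ q)))))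
        (λ e → primary-norm primary (T.reflexive e)) (ℕ.nonTrivial⇒n>1 q {{prime⇒nonTrivial pr}})

    root-step : ∀ {β} → Primary β → IH β → ev β ≋ 0ℤ [ + q ] → RationalSymbol β
    root-step {β} primary ih hβ = [ split , (λ (k , e) → contradiction root (prime-2-mod-3 {k = k} {w} pr e q≢3)) ]′ (prime-mod-3 pr q≢3)
      where
      split : (∃ λ k → q ≡ suc (3 ℕ.* suc k)) → RationalSymbol β
      -- Since N J = q, either J or its conjugate vanishes at w. Conjugating the character exchanges
      -- the two.
      split (k , e) = [ divide-jacobi primary ih hβ χ
                      , (λ h → divide-jacobi primary ih hβ (conjugate χ) (M.trans (M.reflexive (cong ev (CharacterSums.jacobi-conj pr χ))) h)) ]′
        (prime-cancel pr (ev J) (ev (conj J)) (M.trans (ev-conj J) (1ℤ by trans norm-J (lem (+ q)))))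
        where
        χ : CubicCharacter q
        χ = power-residue-character {k = k} pr e {w} root
        open JacobiSums pr χ using (J; norm-J)
        lem : ∀ q → q ≡ 0ℤ + q * 1ℤ
        lem = ℤ-solve

  -- If q divides b, it divides a as well and is a rational factor of β. Otherwise w = - a / b is a
  -- root of w² + w + 1 modulo q at which β vanishes.
  prime-step : ∀ {β} → Primary β → IH β → norm β ≋ 0ℤ [ + q ] → RationalSymbol β
  prime-step {β@(⟨ a , b ⟩)} primary ih hN = case-im (_≋?_ pr b 0ℤ)
    where
    lem₀ : ∀ a b → a * a ≡ a * a - a * b + b * b + b * (a - b)
    lem₀ = ℤ-solve
    lem₁ : ∀ a b b′ → (- (a * b′)) * (- (a * b′)) + (- (a * b′)) + 1ℤ
      ≡ b′ * b′ * (a * a - a * b + b * b) + (b * b′ - 1ℤ) * (a * b′ - b * b′ - 1ℤ)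
    lem₁ = ℤ-solve
    lem₂ : ∀ a b b′ → a + b * (- (a * b′)) ≡ - a * (b * b′ - 1ℤ)
    lem₂ = ℤ-solve
    case-im : Dec (b ≋ 0ℤ [ + q ]) → RationalSymbol β
    case-im (yes h) = content-step primary ih h ([ (λ z → z) , (λ z → z) ]′ (prime-cancel pr a a
      (M.trans (M.reflexive (lem₀ a b)) (M.+-cong hN (≋-mul0ˡ (a - b) h)))))
    case-im (no ne) = root-step root primary ih evβ
      where
      b′ = proj₁ (CharacterSums.inverse pr b ne)
      bb′ : b * b′ - 1ℤ ≋ 0ℤ [ + q ]
      bb′ = ≋-sub (proj₂ (CharacterSums.inverse pr b ne))
      w = - (a * b′)
      root : w * w + w + 1ℤ ≋ 0ℤ [ + q ]
      root = M.trans (M.reflexive (lem₁ a b b′)) (M.+-cong (≋-mul0ʳ (b′ * b′) hN) (≋-mul0ˡ (a * b′ - b * b′ - 1ℤ) bb′))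
      evβ : a + b * w ≋ 0ℤ [ + q ]
      evβ = M.trans (M.reflexive (lem₂ a b b′)) (≋-mul0ʳ (- a) bb′)

opaque
  rational-symbol : ∀ β → Primary β → RationalSymbol β
  rational-symbol β = go β (<-wellFounded ∣ norm β ∣)
    where
    go : ∀ β → Acc ℕ._<_ ∣ norm β ∣ → Primary β → RationalSymbol β
    go β@(⟨ a , b ⟩) (acc rs) primary = case-im (b ℤ.≟ 0ℤ)
      where
      case-im : Dec (b ≡ 0ℤ) → RationalSymbol β
      case-im (yes refl) = symbol-ι a
      case-im (no b≢0) = by-prime (prime-divisor ∣ norm β ∣
        (λ e → primary-norm primary (ℤ/.reflexive (+ 3) (ℤ.∣i∣≡0⇒i≡0 e)))
        (λ e → b≢0 (primary-unit-im primary e)))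
        where
        by-prime : (∃ λ q → Prime q × q ℕ.∣ ∣ norm β ∣) → RationalSymbol β
        by-prime (q , pr , d) = prime-step pr
          (λ { refl → primary-norm primary (∣⇒≋0 d) }) primary
          (λ δ lt δ-primary → go δ (rs lt) δ-primary) (∣⇒≋0 d)


-- The cubic character modulo 9 and primary associates

unit-square : ∀ {a} → ¬ a ≋ 0ℤ [ + 3 ] → a * a ≋ 1ℤ [ + 3 ]
unit-square {a} ne = ℤ/.trans (+ 3) (ℤ/.reflexive (+ 3) (cong (a *_) (sym (ℤ.*-identityʳ a)))) (fermat-unit prime-3 refl a ne)

ω^-mod : ∀ n → ω E.^ n ≡ ω E.^ (n ℕ.% 3)
ω^-mod n = begin
  ω E.^ n                              ≡⟨ cong (ω E.^_) (ℕ.m≡m%n+[m/n]*n n 3) ⟩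
  ω E.^ (r ℕ.+ n ℕ./ 3 ℕ.* 3)          ≡⟨ E.^-homo-* ω r (n ℕ./ 3 ℕ.* 3) ⟩
  ω E.^ r ⊗ ω E.^ (n ℕ./ 3 ℕ.* 3)      ≡⟨ cong (λ i → ω E.^ r ⊗ ω E.^ i) (ℕ.*-comm (n ℕ./ 3) 3) ⟩
  ω E.^ r ⊗ ω E.^ (3 ℕ.* (n ℕ./ 3))    ≡⟨ cong (ω E.^ r ⊗_) (E.^-assocʳ ω 3 (n ℕ./ 3)) ⟨
  ω E.^ r ⊗ 𝟙 E.^ (n ℕ./ 3)            ≡⟨ cong (ω E.^ r ⊗_) (𝟙^ (n ℕ./ 3)) ⟩
  ω E.^ r ⊗ 𝟙                          ≡⟨ E.*-identityʳ _ ⟩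
  ω E.^ r                              ∎
  where
  open ≡-Reasoning
  r = n ℕ.% 3

ω^-cong : ∀ {m n} → + m ≋ + n [ + 3 ] → ω E.^ m ≡ ω E.^ n
ω^-cong {m} {n} e = trans (ω^-mod m) (trans (cong (ω E.^_) (residue-unique (ℕ.m%n<n m 3) (ℕ.m%n<n n 3)
  (M.trans (M.sym (rem m)) (M.trans e (rem n))))) (sym (ω^-mod n)))
  where
  module M = ℤ/ (+ 3)
  rem : ∀ m → + m ≋ + (m ℕ.% 3) [ + 3 ]
  rem m = (+ (m ℕ./ 3)) by trans (cong +_ (trans (ℕ.m≡m%n+[m/n]*n m 3) (cong (m ℕ.% 3 ℕ.+_) (ℕ.*-comm (m ℕ./ 3) 3))))
    (trans (ℤ.pos-+ (m ℕ.% 3) _) (cong (_+_ (+ (m ℕ.% 3))) (ℤ.pos-* 3 (m ℕ./ 3))))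

ω^-cubic : ∀ n → Cubic (ω E.^ n)
ω^-cubic zero = ζ₀
ω^-cubic (suc n) = Cubic-⊗ ζ₁ (ω^-cubic n)

≋-lift-3 : ∀ {a b} → 1ℤ + + 3 * a ≋ 1ℤ + + 3 * b [ + 9 ] → a ≋ b [ + 3 ]
≋-lift-3 {a} {b} (z by e) = z by ℤ.*-cancelˡ-≡ (+ 3) a (b + + 3 * z)
  (trans (lem a) (trans (cong (_- 1ℤ) e) (lem₂ b z)))
  where
  lem : ∀ a → + 3 * a ≡ 1ℤ + + 3 * a - 1ℤ
  lem = ℤ-solve
  lem₂ : ∀ b z → 1ℤ + + 3 * b + + 9 * z - 1ℤ ≡ + 3 * (b + + 3 * z)
  lem₂ = ℤ-solve

-- e is the exponent of ω in the cubic character t ↦ ω ^ ((t² − 1) / 3) modulo 9.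
SquareExponent : ℤ → ℕ → Set
SquareExponent t e = t * t ≋ 1ℤ + + 3 * + e [ + 9 ]

opaque
  square-exponent : ∀ {t} → ¬ t ≋ 0ℤ [ + 3 ] → ∃ (SquareExponent t)
  square-exponent {t} ne = reduce (unit-square ne)
    where
    lem : ∀ r v → 1ℤ + + 3 * (r + v * + 3) ≡ 1ℤ + + 3 * r + + 9 * v
    lem = ℤ-solve
    reduce : t * t ≋ 1ℤ [ + 3 ] → ∃ (SquareExponent t)
    reduce (z by e) = z ℤ.%ℕ 3 , ((z ℤ./ℕ 3) by trans e (trans (cong (λ v → 1ℤ + + 3 * v) (ℤ.a≡a%ℕn+[a/ℕn]*n z 3)) (lem (+ (z ℤ.%ℕ 3)) (z ℤ./ℕ 3))))

square-exponent-* : ∀ {s t e f} → SquareExponent s e → SquareExponent t f → SquareExponent (s * t) (e ℕ.+ f)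
square-exponent-* {s} {t} {e} {f} p q = M.trans (M.reflexive (lem s t)) (M.trans (M.*-cong p q)
  ((+ e * + f) by trans (lem₂ (+ e) (+ f)) (cong (λ n → 1ℤ + + 3 * n + + 9 * (+ e * + f)) (sym (ℤ.pos-+ e f)))))
  where
  module M = ℤ/ (+ 9)
  lem : ∀ s t → s * t * (s * t) ≡ (s * s) * (t * t)
  lem = ℤ-solve
  lem₂ : ∀ e f → (1ℤ + + 3 * e) * (1ℤ + + 3 * f) ≡ 1ℤ + + 3 * (e + f) + + 9 * (e * f)
  lem₂ = ℤ-solve

square-exponent-unique : ∀ {t e f} → SquareExponent t e → SquareExponent t f → + e ≋ + f [ + 3 ]
square-exponent-unique p q = ≋-lift-3 (ℤ/.trans (+ 9) (ℤ/.sym (+ 9) p) q)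

infix 5 _+_√−3
-- Here √-3 is 1 + 2 ω.
_+_√−3 : ℤ → ℤ → Eisenstein
a + b √−3 = ⟨ a + b , + 2 * b ⟩

norm-√−3 : ∀ a b → norm (a + b √−3) ≡ a * a + + 3 * (b * b)
norm-√−3 = lem
  where
  lem : ∀ a b → (a + b) * (a + b) - (a + b) * (+ 2 * b) + + 2 * b * (+ 2 * b) ≡ a * a + + 3 * (b * b)
  lem = ℤ-solve

record PrimaryAssociate (a b : ℤ) : Set where
  field
    exponent   : ℕ
    associate  : Eisenstein
    primary    : Primary associate
    associate≡ : a + b √−3 ≡ ω E.^ exponent ⊗ associate
    norm≡      : norm associate ≡ norm (a + b √−3)
    exponent≋  : + exponent ≋ - (a * b) [ + 3 ]

-- Either a ≡ b or a ≡ - b modulo 3, and accordingly ω β or ω² β is primary. The exponents 2 and 1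
-- are both ≡ - a b, which covers the two cases by one formula.
primary-associate : ∀ {a b} → ¬ a ≋ 0ℤ [ + 3 ] → ¬ b ≋ 0ℤ [ + 3 ] → PrimaryAssociate a b
primary-associate {a} {b} 3∤a 3∤b = [ same , opposite ]′ (prime-cancel prime-3 (a - b) (a + b)
  (M.trans (M.reflexive (lem a b)) (≋-sub (M.trans (unit-square 3∤a) (M.sym (unit-square 3∤b))))))
  where
  module M = ℤ/ (+ 3)
  lem : ∀ a b → (a - b) * (a + b) ≡ a * a - b * b
  lem = ℤ-solve
  β = a + b √−3
  unit-⊗ : ∀ e → (ω E.^ e) ⊗ (conj (ω E.^ e) ⊗ β) ≡ (ω E.^ e ⊗ conj (ω E.^ e)) ⊗ β
  unit-⊗ e = sym (E.*-assoc (ω E.^ e) (conj (ω E.^ e)) β)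
  same : a - b ≋ 0ℤ [ + 3 ] → PrimaryAssociate a b
  same h = record
    { exponent = 2
    ; associate = ⟨ - (+ 2 * b) , a - b ⟩
    ; primary = (λ g → 3∤b (M.trans (b by lem₁ b) g)) , h
    ; associate≡ = trans (sym (⊗-identityˡ β)) (trans (sym (unit-⊗ 2)) (cong (ω E.^ 2 ⊗_) (cong₂ ⟨_,_⟩ (lem₂ a b) (lem₃ a b))))
    ; norm≡ = lem₄ a b
    ; exponent≋ = M.trans (1ℤ by refl) (M.-‿cong (M.sym (M.trans (M.*-cong (≋-add {a = a} {b = b} h) (M.refl {b})) (unit-square 3∤b)))) }
    where
    lem₁ : ∀ b → b ≡ - (+ 2 * b) + + 3 * b
    lem₁ = ℤ-solve
    lem₂ : ∀ a b → 0ℤ * (a + b) - 1ℤ * (+ 2 * b) ≡ - (+ 2 * b)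
    lem₂ = ℤ-solve
    lem₃ : ∀ a b → 0ℤ * (+ 2 * b) + 1ℤ * (a + b) - 1ℤ * (+ 2 * b) ≡ a - b
    lem₃ = ℤ-solve
    lem₄ : ∀ a b → - (+ 2 * b) * - (+ 2 * b) - - (+ 2 * b) * (a - b) + (a - b) * (a - b)
      ≡ (a + b) * (a + b) - (a + b) * (+ 2 * b) + + 2 * b * (+ 2 * b)
    lem₄ = ℤ-solve
  opposite : a + b ≋ 0ℤ [ + 3 ] → PrimaryAssociate a b
  opposite h = record
    { exponent = 1
    ; associate = ⟨ b - a , - (a + b) ⟩
    ; primary = (λ g → 3∤b (M.trans (b by lem₁ a b) (M.-‿cong (M.+-cong h g)))) , M.-‿cong h
    ; associate≡ = trans (sym (⊗-identityˡ β)) (trans (sym (unit-⊗ 1)) (cong (ω E.^ 1 ⊗_) (cong₂ ⟨_,_⟩ (lem₂ a b) (lem₃ a b))))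
    ; norm≡ = lem₄ a b
    ; exponent≋ = M.trans (M.sym (unit-square 3∤b)) (M.trans (M.reflexive (lem₅ a b)) (M.trans (M.+-cong (M.refl { - (a * b)}) (≋-mul0ˡ b h)) (M.reflexive (ℤ.+-identityʳ _)))) }
    where
    lem₁ : ∀ a b → b ≡ - (a + b + (b - a)) + + 3 * b
    lem₁ = ℤ-solve
    lem₂ : ∀ a b → - 1ℤ * (a + b) - - 1ℤ * (+ 2 * b) ≡ b - a
    lem₂ = ℤ-solve
    lem₃ : ∀ a b → - 1ℤ * (+ 2 * b) + - 1ℤ * (a + b) - - 1ℤ * (+ 2 * b) ≡ - (a + b)
    lem₃ = ℤ-solve
    lem₄ : ∀ a b → (b - a) * (b - a) - (b - a) * - (a + b) + - (a + b) * - (a + b)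
      ≡ (a + b) * (a + b) - (a + b) * (+ 2 * b) + + 2 * b * (+ 2 * b)
    lem₄ = ℤ-solve
    lem₅ : ∀ a b → b * b ≡ - (a * b) + (a + b) * b
    lem₅ = ℤ-solve


-- Rational primes at which the symbol is trivial

𝔼-cancel : ∀ {ℓ} → Prime ℓ → ∀ z {x y} → ¬ norm z ≋ 0ℤ [ + ℓ ] → z ⊗ x ≋ᴱ z ⊗ y [ + ℓ ] → x ≋ᴱ y [ + ℓ ]
𝔼-cancel {ℓ} pr z {x} {y} ne e = L.trans (L.sym (unscale x)) (L.trans (L.*-cong (L.refl {ι n′ ⊗ conj z}) e) (unscale y))
  where
  module L = 𝔼/ (+ ℓ)
  inv = CharacterSums.inverse pr (norm z) ne
  n′ = proj₁ inv
  lem : ∀ x y z w → (x ⊗ y) ⊗ (z ⊗ w) ≡ ((z ⊗ y) ⊗ x) ⊗ w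
  lem = solve-∀ 𝔼-acr
  unscale : ∀ x → (ι n′ ⊗ conj z) ⊗ (z ⊗ x) ≋ᴱ x [ + ℓ ]
  unscale x = L.trans (L.≈-reflexive (trans (lem (ι n′) (conj z) z x) (cong (_⊗ x) (trans (cong (_⊗ ι n′) (⊗-conj z)) (ι-⊗ (norm z) n′)))))
    (L.trans (L.*-cong (ι-cong (proj₂ inv)) (L.refl {x})) (L.≈-reflexive (⊗-identityˡ x)))

θ : Eisenstein
θ = 0ℤ + 1ℤ √−3

θ-frobenius : ∀ {ℓ} → Prime ℓ → θ E.^ ℓ ≋ᴱ 𝟙 ⊕ ι (+ 2) ⊗ ω E.^ ℓ [ + ℓ ]
θ-frobenius {ℓ} pr = L.trans (L.freshman pr (multiple ℓ) 𝟙 (ι (+ 2) ⊗ ω)) (L.+-cong (L.≈-reflexive (𝟙^ ℓ))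
  (L.trans (L.≈-reflexive (trans (E.^-distrib-* (ι (+ 2)) ω ℓ) (cong (_⊗ ω E.^ ℓ) (ι-^ (+ 2) ℓ))))
    (L.*-cong (ι-cong (fermat pr (+ 2))) (L.refl {ω E.^ ℓ}))))
  where
  module L = 𝔼/ (+ ℓ)
  open import Algebra.Properties.Semiring.Mult E.semiring using () renaming (_×_ to _·_)
  multiple : ∀ n x → n · x ≡ ι (+ n) ⊗ x
  multiple zero x = sym (E.zeroˡ x)
  multiple (suc n) x = trans (cong₂ _⊕_ (sym (⊗-identityˡ x)) (multiple n x)) (sym (E.distribʳ x 𝟙 (ι (+ n))))

module TrivialPrimes (a b : ℤ) {ℓ : ℕ} (pr : Prime ℓ) (ℓ≢3 : ℓ ≢ 3)
                     (ℓ∤N : ¬ norm (a + b √−3) ≋ 0ℤ [ + ℓ ]) where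
  private
    module L = 𝔼/ (+ ℓ)
    module M = ℤ/ (+ ℓ)
    β = a + b √−3
    N = norm β

  -- These are the powers from `RationalSymbol`, but for a + b √-3 itself instead of its primary
  -- associate.
  Trivial : Set
  Trivial = (∀ k → ℓ ≡ suc (3 ℕ.* k) → (ι N ⊗ β) E.^ k ≋ᴱ 𝟙 [ + ℓ ])
          × (∀ k → ℓ ≡ suc (suc (3 ℕ.* k)) → (ι N ⊗ β) E.^ k ⊗ β ≋ᴱ 𝟙 [ + ℓ ])

  cube-power : ∀ {z} → ι N ⊗ β ≋ᴱ z E.^ 3 [ + ℓ ] → ∀ k → (ι N ⊗ β) E.^ k ≋ᴱ z E.^ (3 ℕ.* k) [ + ℓ ]
  cube-power {z} e k = L.trans (L.^-cong-≈ k e) (L.≈-reflexive (E.^-assocʳ z 3 k))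

  -- β is congruent to the rational integer a, and N(β) β to a³, so Fermat applies.
  trivial-∣b : b ≋ 0ℤ [ + ℓ ] → Trivial
  trivial-∣b h = (λ k e → L.trans (cube-power cube k) (L.trans (L.≈-reflexive (ι-^ a (3 ℕ.* k))) (ι-cong (fermat-unit pr e a ℓ∤a))))
    , (λ k e → L.trans (L.*-cong (cube-power cube k) β≋) (L.trans (L.≈-reflexive (trans (⊗-comm _ (ι a)) (ι-^ a (suc (3 ℕ.* k)))))
        (ι-cong (fermat-unit pr e a ℓ∤a))))
    where
    N≋ : N ≋ a * a [ + ℓ ]
    N≋ = M.trans (M.reflexive (norm-√−3 a b)) (M.trans (M.+-cong (M.refl {a * a}) (≋-mul0ʳ (+ 3) (≋-mul0ˡ b h))) (M.reflexive (ℤ.+-identityʳ _)))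
    ℓ∤a : ¬ a ≋ 0ℤ [ + ℓ ]
    ℓ∤a g = ℓ∤N (M.trans N≋ (≋-mul0ˡ a g))
    β≋ : β ≋ᴱ ι a [ + ℓ ]
    β≋ = L.trans (L.≈-reflexive (trans (cong₂ ⟨_,_⟩ (cong (_+_ a) (sym (ℤ.*-identityʳ b))) (trans (ℤ.*-comm (+ 2) b) (sym (ℤ.+-identityˡ _))))
        (cong (ι a ⊕_) (sym (ι-⊗-⟨⟩ b 1ℤ (+ 2))))))
      (L.trans (L.+-cong (L.refl {ι a}) (L.trans (L.*-cong (ι-cong h) (L.refl {θ})) (L.≈-reflexive (E.zeroˡ θ)))) (L.≈-reflexive (E.+-identityʳ _)))
    cube : ι N ⊗ β ≋ᴱ ι a E.^ 3 [ + ℓ ]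
    cube = L.trans (L.*-cong (ι-cong N≋) β≋) (L.≈-reflexive (trans (ι-⊗ (a * a) a) (trans (cong ι (lem a)) (sym (ι-^ a 3)))))
      where
      lem : ∀ a → a * a * a ≡ a * (a * (a * 1ℤ))
      lem = ℤ-solve

  -- Now β ≡ b √-3 = - z and N(β) β ≡ z³ for z = - b √-3. After multiplication by z the two powers
  -- become z^ℓ and - z^ℓ, while Frobenius gives z^ℓ ≡ z for ℓ ≡ 1 and z^ℓ ≡ - z for ℓ ≡ 2 modulo 3.
  -- Finally z is cancelled.
  trivial-∣a : a ≋ 0ℤ [ + ℓ ] → Trivial
  trivial-∣a h = (λ k e → 𝔼-cancel pr z norm-z (L.trans (L.*-cong (L.refl {z}) (cube-power cube k))
        (L.trans (L.≈-reflexive (cong (z E.^_) (sym e))) (L.trans (frobenius-z ω (trans (ω^-cong (residue e k 1 (lem₁ (+ k)))) (E.*-identityʳ ω)))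
          (L.≈-reflexive (sym (E.*-identityʳ z)))))))
    , (λ k e → 𝔼-cancel pr z norm-z (L.trans (L.*-cong (L.refl {z}) (L.*-cong (cube-power cube k) β≋))
        (L.trans (L.≈-reflexive (trans (lem₂ z (z E.^ (3 ℕ.* k))) (cong (λ n → ⊖ (z E.^ n)) (sym e))))
        (L.trans (L.-‿cong (frobenius-z ω² (trans (ω^-cong (residue e k 2 (lem₃ (+ k)))) (cong (ω ⊗_) (E.*-identityʳ ω)))))
          (L.≈-reflexive (lem₄ (ι (- b))))))))
    where
    z = ι (- b) ⊗ θ
    residue : ∀ {n} → ℓ ≡ n → ∀ k r → + n ≡ + r + + 3 * + k → + ℓ ≋ + r [ + 3 ]
    residue refl k r e = (+ k) by e
    lem₁ : ∀ k → 1ℤ + (k + (k + (k + 0ℤ))) ≡ 1ℤ + + 3 * k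
    lem₁ = ℤ-solve
    lem₃ : ∀ k → + 2 + (k + (k + (k + 0ℤ))) ≡ + 2 + + 3 * k
    lem₃ = ℤ-solve
    lem₂ : ∀ z x → z ⊗ (x ⊗ (⊖ z)) ≡ ⊖ (z ⊗ (z ⊗ x))
    lem₂ = solve-∀ 𝔼-acr
    lem₄ : ∀ c → ⊖ (c ⊗ (𝟙 ⊕ ι (+ 2) ⊗ ω²)) ≡ (c ⊗ θ) ⊗ 𝟙
    lem₄ = solve-∀ 𝔼-acr
    ℓ∤b : ¬ b ≋ 0ℤ [ + ℓ ]
    ℓ∤b g = ℓ∤N (M.trans (M.reflexive (norm-√−3 a b)) (M.+-cong (≋-mul0ˡ a h) (≋-mul0ʳ (+ 3) (≋-mul0ˡ b g))))
    norm-z : ¬ norm z ≋ 0ℤ [ + ℓ ]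
    norm-z g = [ (λ h₃ → ℓ≢3 (prime-∣prime pr prime-3 h₃)) , (λ hb → [ ℓ∤b , ℓ∤b ]′ (prime-cancel pr b b hb)) ]′
      (prime-cancel pr (+ 3) (b * b) (M.trans (M.reflexive (sym (trans (norm-⊗ (ι (- b)) θ) (lem b)))) g))
      where
      lem : ∀ b → (- b * - b - - b * 0ℤ + 0ℤ * 0ℤ) * + 3 ≡ + 3 * (b * b)
      lem = ℤ-solve
    β≋ : β ≋ᴱ ⊖ z [ + ℓ ]
    β≋ = L.trans (L.≈-reflexive (trans (cong₂ ⟨_,_⟩ (lem₅ a b) (lem₆ b)) (cong (λ v → ι a ⊕ ⊖ v) (sym (ι-⊗-⟨⟩ (- b) 1ℤ (+ 2))))))
      (L.trans (L.+-cong (ι-cong h) (L.refl {⊖ z})) (L.≈-reflexive (E.+-identityˡ (⊖ z))))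
      where
      lem₅ : ∀ a b → a + b ≡ a + - (- b * 1ℤ)
      lem₅ = ℤ-solve
      lem₆ : ∀ b → + 2 * b ≡ 0ℤ + - (- b * + 2)
      lem₆ = ℤ-solve
    cube : ι N ⊗ β ≋ᴱ z E.^ 3 [ + ℓ ]
    cube = L.trans (L.*-cong (ι-cong N≋) β≋) (L.≈-reflexive (trans (cong (_⊗ (⊖ z)) ιN) (lem₇ (ι (- b)))))
      where
      N≋ : N ≋ (- b * - b) * + 3 [ + ℓ ]
      N≋ = M.trans (M.reflexive (norm-√−3 a b)) (M.trans (M.+-cong (≋-mul0ˡ a h) (M.refl {+ 3 * (b * b)})) (M.reflexive (lem b)))
        where
        lem : ∀ b → 0ℤ + + 3 * (b * b) ≡ (- b * - b) * + 3
        lem = ℤ-solve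
      ιN : ι ((- b * - b) * + 3) ≡ (ι (- b) ⊗ ι (- b)) ⊗ ι (+ 3)
      ιN = sym (trans (cong (_⊗ ι (+ 3)) (ι-⊗ (- b) (- b))) (ι-⊗ (- b * - b) (+ 3)))
      lem₇ : ∀ c → ((c ⊗ c) ⊗ ι (+ 3)) ⊗ (⊖ (c ⊗ θ)) ≡ (c ⊗ θ) ⊗ ((c ⊗ θ) ⊗ ((c ⊗ θ) ⊗ 𝟙))
      lem₇ = solve-∀ 𝔼-acr
    frobenius-z : ∀ v → ω E.^ ℓ ≡ v → z E.^ ℓ ≋ᴱ ι (- b) ⊗ (𝟙 ⊕ ι (+ 2) ⊗ v) [ + ℓ ]
    frobenius-z v e = L.trans (L.≈-reflexive (trans (E.^-distrib-* (ι (- b)) θ ℓ) (cong (_⊗ θ E.^ ℓ) (ι-^ (- b) ℓ))))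
      (L.*-cong (ι-cong (fermat pr (- b))) (L.trans (θ-frobenius pr) (L.≈-reflexive (cong (λ v → 𝟙 ⊕ ι (+ 2) ⊗ v) e))))

  -- An odd norm makes a + b odd, so β = (a + b) + 2 b ω ≡ 1; and ℓ = 2 leaves only k = 0.
  trivial-2 : ℓ ≡ 2 → Trivial
  trivial-2 refl = (λ { zero () ; (suc k) e → contradiction (ℕ.suc-injective e) λ e′ → 1≢3+ k (trans e′ (ℕ.*-suc 3 k)) })
    , (λ { zero _ → L.trans (L.≈-reflexive (⊗-identityˡ β)) β≋1
         ; (suc k) e → contradiction (trans (ℕ.suc-injective (ℕ.suc-injective e)) (ℕ.*-suc 3 k)) λ () })
    where
    1≢3+ : ∀ k → 1 ≢ 3 ℕ.+ 3 ℕ.* k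
    1≢3+ k ()
    a+b≋1 : a + b ≋ 1ℤ [ + 2 ]
    a+b≋1 = M.trans (M.reflexive (sym (ℤ.*-identityʳ (a + b)))) (fermat-unit pr refl (a + b) λ h →
      ℓ∤N (M.trans (M.reflexive (lem a b)) (M.+-cong (≋-mul0ˡ (a + b - + 2 * b) h) (multiple-≋0 {+ 2} (+ 2 * (b * b))))))
      where
      lem : ∀ a b → (a + b) * (a + b) - (a + b) * (+ 2 * b) + + 2 * b * (+ 2 * b) ≡ (a + b) * (a + b - + 2 * b) + + 2 * (+ 2 * (b * b))
      lem = ℤ-solve
    β≋1 : β ≋ᴱ 𝟙 [ + 2 ]
    β≋1 = shift a+b≋1
      where
      shift : a + b ≋ 1ℤ [ + 2 ] → β ≋ᴱ 𝟙 [ + 2 ]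
      shift (q by e) = ⟨ q , b ⟩ by trans (cong₂ ⟨_,_⟩ e (sym (ℤ.+-identityˡ _))) (cong (𝟙 ⊕_) (sym (ι-⊗-⟨⟩ (+ 2) q b)))


-- Evaluation of the symbol at p

module RationalReciprocity {a b : ℤ} (3∤a : ¬ a ≋ 0ℤ [ + 3 ]) (3∤b : ¬ b ≋ 0ℤ [ + 3 ]) where
  β = a + b √−3
  N = norm β

  opaque
    normalisation : PrimaryAssociate a b
    normalisation = primary-associate 3∤a 3∤b

  open PrimaryAssociate normalisation public using () renaming (exponent to e₀; exponent≋ to e₀≋)
  private
    β′ = PrimaryAssociate.associate normalisation
    norm-β′ : norm β′ ≡ N
    norm-β′ = PrimaryAssociate.norm≡ normalisation

  open RationalSymbol (rational-symbol β′ (PrimaryAssociate.primary normalisation)) public using (X; X-cubic; X-*; X-1)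
  private
    open RationalSymbol (rational-symbol β′ (PrimaryAssociate.primary normalisation)) using (X-periodic; X-prime-1; X-prime-2)

    P : ℕ → Eisenstein
    P k = (ι (norm β′) ⊗ β′) E.^ k

    N∤⇒ : ∀ {ℓ} → ¬ N ≋ 0ℤ [ ℓ ] → ¬ norm β′ ≋ 0ℤ [ ℓ ]
    N∤⇒ ne h = ne (subst (_≋ 0ℤ [ _ ]) norm-β′ h)

    power-β : ∀ k → (ι N ⊗ β) E.^ k ≡ ω E.^ (e₀ ℕ.* k) ⊗ P k
    power-β k = trans (cong (E._^ k) (trans (cong₂ (λ n x → ι n ⊗ x) (sym norm-β′) (PrimaryAssociate.associate≡ normalisation)) (swap (ι (norm β′)) (ω E.^ e₀) β′)))
      (trans (E.^-distrib-* (ω E.^ e₀) (ι (norm β′) ⊗ β′) k) (cong (_⊗ P k) (E.^-assocʳ ω e₀ k)))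
      where
      swap : ∀ x y z → x ⊗ (y ⊗ z) ≡ y ⊗ (x ⊗ z)
      swap = solve-∀ 𝔼-acr

  ω^-e₀ : ∀ {m n} → + m ≋ + n [ + 3 ] → ω E.^ (e₀ ℕ.* m) ≡ ω E.^ (e₀ ℕ.* n)
  ω^-e₀ {m} {n} e = ω^-cong (subst₂ _≋_[ + 3 ] (sym (ℤ.pos-* e₀ m)) (sym (ℤ.pos-* e₀ n)) (ℤ/.*-cong (+ 3) (ℤ/.refl (+ 3) {+ e₀}) e))

  ω^-e₀-+ : ∀ m n → ω E.^ (e₀ ℕ.* (m ℕ.+ n)) ≡ ω E.^ (e₀ ℕ.* m) ⊗ ω E.^ (e₀ ℕ.* n)
  ω^-e₀-+ m n = trans (cong (ω E.^_) (ℕ.*-distribˡ-+ e₀ m n)) (E.^-homo-* ω (e₀ ℕ.* m) (e₀ ℕ.* n))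

  ω^-e₀-3 : ∀ n → ω E.^ (e₀ ℕ.* (3 ℕ.* n)) ≡ 𝟙
  ω^-e₀-3 n = trans (ω^-e₀ {3 ℕ.* n} {0} ((+ n) by trans (ℤ.pos-* 3 n) (sym (ℤ.+-identityˡ _)))) (cong (ω E.^_) (ℕ.*-zeroʳ e₀))

  -- X agrees at t with the cubic character modulo 9 that makes β primary.
  Good : ℤ → Set
  Good t = ∀ e → SquareExponent t e → X t ⊗ ω E.^ (e₀ ℕ.* e) ≡ 𝟙

  good-from : ∀ {t} e → SquareExponent t e → X t ⊗ ω E.^ (e₀ ℕ.* e) ≡ 𝟙 → Good t
  good-from {t} e se eq f sf = trans (cong (X t ⊗_) (ω^-e₀ (square-exponent-unique {t} sf se))) eq

  good-1 : Good 1ℤ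
  good-1 = good-from 0 (0ℤ by refl) (trans (cong₂ _⊗_ X-1 (cong (ω E.^_) (ℕ.*-zeroʳ e₀))) (⊗-identityˡ 𝟙))

  good-−1 : Good (- 1ℤ)
  good-−1 = good-from 0 (0ℤ by refl) (trans (cong₂ _⊗_ (cubic-square-1 (X-cubic (- 1ℤ)) (trans (sym (X-* (- 1ℤ) (- 1ℤ))) X-1))
    (cong (ω E.^_) (ℕ.*-zeroʳ e₀))) (⊗-identityˡ 𝟙))

  good-* : ∀ {s t} → ¬ s ≋ 0ℤ [ + 3 ] → ¬ t ≋ 0ℤ [ + 3 ] → Good s → Good t → Good (s * t)
  good-* {s} {t} 3∤s 3∤t gs gt = combine (square-exponent 3∤s) (square-exponent 3∤t)
    where
    interchange : ∀ x y z w → (x ⊗ y) ⊗ (z ⊗ w) ≡ (x ⊗ z) ⊗ (y ⊗ w)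
    interchange = solve-∀ 𝔼-acr
    combine : ∃ (SquareExponent s) → ∃ (SquareExponent t) → Good (s * t)
    combine (e , se) (f , sf) = good-from (e ℕ.+ f) (square-exponent-* {s} {t} {e} {f} se sf)
      (trans (cong₂ _⊗_ (X-* s t) (ω^-e₀-+ e f)) (trans (interchange (X s) (X t) (ω E.^ (e₀ ℕ.* e)) (ω E.^ (e₀ ℕ.* f)))
        (trans (cong₂ _⊗_ (gs e se) (gt f sf)) (⊗-identityˡ 𝟙))))

  square-exponent-3k+1 : ∀ {ℓ} k → ℓ ≡ suc (3 ℕ.* k) → SquareExponent (+ ℓ) (2 ℕ.* k)
  square-exponent-3k+1 k refl = (+ k * + k) by trans (cong (λ n → (1ℤ + n) * (1ℤ + n)) (ℤ.pos-* 3 k))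
    (trans (lem (+ k)) (cong (λ n → 1ℤ + + 3 * n + + 9 * (+ k * + k)) (sym (ℤ.pos-* 2 k))))
    where
    lem : ∀ k → (1ℤ + + 3 * k) * (1ℤ + + 3 * k) ≡ 1ℤ + + 3 * (+ 2 * k) + + 9 * (k * k)
    lem = ℤ-solve

  square-exponent-3k+2 : ∀ {ℓ} k → ℓ ≡ suc (suc (3 ℕ.* k)) → SquareExponent (+ ℓ) (suc k)
  square-exponent-3k+2 k refl = (+ k * + k + + k) by trans (cong (λ n → (+ 2 + n) * (+ 2 + n)) (ℤ.pos-* 3 k)) (lem (+ k))
    where
    lem : ∀ k → (+ 2 + + 3 * k) * (+ 2 + + 3 * k) ≡ 1ℤ + + 3 * (1ℤ + k) + + 9 * (k * k + k)
    lem = ℤ-solve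

  -- As β is trivial at ℓ, the symbol of its associate only records the power of ω between them: X ℓ
  -- = ω^(e₀ k) for ℓ = 3 k + 1, and X ℓ ω^(e₀ (k + 1)) = 1 for ℓ = 3 k + 2. The exponents of ℓ
  -- modulo 9 are 2 k and k + 1, so the product is 1 in both cases.
  good-prime : ∀ {ℓ} → Prime ℓ → ℓ ≢ 3 → ¬ N ≋ 0ℤ [ + ℓ ] →
    ℓ ≡ 2 ⊎ a ≋ 0ℤ [ + ℓ ] ⊎ b ≋ 0ℤ [ + ℓ ] → Good (+ ℓ)
  good-prime {ℓ} pr ℓ≢3 ℓ∤N cases = [ case-1 , case-2 ]′ (prime-mod-3 pr ℓ≢3)
    where
    module L = 𝔼/ (+ ℓ)
    open TrivialPrimes a b pr ℓ≢3 ℓ∤N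
    trivial : Trivial
    trivial = [ trivial-2 , [ trivial-∣a , trivial-∣b ]′ ]′ cases
    Xℓ = X (+ ℓ)
    case-1 : (∃ λ k → ℓ ≡ suc (3 ℕ.* suc k)) → Good (+ ℓ)
    case-1 (k₀ , e) = good-from (2 ℕ.* k) (square-exponent-3k+1 k e)
      (trans (cong (_⊗ ω E.^ (e₀ ℕ.* (2 ℕ.* k))) Xℓ≡) (trans (sym (ω^-e₀-+ k (2 ℕ.* k))) (ω^-e₀-3 k)))
      where
      k = suc k₀
      Xℓ≡ : Xℓ ≡ ω E.^ (e₀ ℕ.* k)
      Xℓ≡ = cubic-unique-≋ᴱ pr ℓ≢3 (X-cubic (+ ℓ)) (ω^-cubic (e₀ ℕ.* k)) (L.trans (L.≈-reflexive (sym (⊗-identityˡ Xℓ)))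
        (L.trans (L.*-cong (L.sym (L.trans (L.≈-reflexive (sym (power-β k))) (proj₁ trivial k e))) (L.refl {Xℓ}))
        (L.trans (L.≈-reflexive (E.*-assoc (ω E.^ (e₀ ℕ.* k)) (P k) Xℓ)) (L.trans (L.*-cong (L.refl {ω E.^ (e₀ ℕ.* k)}) (X-prime-1 pr ℓ≢3 (N∤⇒ ℓ∤N) k e))
        (L.≈-reflexive (E.*-identityʳ (ω E.^ (e₀ ℕ.* k))))))))
    case-2 : (∃ λ k → ℓ ≡ suc (suc (3 ℕ.* k))) → Good (+ ℓ)
    case-2 (k , e) = good-from (suc k) (square-exponent-3k+2 k e)
      (cubic-unique-≋ᴱ pr ℓ≢3 (Cubic-⊗ (X-cubic (+ ℓ)) (ω^-cubic (e₀ ℕ.* suc k))) ζ₀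
        (L.trans (L.*-cong (L.sym (X-prime-2 pr ℓ≢3 (N∤⇒ ℓ∤N) k e)) (L.refl {ω E.^ (e₀ ℕ.* suc k)}))
        (L.trans (L.≈-reflexive regroup) (proj₂ trivial k e))))
      where
      lem : ∀ p β u v → (p ⊗ β) ⊗ (u ⊗ v) ≡ (v ⊗ p) ⊗ (u ⊗ β)
      lem = solve-∀ 𝔼-acr
      regroup : (P k ⊗ β′) ⊗ ω E.^ (e₀ ℕ.* suc k) ≡ (ι N ⊗ β) E.^ k ⊗ β
      regroup = trans (cong ((P k ⊗ β′) ⊗_) (trans (ω^-e₀-+ 1 k) (cong (λ n → ω E.^ n ⊗ ω E.^ (e₀ ℕ.* k)) (ℕ.*-identityʳ e₀))))
        (trans (lem (P k) β′ (ω E.^ e₀) (ω E.^ (e₀ ℕ.* k))) (cong₂ _⊗_ (sym (power-β k)) (sym (PrimaryAssociate.associate≡ normalisation))))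

  GoodPrimes : ℤ → Set
  GoodPrimes t = ∀ {ℓ} → Prime ℓ → t ≋ 0ℤ [ + ℓ ] → ¬ N ≋ 0ℤ [ + ℓ ] × (ℓ ≡ 2 ⊎ a ≋ 0ℤ [ + ℓ ] ⊎ b ≋ 0ℤ [ + ℓ ])

  good-nat : ∀ n → n ≢ 0 → ¬ + n ≋ 0ℤ [ + 3 ] → GoodPrimes (+ n) → Good (+ n)
  good-nat n n≢0 3∤n gp = go (factors f) n (isFactorisation f) (factorsPrime f) 3∤n gp
    where
    open PrimeFactorisation
    f = factorise n {{ℕ.≢-nonZero n≢0}}
    go : ∀ ps n → n ≡ product ps → All Prime ps → ¬ + n ≋ 0ℤ [ + 3 ] → GoodPrimes (+ n) → Good (+ n)
    go [] n refl _ _ _ = good-1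
    go (q ∷ ps) n refl (pr ∷ prs) 3∤n gp = subst Good (sym eq) (good-* 3∤q 3∤r
      (good-prime pr (λ { refl → 3∤q (subst (_≋ 0ℤ [ + 3 ]) (ℤ.*-identityʳ (+ 3)) (multiple-≋0 {+ 3} 1ℤ)) }) (proj₁ q-good) (proj₂ q-good))
      (go ps (product ps) refl prs 3∤r (λ {ℓ} pℓ h → gp pℓ (subst (_≋ 0ℤ [ + ℓ ]) (sym eq) (≋-mul0ʳ (+ q) h)))))
      where
      eq : + (q ℕ.* product ps) ≡ + q * + product ps
      eq = ℤ.pos-* q (product ps)
      3∤q : ¬ + q ≋ 0ℤ [ + 3 ]
      3∤q h = 3∤n (subst (_≋ 0ℤ [ + 3 ]) (sym eq) (≋-mul0ˡ (+ product ps) h))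
      3∤r : ¬ + product ps ≋ 0ℤ [ + 3 ]
      3∤r h = 3∤n (subst (_≋ 0ℤ [ + 3 ]) (sym eq) (≋-mul0ʳ (+ q) h))
      q-good : ¬ N ≋ 0ℤ [ + q ] × (q ≡ 2 ⊎ a ≋ 0ℤ [ + q ] ⊎ b ≋ 0ℤ [ + q ])
      q-good = gp pr (subst (_≋ 0ℤ [ + q ]) (sym eq) (multiple-≋0 {+ q} (+ product ps)))

  good-integer : ∀ t → ¬ t ≋ 0ℤ [ + 3 ] → GoodPrimes t → Good t
  good-integer (+ zero) 3∤t _ = contradiction (0ℤ by refl) 3∤t
  good-integer (+ suc n) 3∤t gp = good-nat (suc n) (λ ()) 3∤t gp
  good-integer -[1+ n ] 3∤t gp = subst Good (neg (+ suc n)) (good-* {s = - 1ℤ} (prime≢0 prime-3 refl) 3∤n good-−1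
      (good-nat (suc n) (λ ()) 3∤n (λ {ℓ} pℓ h → gp pℓ (ℤ/.-‿cong (+ ℓ) h))))
    where
    neg : ∀ x → - 1ℤ * x ≡ - x
    neg = ℤ-solve
    3∤n : ¬ + suc n ≋ 0ℤ [ + 3 ]
    3∤n h = 3∤t (ℤ/.-‿cong (+ 3) h)

  module _ {p k : ℕ} (pr : Prime p) (p≢3 : p ≢ 3) (p≡ : p ≡ suc (3 ℕ.* k)) (p∤N : ¬ N ≋ 0ℤ [ + p ])
           {u h x : ℤ} (3∤u : ¬ u ≋ 0ℤ [ + 3 ]) (3∤h : ¬ h ≋ 0ℤ [ + 3 ]) (3∤x : ¬ x ≋ 0ℤ [ + 3 ])
           (good-u : Good u) (good-h : Good h) (good-x : Good x)
           (relation : + p * (u * u) ≋ h * (x * x) [ N ]) where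
    private module L = 𝔼/ (+ p)

    -- By `relation`, X p = X h (X x)² (X u)⁻², and X is inverse to a power of ω at h, x and u. The
    -- resulting exponents - 1 at h and - 2 at x are replaced by 2 and 4, equal modulo 3, whence the
    -- product p u² h² x⁴. The exponent 2 k of p combines with the ω^(e₀ k) between β and its
    -- associate to ω^(3 e₀ k) = 1.
    reciprocity : ∀ m → SquareExponent (+ p * ((u * u) * ((h * h) * ((x * x) * (x * x))))) m →
      (ι N ⊗ β) E.^ k ⊗ ω E.^ (e₀ ℕ.* m) ≋ᴱ 𝟙 [ + p ]
    reciprocity m sm = combine (square-exponent 3∤u) (square-exponent 3∤h) (square-exponent 3∤x)
      where
      sq : ∀ {t e} → SquareExponent t e → SquareExponent (t * t) (e ℕ.+ e)
      sq {t} {e} s = square-exponent-* {t} {t} {e} {e} s s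
      identity : ∀ pk xp u h y xu xh xx → xu ⊗ u ≡ 𝟙 → xh ⊗ h ≡ 𝟙 → xx ⊗ y ≡ 𝟙 → h ⊗ (h ⊗ h) ≡ 𝟙 → y ⊗ (y ⊗ y) ≡ 𝟙 →
        xp ⊗ (xu ⊗ xu) ≡ xh ⊗ (xx ⊗ xx) → pk ⊗ ((u ⊗ u) ⊗ ((h ⊗ h) ⊗ ((y ⊗ y) ⊗ (y ⊗ y)))) ≡ pk ⊗ xp
      identity pk xp u h y xu xh xx eu eh ey eh³ ey³ e = cong (pk ⊗_) (sym (begin
        xp                                              ≡⟨ trans (sym (E.*-identityʳ xp)) (cong (xp ⊗_) (sym (⊗-identityˡ 𝟙))) ⟩
        xp ⊗ (𝟙 ⊗ 𝟙)                                    ≡⟨ cong (λ v → xp ⊗ (v ⊗ v)) eu ⟨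
        xp ⊗ ((xu ⊗ u) ⊗ (xu ⊗ u))                      ≡⟨ l₁ xp xu u ⟩
        (xp ⊗ (xu ⊗ xu)) ⊗ (u ⊗ u)                      ≡⟨ cong (_⊗ (u ⊗ u)) e ⟩
        -- The cubes of h and y, equal to 1, are inserted so that no inverse has to be formed.
        (xh ⊗ (xx ⊗ xx)) ⊗ (u ⊗ u)                      ≡⟨ cong₂ (λ v w → (xh ⊗ (xx ⊗ xx)) ⊗ (u ⊗ u) ⊗ (v ⊗ (w ⊗ w))) eh³ ey³ ⟨⟩ l₀ (xh ⊗ (xx ⊗ xx)) (u ⊗ u) ⟨
        (xh ⊗ (xx ⊗ xx)) ⊗ (u ⊗ u) ⊗ ((h ⊗ (h ⊗ h)) ⊗ ((y ⊗ (y ⊗ y)) ⊗ (y ⊗ (y ⊗ y)))) ≡⟨ l₂ xh xx u h y ⟩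
        ((xh ⊗ h) ⊗ ((xx ⊗ y) ⊗ (xx ⊗ y))) ⊗ ((u ⊗ u) ⊗ ((h ⊗ h) ⊗ ((y ⊗ y) ⊗ (y ⊗ y)))) ≡⟨ cong₂ (λ v w → (v ⊗ (w ⊗ w)) ⊗ ((u ⊗ u) ⊗ ((h ⊗ h) ⊗ ((y ⊗ y) ⊗ (y ⊗ y))))) eh ey ⟩
        (𝟙 ⊗ (𝟙 ⊗ 𝟙)) ⊗ ((u ⊗ u) ⊗ ((h ⊗ h) ⊗ ((y ⊗ y) ⊗ (y ⊗ y)))) ≡⟨ ⊗-identityˡ _ ⟩
        (u ⊗ u) ⊗ ((h ⊗ h) ⊗ ((y ⊗ y) ⊗ (y ⊗ y)))       ∎))
        where
        open ≡-Reasoning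
        infixr 2 _⟨⟩_
        _⟨⟩_ : ∀ {x y z : Eisenstein} → x ≡ y → y ≡ z → x ≡ z
        _⟨⟩_ = trans
        l₀ : ∀ x y → x ⊗ y ⊗ (𝟙 ⊗ (𝟙 ⊗ 𝟙)) ≡ x ⊗ y
        l₀ = solve-∀ 𝔼-acr
        l₁ : ∀ xp xu u → xp ⊗ ((xu ⊗ u) ⊗ (xu ⊗ u)) ≡ (xp ⊗ (xu ⊗ xu)) ⊗ (u ⊗ u)
        l₁ = solve-∀ 𝔼-acr
        l₂ : ∀ xh xx u h y → (xh ⊗ (xx ⊗ xx)) ⊗ (u ⊗ u) ⊗ ((h ⊗ (h ⊗ h)) ⊗ ((y ⊗ (y ⊗ y)) ⊗ (y ⊗ (y ⊗ y))))
          ≡ ((xh ⊗ h) ⊗ ((xx ⊗ y) ⊗ (xx ⊗ y))) ⊗ ((u ⊗ u) ⊗ ((h ⊗ h) ⊗ ((y ⊗ y) ⊗ (y ⊗ y))))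
        l₂ = solve-∀ 𝔼-acr
      cube-1 : ∀ e → ω E.^ (e₀ ℕ.* e) ⊗ (ω E.^ (e₀ ℕ.* e) ⊗ ω E.^ (e₀ ℕ.* e)) ≡ 𝟙
      cube-1 e = trans (cong (ω E.^ (e₀ ℕ.* e) ⊗_) (sym (ω^-e₀-+ e e))) (trans (sym (ω^-e₀-+ e (e ℕ.+ e)))
        (trans (cong (λ n → ω E.^ (e₀ ℕ.* (e ℕ.+ (e ℕ.+ n)))) (sym (ℕ.+-identityʳ e))) (ω^-e₀-3 e)))
      combine : ∃ (SquareExponent u) → ∃ (SquareExponent h) → ∃ (SquareExponent x) → (ι N ⊗ β) E.^ k ⊗ ω E.^ (e₀ ℕ.* m) ≋ᴱ 𝟙 [ + p ]
      combine (eᵤ , su) (eₕ , sh) (eₓ , sx) = L.trans (L.≈-reflexive (begin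
        (ι N ⊗ β) E.^ k ⊗ W m                           ≡⟨ cong₂ _⊗_ (power-β k) (trans (ω^-e₀ (square-exponent-unique {+ p * ((u * u) * ((h * h) * ((x * x) * (x * x))))} sm total)) split) ⟩
        (W k ⊗ P k) ⊗ (W (2 ℕ.* k) ⊗ V)                 ≡⟨ shuffle (W k) (P k) (W (2 ℕ.* k)) V ⟩
        (W k ⊗ W (2 ℕ.* k)) ⊗ (P k ⊗ V)                 ≡⟨ cong (_⊗ (P k ⊗ V)) (trans (sym (ω^-e₀-+ k (2 ℕ.* k))) (ω^-e₀-3 k)) ⟩
        𝟙 ⊗ (P k ⊗ V)                                   ≡⟨ ⊗-identityˡ _ ⟩
        P k ⊗ V                                         ≡⟨ identity (P k) (X (+ p)) (W eᵤ) (W eₕ) (W eₓ) (X u) (X h) (X x)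
                                                             (good-u eᵤ su) (good-h eₕ sh) (good-x eₓ sx) (cube-1 eₕ) (cube-1 eₓ) X-relation ⟩
        P k ⊗ X (+ p)                                   ∎))
        (X-prime-1 pr p≢3 (N∤⇒ p∤N) k p≡)
        where
        open ≡-Reasoning
        W : ℕ → Eisenstein
        W n = ω E.^ (e₀ ℕ.* n)
        V = (W eᵤ ⊗ W eᵤ) ⊗ ((W eₕ ⊗ W eₕ) ⊗ ((W eₓ ⊗ W eₓ) ⊗ (W eₓ ⊗ W eₓ)))
        E₄ = (eₓ ℕ.+ eₓ) ℕ.+ (eₓ ℕ.+ eₓ)
        E₃ = (eₕ ℕ.+ eₕ) ℕ.+ E₄
        E₂ = (eᵤ ℕ.+ eᵤ) ℕ.+ E₃
        shuffle : ∀ w p w′ v → (w ⊗ p) ⊗ (w′ ⊗ v) ≡ (w ⊗ w′) ⊗ (p ⊗ v)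
        shuffle = solve-∀ 𝔼-acr
        total : SquareExponent (+ p * ((u * u) * ((h * h) * ((x * x) * (x * x))))) (2 ℕ.* k ℕ.+ E₂)
        total = square-exponent-* {+ p} {e = 2 ℕ.* k} {f = E₂} (square-exponent-3k+1 k p≡)
          (square-exponent-* {u * u} {e = eᵤ ℕ.+ eᵤ} {f = E₃} (sq {u} {eᵤ} su) (square-exponent-* {h * h} {e = eₕ ℕ.+ eₕ} {f = E₄} (sq {h} {eₕ} sh)
            (sq {x * x} {eₓ ℕ.+ eₓ} (sq {x} {eₓ} sx))))
        split : W (2 ℕ.* k ℕ.+ E₂) ≡ W (2 ℕ.* k) ⊗ V
        split = trans (ω^-e₀-+ (2 ℕ.* k) E₂) (cong (W (2 ℕ.* k) ⊗_) (trans (ω^-e₀-+ (eᵤ ℕ.+ eᵤ) E₃) (cong₂ _⊗_ (ω^-e₀-+ eᵤ eᵤ)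
          (trans (ω^-e₀-+ (eₕ ℕ.+ eₕ) E₄) (cong₂ _⊗_ (ω^-e₀-+ eₕ eₕ) (trans (ω^-e₀-+ (eₓ ℕ.+ eₓ) (eₓ ℕ.+ eₓ)) (cong₂ _⊗_ (ω^-e₀-+ eₓ eₓ) (ω^-e₀-+ eₓ eₓ))))))))
        X-relation : X (+ p) ⊗ (X u ⊗ X u) ≡ X h ⊗ (X x ⊗ X x)
        X-relation = trans (sym (trans (X-* (+ p) (u * u)) (cong (X (+ p) ⊗_) (X-* u u))))
          (trans (X-periodic (subst (+ p * (u * u) ≋ h * (x * x) [_]) (sym norm-β′) relation))
          (trans (X-* h (x * x)) (cong (X h ⊗_) (X-* x x))))


-- Descent from p = x² + 3dy²

NoCommonPrime : ℤ → ℤ → Set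
NoCommonPrime a b = ∀ {ℓ} → Prime ℓ → a ≋ 0ℤ [ + ℓ ] → b ≋ 0ℤ [ + ℓ ] → ⊥

record Reduced (a b : ℤ) : Set where
  field
    g a′ b′ : ℤ
    a≡      : a ≡ g * a′
    b≡      : b ≡ g * b′
    coprime : NoCommonPrime a′ b′

reduce-by : ∀ {a b} G → G ≢ 0 → a ≋ 0ℤ [ + G ] → b ≋ 0ℤ [ + G ] →
  (∀ {c} → c ℕ.∣ ∣ a ∣ → c ℕ.∣ ∣ b ∣ → c ℕ.∣ G) → Reduced a b
reduce-by {a} {b} G G≢0 (a′ by ea) (b′ by eb) greatest = record
  { g = + G ; a′ = a′ ; b′ = b′ ; a≡ = a≡ ; b≡ = b≡
  ; coprime = λ {ℓ} pr ha hb → ℕ.<⇒≱ (ℕ.m<m*n G ℓ {{ℕ.≢-nonZero G≢0}} (ℕ.nonTrivial⇒n>1 ℓ {{prime⇒nonTrivial pr}}))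
      (ℕ.∣⇒≤ {{ℕ.≢-nonZero G≢0}} (greatest (factor {ℓ} a≡ ha) (factor {ℓ} b≡ hb))) }
  where
  a≡ : a ≡ + G * a′
  a≡ = trans ea (ℤ.+-identityˡ _)
  b≡ : b ≡ + G * b′
  b≡ = trans eb (ℤ.+-identityˡ _)
  factor : ∀ {ℓ c c′} → c ≡ + G * c′ → c′ ≋ 0ℤ [ + ℓ ] → G ℕ.* ℓ ℕ.∣ ∣ c ∣
  factor {ℓ} {c′ = c′} refl h = subst (G ℕ.* ℓ ℕ.∣_) (sym (ℤ.abs-* (+ G) c′)) (ℕ.*-monoʳ-∣ G (≋0⇒∣ {+ ℓ} {c′} h))

opaque
  reduce : ∀ a b → a ≢ 0ℤ → Reduced a b
  reduce a b a≢0 = reduce-by (ℕ.gcd ∣ a ∣ ∣ b ∣) (λ e → a≢0 (ℤ.∣i∣≡0⇒i≡0 (ℕ.gcd[m,n]≡0⇒m≡0 {∣ a ∣} {∣ b ∣} e)))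
    (∣⇒≋0 {+ ℕ.gcd ∣ a ∣ ∣ b ∣} {a} (ℕ.gcd[m,n]∣m ∣ a ∣ ∣ b ∣)) (∣⇒≋0 {+ ℕ.gcd ∣ a ∣ ∣ b ∣} {b} (ℕ.gcd[m,n]∣n ∣ a ∣ ∣ b ∣))
    (λ {c} ca cb → ℕ.gcd-greatest {∣ a ∣} {∣ b ∣} {c} ca cb)

prime-square : ∀ {ℓ} → Prime ℓ → ∀ {a} → a * a ≋ 0ℤ [ + ℓ ] → a ≋ 0ℤ [ + ℓ ]
prime-square pr {a} h = [ (λ z → z) , (λ z → z) ]′ (prime-cancel pr a a h)

-- v² = 1 + 3 z, and the cube of 1 + 3 z is 1 modulo 9. Common factors can thus be restored in sixth
-- powers without changing a residue modulo 9.
sixth-power : ∀ {v} → ¬ v ≋ 0ℤ [ + 3 ] → (v * v) * ((v * v) * (v * v)) ≋ 1ℤ [ + 9 ]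
sixth-power {v} 3∤v = go (unit-square 3∤v)
  where
  lem : ∀ z → (1ℤ + + 3 * z) * ((1ℤ + + 3 * z) * (1ℤ + + 3 * z)) ≡ 1ℤ + + 9 * (z + + 3 * (z * z) + + 3 * (z * (z * z)))
  lem = ℤ-solve
  go : v * v ≋ 1ℤ [ + 3 ] → (v * v) * ((v * v) * (v * v)) ≋ 1ℤ [ + 9 ]
  go (z by e) = (z + + 3 * (z * z) + + 3 * (z * (z * z))) by trans (cong (λ t → t * (t * t)) e) (lem z)

-- The element u + n √d below satisfies (u + n √d)² = 2 u (m + n √d) and has norm 4 τ u.
module Descent {d x y u n τ : ℤ} {p : ℕ} (pr : Prime p) (0<d : 0ℤ < d)
               (p≡ : + p ≡ x * x + + 3 * d * (y * y)) (3∤x : ¬ x ≋ 0ℤ [ + 3 ]) (3∤y : ¬ y ≋ 0ℤ [ + 3 ])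
               (τ² : τ * τ ≡ 1ℤ) (norm-u : u * u - d * (n * n) ≡ + 4 * τ * u)
               (3∤u : ¬ u ≋ 0ℤ [ + 3 ]) (p∤n : ¬ n ≋ 0ℤ [ + p ]) where

  private module M₃ = ℤ/ (+ 3)

  p≋1 : + p ≋ 1ℤ [ + 3 ]
  p≋1 = M₃.trans (M₃.reflexive p≡) (M₃.trans (M₃.+-cong (unit-square 3∤x) (≋-mul0ˡ (y * y) (multiple-≋0 {+ 3} d))) (M₃.reflexive refl))

  p≢3 : p ≢ 3
  p≢3 refl = prime≢0 prime-3 {1ℤ} refl (M₃.trans (M₃.sym p≋1) (1ℤ by refl))

  opaque
    p-mod-3 : ∃ λ k → p ≡ suc (3 ℕ.* suc k)
    p-mod-3 = [ (λ h → h) , (λ (k , e) → contradiction (two k e) 2≢1) ]′ (prime-mod-3 pr p≢3)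
      where
      two : ∀ k → p ≡ suc (suc (3 ℕ.* k)) → + 2 ≋ 1ℤ [ + 3 ]
      two k e = M₃.trans (M₃.sym {+ p} {+ 2} ((+ k) by trans (cong +_ e) (cong (_+_ (+ 2)) (ℤ.pos-* 3 k)))) p≋1
      2≢1 : ¬ + 2 ≋ 1ℤ [ + 3 ]
      2≢1 h = contradiction (residue-unique {3} {2} {1} (s≤s (s≤s (s≤s z≤n))) (s≤s (s≤s z≤n)) h) λ ()

  p≢2 : p ≢ 2
  p≢2 e = two (trans (sym (proj₂ p-mod-3)) e)
    where
    two : ∀ {k} → suc (3 ℕ.* suc k) ≢ 2
    two {zero} ()
    two {suc k} ()

  private
    x²≤p : ∣ x ∣ ℕ.* ∣ x ∣ ℕ.≤ p
    x²≤p = bound d 0<d p≡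
      where
      bound : ∀ d → 0ℤ < d → + p ≡ x * x + + 3 * d * (y * y) → ∣ x ∣ ℕ.* ∣ x ∣ ℕ.≤ p
      bound (+ D) _ e = subst (∣ x ∣ ℕ.* ∣ x ∣ ℕ.≤_) (sym (ℤ.+-injective (trans e (trans (cong₂ _+_ (square-abs x)
        (trans (cong₂ _*_ (sym (ℤ.pos-* 3 D)) (square-abs y)) (sym (ℤ.pos-* (3 ℕ.* D) (∣ y ∣ ℕ.* ∣ y ∣)))))
        (sym (ℤ.pos-+ (∣ x ∣ ℕ.* ∣ x ∣) (3 ℕ.* D ℕ.* (∣ y ∣ ℕ.* ∣ y ∣)))))))) (ℕ.m≤m+n _ _)
      bound -[1+ _ ] () _

  -- Since d > 0 one has x² ≤ p < p², and x ≠ 0 because 3 does not divide it.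
  p∤x : ¬ x ≋ 0ℤ [ + p ]
  p∤x h = ℕ.<⇒≱ (ℕ.m<m*n p p {{prime⇒nonZero pr}} (ℕ.nonTrivial⇒n>1 p {{prime⇒nonTrivial pr}})) (ℕ.≤-trans (ℕ.*-mono-≤ p≤x p≤x) x²≤p)
    where
    p≤x : p ℕ.≤ ∣ x ∣
    p≤x = ℕ.∣⇒≤ {{ℕ.≢-nonZero λ e → 3∤x (M₃.reflexive (ℤ.∣i∣≡0⇒i≡0 e))}} (≋0⇒∣ h)

  -- Such a prime divides p, hence equals p, which does not divide x.
  no-prime-xdy : ∀ {ℓ} → Prime ℓ → x ≋ 0ℤ [ + ℓ ] → d * (y * y) ≋ 0ℤ [ + ℓ ] → ⊥
  no-prime-xdy {ℓ} pℓ hx hdy = p∤x (subst (λ l → x ≋ 0ℤ [ + l ]) (prime-∣prime pℓ pr (M.trans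
    (M.reflexive (trans p≡ (cong (_+_ (x * x)) (ℤ.*-assoc (+ 3) d (y * y))))) (M.+-cong (≋-mul0ˡ x hx) (≋-mul0ʳ (+ 3) hdy)))) hx)
    where module M = ℤ/ (+ ℓ)

  p∤dy² : ¬ d * (y * y) ≋ 0ℤ [ + p ]
  p∤dy² h = p∤x (prime-square pr (M.trans (M.reflexive lem) (M.+-cong p≋0 (M.-‿cong (≋-mul0ʳ {a = d * (y * y)} (+ 3) h)))))
    where
    module M = ℤ/ (+ p)
    p≋0 : + p ≋ 0ℤ [ + p ]
    p≋0 = subst (_≋ 0ℤ [ + p ]) (ℤ.*-identityʳ (+ p)) (multiple-≋0 {+ p} 1ℤ)
    lem′ : ∀ x d y → x * x ≡ x * x + + 3 * d * (y * y) + - (+ 3 * (d * (y * y)))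
    lem′ = ℤ-solve
    lem : x * x ≡ + p + - (+ 3 * (d * (y * y)))
    lem = trans (lem′ x d y) (cong (_+ - (+ 3 * (d * (y * y)))) (sym p≡))

  p∤d : ¬ d ≋ 0ℤ [ + p ]
  p∤d h = p∤dy² (≋-mul0ˡ (y * y) h)

  p∤y : ¬ y ≋ 0ℤ [ + p ]
  p∤y h = p∤dy² (≋-mul0ʳ d (≋-mul0ˡ y h))

  u≢0 : u ≢ 0ℤ
  u≢0 refl = 3∤u M₃.refl

  private
    R₀ : Reduced u n
    R₀ = reduce u n u≢0
  open Reduced R₀ public using (g) renaming (a′ to u′; b′ to n′; a≡ to u≡; b≡ to n≡; coprime to coprime-u′n′)

  private
    nonzero-factor : ∀ {a b c} → a ≢ 0ℤ → a ≡ b * c → c ≢ 0ℤ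
    nonzero-factor {b = b} ne refl refl = ne (ℤ.*-zeroʳ b)

    u′≢0 : u′ ≢ 0ℤ
    u′≢0 = nonzero-factor {b = g} u≢0 u≡

    R₁ : Reduced u′ x
    R₁ = reduce u′ x u′≢0
  open Reduced R₁ public using () renaming (g to e; a′ to u₁; b′ to x₁; a≡ to u′≡; b≡ to x≡; coprime to coprime-u₁x₁)

  private
    y≢0 : y ≢ 0ℤ
    y≢0 refl = 3∤y M₃.refl

    R₂ : Reduced y n′
    R₂ = reduce y n′ y≢0
  open Reduced R₂ public using () renaming (g to f; a′ to y₁; b′ to n₁; a≡ to y≡; b≡ to n′≡; coprime to coprime-y₁n₁)

  -- The norm of u′ + n′ √d. As u² - d n² is linear in u on the right of `norm-u`, only one of the
  -- two factors g cancels, which leaves g h = 4 τ u′.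
  h : ℤ
  h = u′ * u′ - d * (n′ * n′)

  gh≡ : g * h ≡ + 4 * τ * u′
  gh≡ = ℤ.*-cancelˡ-≡ g (g * h) (+ 4 * τ * u′) {{ℤ.≢-nonZero g≢0}} (trans (lem g u′ d n′)
    (trans (cong₂ (λ u n → u * u - d * (n * n)) (sym u≡) (sym n≡)) (trans norm-u (trans (cong (_*_ (+ 4 * τ)) u≡) (lem₂ (+ 4 * τ) g u′)))))
    where
    g≢0 : g ≢ 0ℤ
    g≢0 e₀ = u≢0 (trans u≡ (cong (_* u′) e₀))
    lem : ∀ g u d n → g * (g * (u * u - d * (n * n))) ≡ g * u * (g * u) - d * (g * n * (g * n))
    lem = ℤ-solve
    lem₂ : ∀ t g u → t * (g * u) ≡ g * (t * u)
    lem₂ = ℤ-solve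

  -- The norm of n x + u y √-3 after division by g e f.
  N₂ : ℤ
  N₂ = (n₁ * x₁) * (n₁ * x₁) + + 3 * ((u₁ * y₁) * (u₁ * y₁))

  -- This is (x² + 3 d y²) u′² = (u′² - d n′²) x² + d (n′² x² + 3 u′² y²), divided by e².
  descent : + p * (u₁ * u₁) ≡ h * (x₁ * x₁) + d * (f * f) * N₂
  descent = ℤ.*-cancelˡ-≡ (e * e) _ _ {{ℤ.≢-nonZero e²≢0}} (begin
    e * e * (+ p * (u₁ * u₁))                           ≡⟨ l₁ e (+ p) u₁ ⟩
    + p * ((e * u₁) * (e * u₁))                         ≡⟨ cong₂ (λ P u → P * (u * u)) p≡ (sym u′≡) ⟩
    (x * x + + 3 * d * (y * y)) * (u′ * u′)             ≡⟨ l₂ x d y u′ n′ ⟩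
    h * (x * x) + d * ((n′ * x) * (n′ * x) + + 3 * ((u′ * y) * (u′ * y))) ≡⟨ cong (_+ d * ((n′ * x) * (n′ * x) + + 3 * ((u′ * y) * (u′ * y)))) (cong (λ v → h * (v * v)) x≡) ⟩
    h * (e * x₁ * (e * x₁)) + d * ((n′ * x) * (n′ * x) + + 3 * ((u′ * y) * (u′ * y))) ≡⟨ cong (λ v → h * (e * x₁ * (e * x₁)) + d * v) (cong₂ (λ v w → v * v + + 3 * (w * w)) (cong₂ _*_ n′≡ x≡) (cong₂ _*_ u′≡ y≡)) ⟩
    h * (e * x₁ * (e * x₁)) + d * ((f * n₁ * (e * x₁)) * (f * n₁ * (e * x₁)) + + 3 * ((e * u₁ * (f * y₁)) * (e * u₁ * (f * y₁)))) ≡⟨ l₃ h e x₁ d f n₁ u₁ y₁ ⟩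
    e * e * (h * (x₁ * x₁) + d * (f * f) * N₂)          ∎)
    where
    open ≡-Reasoning
    e²≢0 : e * e ≢ 0ℤ
    e²≢0 h = u′≢0 (trans u′≡ (cong (_* u₁) ([ (λ z → z) , (λ z → z) ]′ (ℤ.i*j≡0⇒i≡0∨j≡0 e h))))
    l₁ : ∀ e p u → e * e * (p * (u * u)) ≡ p * ((e * u) * (e * u))
    l₁ = ℤ-solve
    l₂ : ∀ x d y u n → (x * x + + 3 * d * (y * y)) * (u * u)
      ≡ (u * u - d * (n * n)) * (x * x) + d * ((n * x) * (n * x) + + 3 * ((u * y) * (u * y)))
    l₂ = ℤ-solve
    l₃ : ∀ h e x d f n u y → h * (e * x * (e * x)) + d * ((f * n * (e * x)) * (f * n * (e * x)) + + 3 * ((e * u * (f * y)) * (e * u * (f * y))))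
      ≡ e * e * (h * (x * x) + d * (f * f) * ((n * x) * (n * x) + + 3 * ((u * y) * (u * y))))
    l₃ = ℤ-solve

  module _ {ℓ : ℕ} (pℓ : Prime ℓ) where
    private
      module M = ℤ/ (+ ℓ)

      left-factor : ∀ {a b c} → a ≡ b * c → b ≋ 0ℤ [ + ℓ ] → a ≋ 0ℤ [ + ℓ ]
      left-factor {c = c} refl hb = ≋-mul0ˡ c hb

      right-factor : ∀ {a b c} → a ≡ b * c → c ≋ 0ℤ [ + ℓ ] → a ≋ 0ℤ [ + ℓ ]
      right-factor {b = b} refl hc = ≋-mul0ʳ b hc

      minus : ∀ {a b} → a + b ≋ 0ℤ [ + ℓ ] → b ≋ 0ℤ [ + ℓ ] → a ≋ 0ℤ [ + ℓ ]
      minus {a} {b} hab hb = M.trans (M.reflexive (lem a b)) (M.+-cong hab (M.-‿cong hb))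
        where
        lem : ∀ a b → a ≡ a + b + - b
        lem = ℤ-solve

    u₁-coprime-N₂ : u₁ ≋ 0ℤ [ + ℓ ] → ¬ N₂ ≋ 0ℤ [ + ℓ ]
    u₁-coprime-N₂ hu hN = [ (λ hn → coprime-u′n′ pℓ (right-factor {b = e} {c = u₁} u′≡ hu) (right-factor {b = f} {c = n₁} n′≡ hn)) , coprime-u₁x₁ pℓ hu ]′
      (prime-cancel pℓ n₁ x₁ (prime-square pℓ (minus hN (≋-mul0ʳ (+ 3) (≋-mul0ˡ (u₁ * y₁) (≋-mul0ˡ y₁ hu))))))

    -- Such a prime divides 3, u₁ or y₁. The first contradicts 3 ∤ x, the second the reduction of u′
    -- and x, and the third gives a common prime of x and d y².
    x₁-coprime-N₂ : x₁ ≋ 0ℤ [ + ℓ ] → ¬ N₂ ≋ 0ℤ [ + ℓ ]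
    x₁-coprime-N₂ hx hN = [ three , (λ hu → [ (λ hu → coprime-u₁x₁ pℓ hu hx)
        , (λ hy → no-prime-xdy pℓ (right-factor {b = e} {c = x₁} x≡ hx) (≋-mul0ʳ d (≋-mul0ˡ y (right-factor {b = f} {c = y₁} y≡ hy)))) ]′ (prime-cancel pℓ u₁ y₁ (prime-square pℓ hu))) ]′
      (prime-cancel pℓ (+ 3) ((u₁ * y₁) * (u₁ * y₁)) (minus (M.trans (M.reflexive (ℤ.+-comm (+ 3 * ((u₁ * y₁) * (u₁ * y₁))) ((n₁ * x₁) * (n₁ * x₁)))) hN)
        (≋-mul0ˡ (n₁ * x₁) (≋-mul0ʳ n₁ hx))))
      where
      three : + 3 ≋ 0ℤ [ + ℓ ] → ⊥
      three h₃ = 3∤x (subst (λ l → x ≋ 0ℤ [ + l ]) (prime-∣prime pℓ prime-3 h₃) (right-factor {b = e} {c = x₁} x≡ hx))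

    -- By `gh≡` the prime divides 4 or u′ = e u₁. If it divided e, it would divide x and u′, hence d
    -- n′²; but it cannot divide d together with x, nor n′ together with u′.
    h-divisors : h ≋ 0ℤ [ + ℓ ] → ℓ ≡ 2 ⊎ u₁ ≋ 0ℤ [ + ℓ ]
    h-divisors hh = [ four , (λ hu → [ (λ he → ⊥-elim (bad-e he)) , inj₂ ]′ (prime-cancel pℓ e u₁ (M.trans (M.reflexive (sym u′≡)) hu))) ]′
      (prime-cancel pℓ (+ 4 * τ) u′ (M.trans (M.reflexive (sym gh≡)) (≋-mul0ʳ g hh)))
      where
      unit-τ : ¬ τ ≋ 0ℤ [ + ℓ ]
      unit-τ ht = prime≢0 pℓ {1ℤ} refl (M.trans (M.reflexive (sym τ²)) (≋-mul0ˡ τ ht))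
      four : + 4 * τ ≋ 0ℤ [ + ℓ ] → ℓ ≡ 2 ⊎ u₁ ≋ 0ℤ [ + ℓ ]
      four h₄ = [ (λ h → inj₁ (prime-∣prime pℓ prime-2 (prime-square pℓ {+ 2} h))) , (λ ht → contradiction ht unit-τ) ]′ (prime-cancel pℓ (+ 4) τ h₄)
      bad-e : e ≋ 0ℤ [ + ℓ ] → ⊥
      bad-e he = [ (λ hd → no-prime-xdy pℓ (left-factor {b = e} {c = x₁} x≡ he) (≋-mul0ˡ (y * y) hd)) , (λ hn → coprime-u′n′ pℓ hu′ (prime-square pℓ hn)) ]′
        (prime-cancel pℓ d (n′ * n′) (M.trans (M.reflexive (lem u′ (d * (n′ * n′)))) (M.+-cong (≋-mul0ˡ u′ hu′) (M.-‿cong hh))))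
        where
        hu′ : u′ ≋ 0ℤ [ + ℓ ]
        hu′ = left-factor {b = e} {c = u₁} u′≡ he
        lem : ∀ u v → v ≡ u * u + - (u * u - v)
        lem = ℤ-solve

    -- By `descent` such a prime divides p u₁², and primes of u₁ are already excluded.
    h-coprime-N₂ : h ≋ 0ℤ [ + ℓ ] → ℓ ≢ p → ¬ N₂ ≋ 0ℤ [ + ℓ ]
    h-coprime-N₂ hh ℓ≢p hN = [ (λ hp → ℓ≢p (prime-∣prime pℓ pr hp)) , (λ hu → u₁-coprime-N₂ (prime-square pℓ hu) hN) ]′
      (prime-cancel pℓ (+ p) (u₁ * u₁) (M.trans (M.reflexive descent) (M.+-cong (≋-mul0ˡ (x₁ * x₁) hh) (≋-mul0ʳ (d * (f * f)) hN))))

  p∤u₁ : ¬ u₁ ≋ 0ℤ [ + p ]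
  p∤u₁ hu = p∤dn (M.trans (M.reflexive (trans (lem u d n) (cong (λ v → u * u + - v) norm-u))) (M.+-cong (≋-mul0ˡ u hu′) (M.-‿cong (≋-mul0ʳ (+ 4 * τ) hu′))))
    where
    module M = ℤ/ (+ p)
    lem : ∀ u d n → d * (n * n) ≡ u * u + - (u * u - d * (n * n))
    lem = ℤ-solve
    hu′ : u ≋ 0ℤ [ + p ]
    hu′ = M.trans (M.reflexive (trans u≡ (cong (g *_) u′≡))) (≋-mul0ʳ g (≋-mul0ʳ e hu))
    p∤dn : ¬ d * (n * n) ≋ 0ℤ [ + p ]
    p∤dn hd = [ p∤d , (λ hn → p∤n (prime-square pr hn)) ]′ (prime-cancel pr d (n * n) hd)

  p∤h : ¬ h ≋ 0ℤ [ + p ]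
  p∤h hh = [ p≢2 , p∤u₁ ]′ (h-divisors pr hh)

  p∤N₂ : ¬ N₂ ≋ 0ℤ [ + p ]
  p∤N₂ hN = [ p∤h , (λ hx → p∤x (M.trans (M.reflexive x≡) (≋-mul0ʳ e (prime-square pr hx)))) ]′ (prime-cancel pr h (x₁ * x₁)
    (M.trans (M.reflexive (trans (lem (h * (x₁ * x₁)) (d * (f * f) * N₂)) (cong (_+ - (d * (f * f) * N₂)) (sym descent))))
      (M.+-cong (multiple-≋0 {+ p} (u₁ * u₁)) (M.-‿cong (≋-mul0ʳ (d * (f * f)) hN)))))
    where
    module M = ℤ/ (+ p)
    lem : ∀ a b → a ≡ a + b + - b
    lem = ℤ-solve

  private
    3∤-right : ∀ {a b c} → a ≡ b * c → ¬ a ≋ 0ℤ [ + 3 ] → ¬ c ≋ 0ℤ [ + 3 ]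
    3∤-right {b = b} refl ne hc = ne (≋-mul0ʳ b hc)
    3∤-left : ∀ {a b c} → a ≡ b * c → ¬ a ≋ 0ℤ [ + 3 ] → ¬ b ≋ 0ℤ [ + 3 ]
    3∤-left {c = c} refl ne hb = ne (≋-mul0ˡ c hb)

  3∤u′ : ¬ u′ ≋ 0ℤ [ + 3 ]
  3∤u′ = 3∤-right {b = g} {c = u′} u≡ 3∤u
  3∤g : ¬ g ≋ 0ℤ [ + 3 ]
  3∤g = 3∤-left {b = g} {c = u′} u≡ 3∤u
  3∤u₁ : ¬ u₁ ≋ 0ℤ [ + 3 ]
  3∤u₁ = 3∤-right {b = e} {c = u₁} u′≡ 3∤u′
  3∤e : ¬ e ≋ 0ℤ [ + 3 ]
  3∤e = 3∤-left {b = e} {c = u₁} u′≡ 3∤u′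
  3∤x₁ : ¬ x₁ ≋ 0ℤ [ + 3 ]
  3∤x₁ = 3∤-right {b = e} {c = x₁} x≡ 3∤x
  3∤y₁ : ¬ y₁ ≋ 0ℤ [ + 3 ]
  3∤y₁ = 3∤-right {b = f} {c = y₁} y≡ 3∤y
  3∤f : ¬ f ≋ 0ℤ [ + 3 ]
  3∤f = 3∤-left {b = f} {c = y₁} y≡ 3∤y
  3∤h : ¬ h ≋ 0ℤ [ + 3 ]
  3∤h hh = [ (λ h₄ → [ prime≢4 , (λ ht → prime≢0 prime-3 {1ℤ} refl (M₃.trans (M₃.reflexive (sym τ²)) (≋-mul0ˡ τ ht))) ]′ (prime-cancel prime-3 (+ 4) τ h₄)) , 3∤u′ ]′
    (prime-cancel prime-3 (+ 4 * τ) u′ (M₃.trans (M₃.reflexive (sym gh≡)) (≋-mul0ʳ g hh)))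
    where
    prime≢4 : ¬ + 4 ≋ 0ℤ [ + 3 ]
    prime≢4 h₄ = prime≢0 prime-3 {1ℤ} refl (M₃.trans (M₃.sym (1ℤ by refl)) h₄)


-- The residue of ε as a power of ω

parity : ∀ n → (∃ λ j → n ≡ 2 ℕ.* j) ⊎ (∃ λ j → n ≡ suc (2 ℕ.* j))
parity zero = inj₁ (0 , refl)
parity (suc n) with parity n
... | inj₁ (j , e) = inj₂ (j , cong suc e)
... | inj₂ (j , e) = inj₁ (suc j , trans (cong suc e) (sym (ℕ.*-suc 2 j)))

opaque
  -- For odd p the number 3 k = p - 1 is even. With k even, k-th powers agree as soon as squares do.
  even-third : ∀ {p k} → Prime p → p ≢ 2 → p ≡ suc (3 ℕ.* k) → ∃ λ j → k ≡ 2 ℕ.* j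
  even-third {p} {k} pr p≢2 p≡ = [ (λ h → h) , (λ (j , e) → contradiction (sym (prime-∣prime prime-2 pr (even j e))) p≢2) ]′ (parity k)
    where
    even : ∀ j → k ≡ suc (2 ℕ.* j) → + p ≋ 0ℤ [ + 2 ]
    even j e = (+ 2 + + 3 * + j) by trans (cong +_ (trans p≡ (cong (λ k → suc (3 ℕ.* k)) e)))
      (trans (cong (_+_ 1ℤ) (trans (ℤ.pos-* 3 (suc (2 ℕ.* j))) (cong (λ v → + 3 * (1ℤ + v)) (ℤ.pos-* 2 j)))) (lem (+ j)))
      where
      lem : ∀ j → 1ℤ + + 3 * (1ℤ + + 2 * j) ≡ 0ℤ + + 2 * (+ 2 + + 3 * j)
      lem = ℤ-solve

module CubicResidue {d x y u n τ : ℤ} {p : ℕ} (pr : Prime p) (0<d : 0ℤ < d)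
               (p≡ : + p ≡ x * x + + 3 * d * (y * y)) (3∤x : ¬ x ≋ 0ℤ [ + 3 ]) (3∤y : ¬ y ≋ 0ℤ [ + 3 ])
               (τ² : τ * τ ≡ 1ℤ) (norm-u : u * u - d * (n * n) ≡ + 4 * τ * u)
               (3∤u : ¬ u ≋ 0ℤ [ + 3 ]) (p∤n : ¬ n ≋ 0ℤ [ + p ]) where
  open Descent {τ = τ} pr 0<d p≡ 3∤x 3∤y τ² norm-u 3∤u p∤n public

  private
    module M = ℤ/ (+ p)
    module M₉ = ℤ/ (+ 9)

  k : ℕ
  k = suc (proj₁ p-mod-3)

  c : ℤ
  c = + p * ((u₁ * u₁) * ((h * h) * ((x₁ * x₁) * (x₁ * x₁))))

  -- Multiplication by (g e)⁶ ≡ 1 restores the common factors and, with `gh≡` eliminating h, turns c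
  -- into 16 u⁴ p x⁴. Modulo 9, u⁴ ≡ 1 + 6 l, and p x⁴ = x⁶ + 3 d y² x⁴ ≡ 1 + 3 d.
  c-mod-9 : ∀ {l} → u * u ≡ 1ℤ + + 3 * l → c ≋ + 16 * ((1ℤ + + 6 * l) * (1ℤ + + 3 * d)) [ + 9 ]
  c-mod-9 {l} u² = M₉.trans (M₉.sym (M₉.trans (M₉.*-cong (M₉.refl {c}) (sixth-power 3∤v)) (M₉.reflexive (ℤ.*-identityʳ c))))
    (M₉.trans (M₉.reflexive expand) (M₉.*-cong (M₉.refl {+ 16}) (M₉.*-cong u⁴ (px⁴ (unit-square 3∤x) (unit-square 3∤y)))))
    where
    v = g * e
    3∤v : ¬ v ≋ 0ℤ [ + 3 ]
    3∤v hv = [ 3∤g , 3∤e ]′ (prime-cancel prime-3 g e hv)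
    l₁ : ∀ p u h x g e → p * ((u * u) * ((h * h) * ((x * x) * (x * x)))) * ((g * e * (g * e)) * ((g * e * (g * e)) * (g * e * (g * e))))
      ≡ p * ((e * u) * (e * u)) * ((g * h) * (g * h)) * (g * g * (g * g)) * ((e * x * (e * x)) * (e * x * (e * x)))
    l₁ = ℤ-solve
    l₂ : ∀ p u t g x → p * (u * u) * ((+ 4 * t * u) * (+ 4 * t * u)) * (g * g * (g * g)) * ((x * x) * (x * x))
      ≡ + 16 * ((t * t) * ((g * u) * (g * u)) * ((g * u) * (g * u)) * (p * ((x * x) * (x * x))))
    l₂ = ℤ-solve
    expand : c * ((v * v) * ((v * v) * (v * v))) ≡ + 16 * ((u * u) * (u * u) * (+ p * ((x * x) * (x * x))))
    expand = trans (l₁ (+ p) u₁ h x₁ g e) (trans (cong₂ (λ s t → + p * (s * s) * (t * t) * (g * g * (g * g)) * ((e * x₁ * (e * x₁)) * (e * x₁ * (e * x₁)))) (sym u′≡) gh≡)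
      (trans (cong (λ z → + p * (u′ * u′) * ((+ 4 * τ * u′) * (+ 4 * τ * u′)) * (g * g * (g * g)) * ((z * z) * (z * z))) (sym x≡))
      (trans (l₂ (+ p) u′ τ g x) (cong (+ 16 *_) (trans (cong₂ (λ t w → t * (w * w) * (w * w) * (+ p * ((x * x) * (x * x)))) τ² (sym u≡))
        (cong (λ z → z * (u * u) * (+ p * ((x * x) * (x * x)))) (ℤ.*-identityˡ (u * u))))))))
    u⁴ : (u * u) * (u * u) ≋ 1ℤ + + 6 * l [ + 9 ]
    u⁴ = (l * l) by trans (cong (λ z → z * z) u²) (lem l)
      where
      lem : ∀ l → (1ℤ + + 3 * l) * (1ℤ + + 3 * l) ≡ 1ℤ + + 6 * l + + 9 * (l * l)
      lem = ℤ-solve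
    px⁴ : x * x ≋ 1ℤ [ + 3 ] → y * y ≋ 1ℤ [ + 3 ] → + p * ((x * x) * (x * x)) ≋ 1ℤ + + 3 * d [ + 9 ]
    px⁴ (s by ex) (t by ey) = (s + + 3 * (s * s) + + 3 * (s * s * s) + d * (+ 2 * s + + 3 * (s * s) + t * ((1ℤ + + 3 * s) * (1ℤ + + 3 * s)))) by
      trans (cong (_* ((x * x) * (x * x))) p≡) (trans (cong₂ (λ X Y → (X + + 3 * d * Y) * (X * X)) ex ey) (lem d s t))
      where
      lem : ∀ d s t → ((1ℤ + + 3 * s) + + 3 * d * (1ℤ + + 3 * t)) * ((1ℤ + + 3 * s) * (1ℤ + + 3 * s))
        ≡ 1ℤ + + 3 * d + + 9 * (s + + 3 * (s * s) + + 3 * (s * s * s) + d * (+ 2 * s + + 3 * (s * s) + t * ((1ℤ + + 3 * s) * (1ℤ + + 3 * s))))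
      lem = ℤ-solve

  -- Modulo 9, c ≡ 3 (d - l) - 2, whose square is 4 - 12 (d - l) ≡ 1 + 3 (1 + l + 2 d).
  c-exponent : ∀ {l m} → u * u ≡ 1ℤ + + 3 * l → + m ≋ 1ℤ + l + + 2 * d [ + 3 ] → SquareExponent c m
  c-exponent {l} {m} u² (z by em) = M₉.trans (M₉.*-cong c≋ c≋)
    ((l + (l - d) * (l - d) - + 2 * d - z) by trans (square d l z) (cong (λ w → 1ℤ + + 3 * w + + 9 * (l + (l - d) * (l - d) - + 2 * d - z)) (sym em)))
    where
    c≋ : c ≋ + 3 * (d - l) - + 2 [ + 9 ]
    c≋ = M₉.trans (c-mod-9 {l} u²) ((+ 2 + + 11 * l + + 5 * d + + 32 * (l * d)) by lem d l)
      where
      lem : ∀ d l → + 16 * ((1ℤ + + 6 * l) * (1ℤ + + 3 * d)) ≡ + 3 * (d - l) - + 2 + + 9 * (+ 2 + + 11 * l + + 5 * d + + 32 * (l * d))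
      lem = ℤ-solve
    square : ∀ d l z → (+ 3 * (d - l) - + 2) * (+ 3 * (d - l) - + 2)
      ≡ 1ℤ + + 3 * (1ℤ + l + + 2 * d + + 3 * z) + + 9 * (l + (l - d) * (l - d) - + 2 * d - z)
    square = ℤ-solve

  module _ {a b : ℤ} (3∤a : ¬ a ≋ 0ℤ [ + 3 ]) (3∤b : ¬ b ≋ 0ℤ [ + 3 ])
           {r : ℤ} (N₂≡ : N₂ ≡ r * norm (a + b √−3))
           (u₁-divides : ∀ {ℓ} → u₁ ≋ 0ℤ [ + ℓ ] → a ≋ 0ℤ [ + ℓ ] ⊎ b ≋ 0ℤ [ + ℓ ])
           (x₁-divides : ∀ {ℓ} → x₁ ≋ 0ℤ [ + ℓ ] → a ≋ 0ℤ [ + ℓ ] ⊎ b ≋ 0ℤ [ + ℓ ]) where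
    open RationalReciprocity 3∤a 3∤b using (β; N; e₀; e₀≋; good-integer; reciprocity) public

    N⇒N₂ : ∀ {ℓ} → N ≋ 0ℤ [ + ℓ ] → N₂ ≋ 0ℤ [ + ℓ ]
    N⇒N₂ {ℓ} hN = subst (_≋ 0ℤ [ + ℓ ]) (sym N₂≡) (≋-mul0ʳ r hN)

    N-reciprocity : ∀ m → SquareExponent c m → (ι N ⊗ β) E.^ k ⊗ ω E.^ (e₀ ℕ.* m) ≋ᴱ 𝟙 [ + p ]
    N-reciprocity = reciprocity {p} {k} pr p≢3 (proj₂ p-mod-3) (λ hN → p∤N₂ (N⇒N₂ hN)) {u₁} {h} {x₁} 3∤u₁ 3∤h 3∤x₁
      (good-integer u₁ 3∤u₁ (λ pℓ hu → (λ hN → u₁-coprime-N₂ pℓ hu (N⇒N₂ hN)) , inj₂ (u₁-divides hu)))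
      (good-integer h 3∤h (λ pℓ hh → (λ hN → h-coprime-N₂ pℓ hh (λ ℓ≡p → p∤h (subst (λ l → h ≋ 0ℤ [ + l ]) ℓ≡p hh)) (N⇒N₂ hN))
        , [ inj₁ , (λ hu → inj₂ (u₁-divides hu)) ]′ (h-divisors pℓ hh)))
      (good-integer x₁ 3∤x₁ (λ pℓ hx → (λ hN → x₁-coprime-N₂ pℓ hx (N⇒N₂ hN)) , inj₂ (x₁-divides hx)))
      ((d * (f * f) * r) by trans descent (cong (_+_ (h * (x₁ * x₁))) (trans (cong (_*_ (d * (f * f))) N₂≡) (lem (d * (f * f)) r N))))
      where
      lem : ∀ s r N → s * (r * N) ≡ N * (s * r)
      lem = ℤ-solve

    module _ {w : ℤ} (root : w * w + w + 1ℤ ≋ 0ℤ [ + p ]) where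
      open Evaluation p w root

      private
        B = ev β
        B̄ = ev (conj β)

      -- As k is even, the hypothesis on squares gives (ε B̄)^k ≡ B^k. With N ≡ B B̄ it follows that
      -- ε^k (N B)^k ≡ (ε B̄)^k B^(2k) ≡ B^(3k) ≡ 1, so ε^k is the inverse of the power that
      -- reciprocity evaluates.
      unit-residue : ∀ ε → B * B ≋ (ε * ε) * (B̄ * B̄) [ + p ] → ∀ m → SquareExponent c m → ε ^ k ≋ ev (ω E.^ (e₀ ℕ.* m)) [ + p ]
      unit-residue ε B² m sm = M.trans (M.sym (M.trans (M.*-cong (M.refl {ε ^ k}) VW≋1) (M.reflexive (ℤ.*-identityʳ _))))
        (M.trans (M.reflexive (lem₁ (ε ^ k) ((N * B) ^ k) W)) (M.trans (M.*-cong cubes (M.refl {W})) (M.reflexive (ℤ.*-identityˡ W))))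
        where
        W = ev (ω E.^ (e₀ ℕ.* m))
        j = proj₁ (even-third {p} {k} pr p≢2 (proj₂ p-mod-3))
        k≡2j : k ≡ 2 ℕ.* j
        k≡2j = proj₂ (even-third {p} {k} pr p≢2 (proj₂ p-mod-3))
        lem₁ : ∀ x v w → x * (v * w) ≡ (x * v) * w
        lem₁ = ℤ-solve
        VW≋1 : (N * B) ^ k * W ≋ 1ℤ [ + p ]
        VW≋1 = M.trans (M.sym (M.trans (ev-⊗ ((ι N ⊗ β) E.^ k) (ω E.^ (e₀ ℕ.* m))) (M.*-cong (M.trans (ev-^ (ι N ⊗ β) k)
          (^-congᵐ k (M.trans (ev-⊗ (ι N) β) (M.*-cong (M.reflexive (ev-ι N)) (M.refl {B}))))) (M.refl {W}))))
          (M.trans (ev-≋ (N-reciprocity m sm)) (M.reflexive (ev-ι 1ℤ)))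
        B∤ : ¬ B ≋ 0ℤ [ + p ]
        B∤ hB = p∤N₂ (N⇒N₂ (M.trans (M.sym (ev-conj β)) (≋-mul0ˡ B̄ hB)))
        square-power : ∀ z → (z * z) ^ j ≡ z ^ k
        square-power z = trans (cong (_^ j) (cong (z *_) (sym (ℤ.*-identityʳ z)))) (trans (ℤ.^-*-assoc z 2 j) (cong (z ^_) (sym k≡2j)))
        εB̄ : (ε * B̄) ^ k ≋ B ^ k [ + p ]
        εB̄ = M.trans (M.reflexive (sym (square-power (ε * B̄)))) (M.trans (^-congᵐ j (M.trans (M.reflexive (lem ε B̄)) (M.sym B²))) (M.reflexive (square-power B)))
          where
          lem : ∀ e b → e * b * (e * b) ≡ e * e * (b * b)
          lem = ℤ-solve
        cubes : ε ^ k * (N * B) ^ k ≋ 1ℤ [ + p ]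
        cubes = M.trans (M.trans (M.reflexive (sym (^-*-distrib ε (N * B) k)))
          (^-congᵐ k (M.trans (M.*-cong (M.refl {ε}) (M.*-cong (M.sym (ev-conj β)) (M.refl {B}))) (M.reflexive (lem ε B B̄)))))
          (M.trans (M.reflexive (^-*-distrib (ε * B̄) (B * B) k)) (M.trans (M.*-cong εB̄ (M.refl {(B * B) ^ k}))
          (M.trans (M.reflexive (trans (sym (^-*-distrib B (B * B) k)) (trans (cong (_^ k) (lem₃ B)) (ℤ.^-*-assoc B 3 k)))) (fermat-unit pr (proj₂ p-mod-3) B B∤))))
          where
          lem : ∀ e b b′ → e * (b * b′ * b) ≡ e * b′ * (b * b)
          lem = ℤ-solve
          lem₃ : ∀ b → b * (b * b) ≡ b * (b * (b * 1ℤ))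
          lem₃ = ℤ-solve


-- From powers of ω back to √d modulo p

SignMod3 : ℤ → ℤ → Set
SignMod3 L c = (L ≡ 1ℤ × c ≋ 1ℤ [ + 3 ]) ⊎ (L ≡ - 1ℤ × c ≋ - 1ℤ [ + 3 ])

module Conclusion {d x y m n τ s ½ i : ℤ} {p : ℕ} (pr : Prime p) (0<d : 0ℤ < d)
               (p≡ : + p ≡ x * x + + 3 * d * (y * y)) (3∤x : ¬ x ≋ 0ℤ [ + 3 ]) (3∤y : ¬ y ≋ 0ℤ [ + 3 ])
               (τ² : τ * τ ≡ 1ℤ) (pell : m * m - d * (n * n) ≡ + 4)
               (3∤u : ¬ m + + 2 * τ ≋ 0ℤ [ + 3 ]) (p∤n : ¬ n ≋ 0ℤ [ + p ]) (x≋y : x ≋ y [ + 3 ])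
               (s² : s * s ≋ d [ + p ]) (half : + 2 * ½ ≋ 1ℤ [ + p ]) (dyi : d * y * i ≋ 1ℤ [ + p ]) where
  private
    module M = ℤ/ (+ p)
    module M₃ = ℤ/ (+ 3)

  u : ℤ
  u = m + + 2 * τ

  norm-u : u * u - d * (n * n) ≡ + 4 * τ * u
  norm-u = trans (cong (λ v → u * u - v) (trans (l₁ (m * m) (d * (n * n))) (cong (_-_ (m * m)) pell))) (trans (l₂ m τ) (trans (cong (λ v → + 4 * τ * u + (+ 4 - + 4 * v)) τ²) (ℤ.+-identityʳ _)))
    where
    l₁ : ∀ m d → d ≡ m - (m - d)
    l₁ = ℤ-solve
    l₂ : ∀ m t → (m + + 2 * t) * (m + + 2 * t) - (m * m - + 4) ≡ + 4 * t * (m + + 2 * t) + (+ 4 - + 4 * (t * t))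
    l₂ = ℤ-solve

  open CubicResidue {τ = τ} pr 0<d p≡ 3∤x 3∤y τ² norm-u 3∤u p∤n

  -- r is the square root x √d / (d y) of - 3, w = (- 1 + r) / 2 the image of ω, and ε the image of
  -- (m + n √d) / 2.
  r w ε : ℤ
  r = x * i * s
  w = ½ * (- 1ℤ + r)
  ε = (m + n * s) * ½

  opaque
    r² : r * r ≋ - + 3 [ + p ]
    r² = M.trans (M.reflexive (l₁ x i s)) (M.trans (M.*-cong (M.*-cong x² (M.refl {i * i})) s²)
      (M.trans (M.reflexive (l₂ d y i)) (M.*-cong (M.refl { - + 3}) (M.*-cong dyi dyi))))
      where
      l₁ : ∀ x i s → x * i * s * (x * i * s) ≡ x * x * (i * i) * (s * s)
      l₁ = ℤ-solve
      l₂ : ∀ d y i → - (+ 3 * d * (y * y)) * (i * i) * d ≡ - + 3 * ((d * y * i) * (d * y * i))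
      l₂ = ℤ-solve
      l₃ : ∀ x v → x ≡ - v + (x + v)
      l₃ = ℤ-solve
      x² : x * x ≋ - (+ 3 * d * (y * y)) [ + p ]
      x² = 1ℤ by trans (l₃ (x * x) (+ 3 * d * (y * y))) (cong (_+_ (- (+ 3 * d * (y * y)))) (trans (sym p≡) (sym (ℤ.*-identityʳ (+ p)))))

    2w : + 2 * w ≋ - 1ℤ + r [ + p ]
    2w = M.trans (M.reflexive (sym (ℤ.*-assoc (+ 2) ½ (- 1ℤ + r)))) (M.trans (M.*-cong half (M.refl { - 1ℤ + r})) (M.reflexive (ℤ.*-identityˡ _)))

    root : w * w + w + 1ℤ ≋ 0ℤ [ + p ]
    root = M.trans (M.reflexive (l₁ ½ r)) (M.trans (M.+-cong (M.+-cong (≋-mul0ʳ (½ * ½) (≋-sub r²)) (≋-mul0ʳ (- ½ * (1ℤ + r)) (≋-sub half))) (M.-‿cong (≋-sub half))) (M.reflexive refl))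
      where
      l₁ : ∀ h r → h * (- 1ℤ + r) * (h * (- 1ℤ + r)) + h * (- 1ℤ + r) + 1ℤ
        ≡ h * h * (r * r - - + 3) + - h * (1ℤ + r) * (+ 2 * h - 1ℤ) + - (+ 2 * h - 1ℤ)
      l₁ = ℤ-solve

    yrs : y * r * s ≋ x [ + p ]
    yrs = M.trans (M.reflexive (l₁ x y i s)) (M.trans (M.*-cong (M.refl {x * y * i}) s²) (M.trans (M.reflexive (l₂ x y i d)) (M.trans (M.*-cong (M.refl {x}) dyi) (M.reflexive (ℤ.*-identityʳ x)))))
      where
      l₁ : ∀ x y i s → y * (x * i * s) * s ≡ x * y * i * (s * s)
      l₁ = ℤ-solve
      l₂ : ∀ x y i d → x * y * i * d ≡ x * (d * y * i)
      l₂ = ℤ-solve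

    -- (m + n s) (u - n s) ≡ 4 + 2 τ (m + n s), and writing 4 = 4 τ² makes this 2 τ (u + n s).
    unit-relation : ε * (u - n * s) ≋ τ * (u + n * s) [ + p ]
    unit-relation = M.trans (M.reflexive (l₁ m n s ½ τ)) (M.trans (M.*-cong (M.refl {½}) product-relation)
      (M.trans (M.reflexive (l₃ ½ (τ * (u + n * s)))) (M.trans (M.*-cong half (M.refl {τ * (u + n * s)})) (M.reflexive (ℤ.*-identityˡ _)))))
      where
      l₁ : ∀ m n s h t → (m + n * s) * h * (m + + 2 * t - n * s) ≡ h * ((m + n * s) * (m + + 2 * t - n * s))
      l₁ = ℤ-solve
      l₂ : ∀ m n s t d → (m + n * s) * (m + + 2 * t - n * s)
        ≡ + 2 * (t * (m + + 2 * t + n * s)) + (m * m - d * (n * n) - + 4) + + 4 * (1ℤ - t * t) + n * n * (d - s * s)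
      l₂ = ℤ-solve
      l₃ : ∀ h v → h * (+ 2 * v) ≡ + 2 * h * v
      l₃ = ℤ-solve
      product-relation : (m + n * s) * (u - n * s) ≋ + 2 * (τ * (u + n * s)) [ + p ]
      product-relation = M.trans (M.reflexive (trans (l₂ m n s τ d) (cong₂ (λ P t → + 2 * (τ * (u + n * s)) + (P - + 4) + + 4 * (1ℤ - t) + n * n * (d - s * s)) pell τ²)))
        (M.trans (M.+-cong (M.refl {+ 2 * (τ * (u + n * s)) + 0ℤ + 0ℤ}) (≋-mul0ʳ (n * n) (≋-sub (M.sym s²))))
          (M.reflexive (l₄ (+ 2 * (τ * (u + n * s))))))
        where
        l₄ : ∀ v → v + 0ℤ + 0ℤ + 0ℤ ≡ v
        l₄ = ℤ-solve

    -- Because x ≡ y r s, the two sums are y r (u + n s) and - y r (u - n s). Squaring removes τ and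
    -- the sign from `unit-relation`.
    full-relation : (n * x + u * y * r) * (n * x + u * y * r) ≋ (ε * ε) * ((n * x - u * y * r) * (n * x - u * y * r)) [ + p ]
    full-relation = M.trans (M.*-cong plus plus) (M.trans (M.reflexive (trans (l₁ (y * r) (u + n * s)) (trans (cong (λ t → y * r * (y * r) * (t * ((u + n * s) * (u + n * s)))) (sym τ²)) (l₂ (y * r) τ (u + n * s)))))
      (M.trans (M.*-cong (M.refl {y * r * (y * r)}) (M.*-cong (M.sym unit-relation) (M.sym unit-relation)))
      (M.trans (M.reflexive (l₃ (y * r) ε (u - n * s))) (M.*-cong (M.refl {ε * ε}) (M.*-cong (M.sym minus) (M.sym minus))))))
      where
      l₁ : ∀ v w → v * w * (v * w) ≡ v * v * (1ℤ * (w * w))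
      l₁ = ℤ-solve
      l₂ : ∀ v t w → v * v * ((t * t) * (w * w)) ≡ v * v * ((t * w) * (t * w))
      l₂ = ℤ-solve
      l₃ : ∀ v e w → v * v * ((e * w) * (e * w)) ≡ (e * e) * ((- (v * w)) * (- (v * w)))
      l₃ = ℤ-solve
      l₄ : ∀ n y r s u → n * (y * r * s) + u * y * r ≡ y * r * (u + n * s)
      l₄ = ℤ-solve
      l₅ : ∀ n y r s u → n * (y * r * s) - u * y * r ≡ - (y * r * (u - n * s))
      l₅ = ℤ-solve
      plus : n * x + u * y * r ≋ y * r * (u + n * s) [ + p ]
      plus = M.trans (M.+-cong (M.*-cong (M.refl {n}) (M.sym yrs)) (M.refl {u * y * r})) (M.reflexive (l₄ n y r s u))
      minus : n * x - u * y * r ≋ - (y * r * (u - n * s)) [ + p ]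
      minus = M.trans (M.+-cong (M.*-cong (M.refl {n}) (M.sym yrs)) (M.refl { - (u * y * r)})) (M.reflexive (l₅ n y r s u))

  open Evaluation p w root using (ev)

  opaque
    ev-√−3 : ∀ a b → ev (a + b √−3) ≋ a + b * r [ + p ]
    ev-√−3 a b = M.trans (M.reflexive (l₁ a b w)) (M.trans (M.+-cong (M.refl {a + b}) (M.*-cong (M.refl {b}) 2w)) (M.reflexive (l₂ a b r)))
      where
      l₁ : ∀ a b w → a + b + + 2 * b * w ≡ a + b + b * (+ 2 * w)
      l₁ = ℤ-solve
      l₂ : ∀ a b r → a + b + b * (- 1ℤ + r) ≡ a + b * r
      l₂ = ℤ-solve

    ev-conj-√−3 : ∀ a b → ev (conj (a + b √−3)) ≋ a - b * r [ + p ]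
    ev-conj-√−3 a b = M.trans (M.reflexive (l₁ a b w)) (M.trans (M.+-cong (M.refl {a - b}) (M.-‿cong (M.*-cong (M.refl {b}) 2w))) (M.reflexive (l₂ a b r)))
      where
      l₁ : ∀ a b w → a + b - + 2 * b + (- (+ 2 * b)) * w ≡ a - b + - (b * (+ 2 * w))
      l₁ = ℤ-solve
      l₂ : ∀ a b r → a - b + - (b * (- 1ℤ + r)) ≡ a - b * r
      l₂ = ℤ-solve

    -- ω goes to (- 1 + r) / 2 and ω² to (- 1 - r) / 2, and L is the sign in front of r.
    ev-ω^ : ∀ {q L c} → + q ≋ c [ + 3 ] → SignMod3 L c → ev (ω E.^ q) ≋ ½ * (- 1ℤ + L * (x * i) * s) [ + p ]
    ev-ω^ {q} e (inj₁ (refl , hc)) = M.trans (M.reflexive (cong ev (ω^-cong {q} {1} (M₃.trans e hc)))) (M.reflexive (trans (l₁ w) (cong (λ v → ½ * (- 1ℤ + v * s)) (sym (ℤ.*-identityˡ (x * i))))))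
      where
      l₁ : ∀ w → 0ℤ + 1ℤ * w ≡ w
      l₁ = ℤ-solve
    ev-ω^ {q} e (inj₂ (refl , hc)) = M.trans (M.reflexive (trans (cong ev (ω^-cong {q} {2} (M₃.trans e (M₃.trans hc ((- 1ℤ) by refl))))) (l₁ ½ x i s)))
      (M.trans (M.+-cong (≋-sub half) (M.refl {½ * (- 1ℤ + - 1ℤ * (x * i) * s)})) (M.reflexive (ℤ.+-identityˡ _)))
      where
      l₁ : ∀ h x i s → - 1ℤ + - 1ℤ * (h * (- 1ℤ + x * i * s)) ≡ + 2 * h - 1ℤ + h * (- 1ℤ + - 1ℤ * (x * i) * s)
      l₁ = ℤ-solve

    scaled-relation : ∀ {B B̄} R → ¬ R ≋ 0ℤ [ + p ] → (R * B) * (R * B) ≋ (n * x + u * y * r) * (n * x + u * y * r) [ + p ] →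
      (R * B̄) * (R * B̄) ≋ (n * x - u * y * r) * (n * x - u * y * r) [ + p ] → B * B ≋ (ε * ε) * (B̄ * B̄) [ + p ]
    scaled-relation {B} {B̄} R R∤ hB hB̄ = [ (λ h → contradiction (prime-square pr {R} h) R∤) , ≋-add ]′
      (prime-cancel pr (R * R) (B * B - (ε * ε) * (B̄ * B̄)) (M.trans (M.reflexive (l₁ R B B̄ ε)) (≋-sub
        (M.trans hB (M.trans full-relation (M.*-cong (M.refl {ε * ε}) (M.sym hB̄)))))))
      where
      l₁ : ∀ R B B′ e → R * R * (B * B - e * e * (B′ * B′)) ≡ R * B * (R * B) - e * e * (R * B′ * (R * B′))
      l₁ = ℤ-solve

  -- The factor between n x + u y √-3 and n₁ x₁ + u₁ y₁ √-3. As ρ² ≡ 1 modulo 3, it does not affect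
  -- the product of the coordinates there.
  ρ : ℤ
  ρ = g * (e * f)

  opaque
    p∤ρ : ¬ ρ ≋ 0ℤ [ + p ]
    p∤ρ h = [ (λ hg → p∤n (M.trans (M.reflexive n≡) (≋-mul0ˡ n′ hg))) , (λ hef → [ (λ he → p∤x (M.trans (M.reflexive x≡) (≋-mul0ˡ x₁ he)))
      , (λ hf → p∤y (M.trans (M.reflexive y≡) (≋-mul0ˡ y₁ hf))) ]′ (prime-cancel pr e f hef)) ]′ (prime-cancel pr g (e * f) h)

    ρ²≋1 : ρ * ρ ≋ 1ℤ [ + 3 ]
    ρ²≋1 = unit-square (λ h → [ 3∤g , (λ hef → [ 3∤e , 3∤f ]′ (prime-cancel prime-3 e f hef)) ]′ (prime-cancel prime-3 g (e * f) h))

    xy≋1 : x * y ≋ 1ℤ [ + 3 ]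
    xy≋1 = M₃.trans (M₃.*-cong x≋y (M₃.refl {y})) (unit-square 3∤y)

    ρnx : ρ * (n₁ * x₁) ≡ n * x
    ρnx = trans (l₁ g e f n₁ x₁) (cong₂ _*_ (trans (cong (g *_) (sym n′≡)) (sym n≡)) (sym x≡))
      where
      l₁ : ∀ g e f n x → g * (e * f) * (n * x) ≡ g * (f * n) * (e * x)
      l₁ = ℤ-solve

    ρuy : ρ * (u₁ * y₁) ≡ u * y
    ρuy = trans (l₁ g e f u₁ y₁) (cong₂ _*_ (trans (cong (g *_) (sym u′≡)) (sym u≡)) (sym y≡))
      where
      l₁ : ∀ g e f u y → g * (e * f) * (u * y) ≡ g * (e * u) * (f * y)
      l₁ = ℤ-solve

  exponent : ∀ {l} → ∃ λ q → + q ≋ 1ℤ + l + + 2 * d [ + 3 ]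
  exponent {l} = v ℤ.%ℕ 3 , M₃.sym ((v ℤ./ℕ 3) by trans (ℤ.a≡a%ℕn+[a/ℕn]*n v 3) (cong (_+_ (+ (v ℤ.%ℕ 3))) (ℤ.*-comm (v ℤ./ℕ 3) (+ 3))))
    where v = 1ℤ + l + + 2 * d

  Goal : ℤ → Set
  Goal L = ε ^ ((p ∸ 1) ℕ./ 3) ≋ ½ * (- 1ℤ + L * (x * i) * s) [ + p ]

  -- The exponent of ω is e₀ times the exponent of the auxiliary product in `c-exponent`, that is -
  -- a b (1 + l + 2 d); its class ± 1 modulo 3 decides the sign L.
  conclude : ∀ {a b r′ l c L} (3∤a : ¬ a ≋ 0ℤ [ + 3 ]) (3∤b : ¬ b ≋ 0ℤ [ + 3 ]) (N₂≡ : N₂ ≡ r′ * norm (a + b √−3))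
    (u₁-divides : ∀ {ℓ} → u₁ ≋ 0ℤ [ + ℓ ] → a ≋ 0ℤ [ + ℓ ] ⊎ b ≋ 0ℤ [ + ℓ ])
    (x₁-divides : ∀ {ℓ} → x₁ ≋ 0ℤ [ + ℓ ] → a ≋ 0ℤ [ + ℓ ] ⊎ b ≋ 0ℤ [ + ℓ ]) →
    u * u ≡ 1ℤ + + 3 * l → - (a * b) * (1ℤ + l + + 2 * d) ≋ c [ + 3 ] → SignMod3 L c →
    ev (a + b √−3) * ev (a + b √−3) ≋ (ε * ε) * (ev (conj (a + b √−3)) * ev (conj (a + b √−3))) [ + p ] → Goal L
  conclude {r′ = r′} {l = l} {c} {L} 3∤a 3∤b N₂≡ u₁-divides x₁-divides u² hc sign B² = M.trans (M.reflexive (cong (ε ^_) third≡k)) (M.trans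
    (unit-residue 3∤a 3∤b {r′} N₂≡ u₁-divides x₁-divides root ε B² q (c-exponent {l} {q} u² (proj₂ (exponent {l}))))
    (ev-ω^ {RR.e₀ ℕ.* q} (M₃.trans (M₃.reflexive (ℤ.pos-* RR.e₀ q)) (M₃.trans (M₃.*-cong RR.e₀≋ (proj₂ (exponent {l}))) hc)) sign))
    where
    third≡k : (p ∸ 1) ℕ./ 3 ≡ k
    third≡k = trans (cong (λ p → (p ∸ 1) ℕ./ 3) (proj₂ p-mod-3)) (trans (cong (ℕ._/ 3) (ℕ.*-comm 3 k)) (ℕ.m*n/n≡m k 3))
    q = proj₁ (exponent {l})
    module RR = RationalReciprocity 3∤a 3∤b

  -- Both n₁ x₁ and u₁ y₁ are prime to 3, and their product is ≡ n u because x y ≡ 1.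
  conclude-unit : ∀ {l c L} → ¬ n ≋ 0ℤ [ + 3 ] → u * u ≡ 1ℤ + + 3 * l →
    - (n * u) * (1ℤ + l + + 2 * d) ≋ c [ + 3 ] → SignMod3 L c → Goal L
  conclude-unit {l} {c} 3∤n u² hc sign = conclude {r′ = 1ℤ} {l = l} {c = c} 3∤a 3∤b N₂≡
    (λ {ℓ} hu → inj₂ (≋-mul0ˡ {+ ℓ} {u₁} y₁ hu)) (λ {ℓ} hx → inj₁ (≋-mul0ʳ {+ ℓ} {x₁} n₁ hx)) u²
    (M₃.trans (M₃.*-cong (M₃.-‿cong ab≋) (M₃.refl {1ℤ + l + + 2 * d})) hc) sign
    (scaled-relation ρ p∤ρ (M.*-cong plus plus) (M.*-cong minus minus))
    where
    a = n₁ * x₁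
    b = u₁ * y₁
    3∤n₁ : ¬ n₁ ≋ 0ℤ [ + 3 ]
    3∤n₁ h = 3∤n (M₃.trans (M₃.reflexive (trans n≡ (cong (g *_) n′≡))) (≋-mul0ʳ g (≋-mul0ʳ f h)))
    3∤a : ¬ a ≋ 0ℤ [ + 3 ]
    3∤a h = [ 3∤n₁ , 3∤x₁ ]′ (prime-cancel prime-3 n₁ x₁ h)
    3∤b : ¬ b ≋ 0ℤ [ + 3 ]
    3∤b h = [ 3∤u₁ , 3∤y₁ ]′ (prime-cancel prime-3 u₁ y₁ h)
    N₂≡ : N₂ ≡ 1ℤ * norm (a + b √−3)
    N₂≡ = sym (trans (ℤ.*-identityˡ _) (norm-√−3 a b))
    plus : ρ * ev (a + b √−3) ≋ n * x + u * y * r [ + p ]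
    plus = M.trans (M.*-cong (M.refl {ρ}) (ev-√−3 a b)) (M.reflexive (trans (l₁ ρ a b r) (cong₂ (λ v w → v + w * r) ρnx ρuy)))
      where
      l₁ : ∀ q a b r → q * (a + b * r) ≡ q * a + q * b * r
      l₁ = ℤ-solve
    minus : ρ * ev (conj (a + b √−3)) ≋ n * x - u * y * r [ + p ]
    minus = M.trans (M.*-cong (M.refl {ρ}) (ev-conj-√−3 a b)) (M.reflexive (trans (l₁ ρ a b r) (cong₂ (λ v w → v - w * r) ρnx ρuy)))
      where
      l₁ : ∀ q a b r → q * (a - b * r) ≡ q * a - q * b * r
      l₁ = ℤ-solve
    ab≋ : a * b ≋ n * u [ + 3 ]
    ab≋ = M₃.trans (M₃.trans (M₃.reflexive (sym (ℤ.*-identityˡ (a * b)))) (M₃.*-cong (M₃.sym ρ²≋1) (M₃.refl {a * b})))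
      (M₃.trans (M₃.reflexive (trans (l₁ ρ a b) (trans (cong₂ _*_ ρnx ρuy) (l₂ n x u y)))) (M₃.trans (M₃.*-cong (M₃.refl {n * u}) xy≋1) (M₃.reflexive (ℤ.*-identityʳ (n * u)))))
      where
      l₁ : ∀ q a b → q * q * (a * b) ≡ (q * a) * (q * b)
      l₁ = ℤ-solve
      l₂ : ∀ n x u y → n * x * (u * y) ≡ n * u * (x * y)
      l₂ = ℤ-solve

  -- With n₁ = 3 n₂ one has n₁ x₁ + u₁ y₁ √-3 = √-3 (u₁ y₁ - n₂ x₁ √-3), and the last factor has
  -- coordinates prime to 3. The scaling becomes ρ r; that conjugation negates √-3 is invisible in
  -- squares. The negated coordinate is why n₃ u replaces - n u.
  conclude-ramified : ∀ {n₃ l c L} → n ≡ + 3 * n₃ → ¬ n₃ ≋ 0ℤ [ + 3 ] → u * u ≡ 1ℤ + + 3 * l →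
    (n₃ * u) * (1ℤ + l + + 2 * d) ≋ c [ + 3 ] → SignMod3 L c → Goal L
  conclude-ramified {n₃} {l} {c} {L} n≡3n₃ 3∤n₃ u² hc sign = split (3∣n₁)
    where
    3∣n₁ : n₁ ≋ 0ℤ [ + 3 ]
    3∣n₁ = [ (λ h → contradiction h 3∤g) , (λ h → [ (λ h → contradiction h 3∤f) , (λ h → h) ]′ (prime-cancel prime-3 f n₁ h)) ]′
      (prime-cancel prime-3 g (f * n₁) (M₃.trans (M₃.reflexive (trans (cong (g *_) (sym n′≡)) (trans (sym n≡) n≡3n₃))) (multiple-≋0 {+ 3} n₃)))
    split : n₁ ≋ 0ℤ [ + 3 ] → Goal L
    split (n₂ by e₁) = conclude {r′ = + 3} {l = l} {c = c} 3∤a 3∤b N₂≡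
      (λ {ℓ} hu → inj₁ (≋-mul0ˡ {+ ℓ} {u₁} y₁ hu)) (λ {ℓ} hx → inj₂ (ℤ/.-‿cong (+ ℓ) (≋-mul0ʳ {+ ℓ} {x₁} n₂ hx))) u²
      (M₃.trans (M₃.*-cong -ab≋ (M₃.refl {1ℤ + l + + 2 * d})) hc) sign
      (scaled-relation (ρ * r) p∤ρr (M.*-cong plus plus) (M.trans (M.*-cong minus minus) (M.reflexive (l₀ (n * x) (u * y * r)))))
      where
      a = u₁ * y₁
      b = - (n₂ * x₁)
      n₁≡ : n₁ ≡ + 3 * n₂
      n₁≡ = trans e₁ (ℤ.+-identityˡ _)
      l₀ : ∀ v w → (- v + w) * (- v + w) ≡ (v - w) * (v - w)
      l₀ = ℤ-solve
      n₃≡ : n₃ ≡ g * (f * n₂)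
      n₃≡ = ℤ.*-cancelˡ-≡ (+ 3) n₃ (g * (f * n₂)) (trans (sym n≡3n₃) (trans n≡ (trans (cong (g *_) (trans n′≡ (cong (f *_) n₁≡))) (l₁ g f n₂))))
        where
        l₁ : ∀ g f n → g * (f * (+ 3 * n)) ≡ + 3 * (g * (f * n))
        l₁ = ℤ-solve
      3∤n₂ : ¬ n₂ ≋ 0ℤ [ + 3 ]
      3∤n₂ h = 3∤n₃ (M₃.trans (M₃.reflexive n₃≡) (≋-mul0ʳ g (≋-mul0ʳ f h)))
      3∤a : ¬ a ≋ 0ℤ [ + 3 ]
      3∤a h = [ 3∤u₁ , 3∤y₁ ]′ (prime-cancel prime-3 u₁ y₁ h)
      3∤b : ¬ b ≋ 0ℤ [ + 3 ]
      3∤b h = [ 3∤n₂ , 3∤x₁ ]′ (prime-cancel prime-3 n₂ x₁ (M₃.trans (M₃.reflexive (sym (ℤ.neg-involutive (n₂ * x₁)))) (M₃.-‿cong h)))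
      N₂≡ : N₂ ≡ + 3 * norm (a + b √−3)
      N₂≡ = trans (cong (λ v → (v * x₁) * (v * x₁) + + 3 * (a * a)) n₁≡) (trans (l₁ n₂ x₁ a) (cong (+ 3 *_) (sym (norm-√−3 a b))))
        where
        l₁ : ∀ n x a → (+ 3 * n * x) * (+ 3 * n * x) + + 3 * (a * a) ≡ + 3 * (a * a + + 3 * (- (n * x) * - (n * x)))
        l₁ = ℤ-solve
      p∤r : ¬ r ≋ 0ℤ [ + p ]
      p∤r h = p≢3 (prime-∣prime pr prime-3 (M.trans (M.reflexive refl) (M.-‿cong (M.trans (M.sym r²) (≋-mul0ˡ r h)))))
      p∤ρr : ¬ ρ * r ≋ 0ℤ [ + p ]
      p∤ρr h = [ p∤ρ , p∤r ]′ (prime-cancel pr ρ r h)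
      ρn₁x₁ : + 3 * (ρ * (n₂ * x₁)) ≡ n * x
      ρn₁x₁ = trans (l₁ ρ n₂ x₁) (trans (cong (λ v → ρ * (v * x₁)) (sym n₁≡)) ρnx)
        where
        l₁ : ∀ q n x → + 3 * (q * (n * x)) ≡ q * (+ 3 * n * x)
        l₁ = ℤ-solve
      plus : (ρ * r) * ev (a + b √−3) ≋ n * x + u * y * r [ + p ]
      plus = M.trans (M.*-cong (M.refl {ρ * r}) (ev-√−3 a b)) (M.trans (M.reflexive (l₁ ρ r a (n₂ * x₁)))
        (M.trans (M.+-cong (M.*-cong (M.refl { - (ρ * (n₂ * x₁))}) r²) (M.refl {ρ * a * r})) (M.reflexive (trans (l₂ (ρ * (n₂ * x₁)) (ρ * a * r)) (cong₂ (λ v w → v + w * r) ρn₁x₁ ρuy)))))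
        where
        l₁ : ∀ q r a v → q * r * (a + (- v) * r) ≡ - (q * v) * (r * r) + q * a * r
        l₁ = ℤ-solve
        l₂ : ∀ v w → - v * - + 3 + w ≡ + 3 * v + w
        l₂ = ℤ-solve
      minus : (ρ * r) * ev (conj (a + b √−3)) ≋ - (n * x) + u * y * r [ + p ]
      minus = M.trans (M.*-cong (M.refl {ρ * r}) (ev-conj-√−3 a b)) (M.trans (M.reflexive (l₁ ρ r a (n₂ * x₁)))
        (M.trans (M.+-cong (M.*-cong (M.refl {ρ * (n₂ * x₁)}) r²) (M.refl {ρ * a * r})) (M.reflexive (trans (l₂ (ρ * (n₂ * x₁)) (ρ * a * r)) (cong₂ (λ v w → - v + w * r) ρn₁x₁ ρuy)))))
        where
        l₁ : ∀ q r a v → q * r * (a - (- v) * r) ≡ (q * v) * (r * r) + q * a * r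
        l₁ = ℤ-solve
        l₂ : ∀ v w → v * - + 3 + w ≡ - (+ 3 * v) + w
        l₂ = ℤ-solve
      -ab≋ : - (a * b) ≋ n₃ * u [ + 3 ]
      -ab≋ = M₃.trans (M₃.trans (M₃.reflexive (sym (ℤ.*-identityˡ (- (a * b))))) (M₃.*-cong (M₃.sym ρ²≋1) (M₃.refl { - (a * b)})))
        (M₃.trans (M₃.reflexive (trans (l₁ ρ a (n₂ * x₁)) (trans (cong₂ _*_ ρuy ρn₂x₁) (l₂ n₃ x u y)))) (M₃.trans (M₃.*-cong (M₃.refl {n₃ * u}) xy≋1) (M₃.reflexive (ℤ.*-identityʳ (n₃ * u)))))
        where
        l₁ : ∀ q a v → q * q * - (a * - v) ≡ (q * a) * (q * v)
        l₁ = ℤ-solve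
        l₂ : ∀ n x u y → u * y * (n * x) ≡ n * u * (x * y)
        l₂ = ℤ-solve
        l₃ : ∀ g e f n x → g * (e * f) * (n * x) ≡ g * (f * n) * (e * x)
        l₃ = ℤ-solve
        ρn₂x₁ : ρ * (n₂ * x₁) ≡ n₃ * x
        ρn₂x₁ = trans (l₃ g e f n₂ x₁) (cong₂ _*_ (sym n₃≡) (sym x≡))


-- The Legendre symbol modulo 3 and the four cases

≢-mod-3 : ∀ r r′ → r ℕ.< 3 → r′ ℕ.< 3 → r ≢ r′ → ¬ + r ≋ + r′ [ + 3 ]
≢-mod-3 r r′ r<3 r′<3 ne h = ne (residue-unique {3} {r} {r′} r<3 r′<3 h)

unit≋⇒3∤ : ∀ {a e} → ∣ e ∣ ≡ 1 → a ≋ e [ + 3 ] → ¬ a ≋ 0ℤ [ + 3 ]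
unit≋⇒3∤ ∣e∣≡1 a≋e h = prime≢0 prime-3 ∣e∣≡1 (ℤ/.trans (+ 3) (ℤ/.sym (+ 3) a≋e) h)

module _ {c : ℤ} where
  private
    module M = ℤ/ (+ 3)

    divisible? = c ≡? 0ℤ [mod 3 ]
    square?    = Fin.any? {n = 3} λ k → + toℕ k * + toℕ k ≡? c [mod 3 ]

    symbol : Bool → Bool → ℤ
    symbol b b′ = if b then 0ℤ else if b′ then 1ℤ else - 1ℤ

    1<3 : 1 ℕ.< 3
    1<3 = s≤s (s≤s z≤n)
    2<3 : 2 ℕ.< 3
    2<3 = s≤s (s≤s (s≤s z≤n))

    not-square : c ≋ + 2 [ + 3 ] → ¬ (∃ λ (k : Fin 3) → + toℕ k * + toℕ k ≡ c [mod 3 ])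
    not-square h (Fin.zero , e) = ≢-mod-3 0 2 (s≤s z≤n) 2<3 (λ ()) (M.trans (∣-⇒≋ {+ 3} {0ℤ} {c} e) h)
    not-square h (Fin.suc Fin.zero , e) = ≢-mod-3 1 2 1<3 2<3 (λ ()) (M.trans (∣-⇒≋ {+ 3} {1ℤ} {c} e) h)
    not-square h (Fin.suc (Fin.suc Fin.zero) , e) = ≢-mod-3 1 2 1<3 2<3 (λ ())
      (M.trans ((- 1ℤ) by refl) (M.trans (∣-⇒≋ {+ 3} {+ 4} {c} e) h))

  legendre-3 : ¬ c ≋ 0ℤ [ + 3 ] → SignMod3 (legendre c 3) c
  legendre-3 3∤c = [ square , nonsquare ]′ (prime-cancel prime-3 (c - 1ℤ) (c - - 1ℤ) (M.trans (M.reflexive (lem c)) (≋-sub (unit-square 3∤c))))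
    where
    lem : ∀ c → (c - 1ℤ) * (c - - 1ℤ) ≡ c * c - 1ℤ
    lem = ℤ-solve
    not-0 : does divisible? ≡ false
    not-0 = dec-false divisible? (λ e → 3∤c (∣-⇒≋ {+ 3} {c} {0ℤ} e))
    square : c - 1ℤ ≋ 0ℤ [ + 3 ] → SignMod3 (legendre c 3) c
    square h = inj₁ (cong₂ symbol not-0 (dec-true square? (Fin.suc Fin.zero , ≋⇒∣- {+ 3} {1ℤ} {c} (M.sym (≋-add {a = c} {b = 1ℤ} h)))) , ≋-add h)
    nonsquare : c - - 1ℤ ≋ 0ℤ [ + 3 ] → SignMod3 (legendre c 3) c
    nonsquare h = inj₂ (cong₂ symbol not-0 (dec-false square? (not-square (M.trans (≋-add {a = c} {b = - 1ℤ} h) ((- 1ℤ) by refl)))) , ≋-add h)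

SignMod3-neg : ∀ {L c} → SignMod3 L c → SignMod3 (- L) (- c)
SignMod3-neg (inj₁ (refl , h)) = inj₂ (refl , ℤ/.-‿cong (+ 3) h)
SignMod3-neg (inj₂ (refl , h)) = inj₁ (refl , ℤ/.-‿cong (+ 3) h)

exact-quotient : ∀ {z c} D .{{_ : NonZero D}} → z ≡ c * + D → z / + D ≡ c
exact-quotient {z} {c} D z≡ = sym (ℤ.*-cancelʳ-≡ c (z / + D) (+ D) (trans (sym z≡) (trans z-div (trans (cong (λ r → + r + (z / + D) * + D) r≡0) (ℤ.+-identityˡ _)))))
  where
  z-div = ℤ.a≡a%n+[a/n]*n z (+ D)
  lem : ∀ r w → r ≡ r + w - w
  lem = ℤ-solve
  lem₂ : ∀ c v D → c * D - v * D ≡ 0ℤ + D * (c - v)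
  lem₂ = ℤ-solve
  r≡0 : z ℤ.% + D ≡ 0
  r≡0 = residue-unique {D} (ℤ.n%d<d z (+ D)) (ℕ.>-nonZero⁻¹ D) ((c - z / + D) by trans (lem (+ (z ℤ.% + D)) ((z / + D) * + D))
    (trans (cong (_- (z / + D) * + D) (trans (sym z-div) z≡)) (lem₂ c (z / + D) (+ D))))

greatestExponent-∤ : ∀ b {a} → ¬ 3 ℕ.∣ ∣ a ∣ → greatestExponent≤ b 3 a ≡ 0
greatestExponent-∤ zero _ = refl
greatestExponent-∤ (suc b) {a} 3∤a = trans
  (cong (λ t → if t then suc b else greatestExponent≤ b 3 a) (dec-false (3 ℕ.^ suc b ℕ.∣? ∣ a ∣) (λ h → 3∤a (ℕ.∣-trans (ℕ.m∣m*n (3 ℕ.^ b)) h))))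
  (greatestExponent-∤ b {a} 3∤a)

greatestExponent-∣ : ∀ b {a} → 3 ℕ.∣ ∣ a ∣ → 0 ℕ.< greatestExponent≤ (suc b) 3 a
greatestExponent-∣ b {a} 3∣a = by-cases b (does (3 ℕ.^ suc b ℕ.∣? ∣ a ∣)) refl
  where
  value : ∀ b t → does (3 ℕ.^ suc b ℕ.∣? ∣ a ∣) ≡ t → greatestExponent≤ (suc b) 3 a ≡ (if t then suc b else greatestExponent≤ b 3 a)
  value b t e = cong (λ t → if t then suc b else greatestExponent≤ b 3 a) e
  by-cases : ∀ b t → does (3 ℕ.^ suc b ℕ.∣? ∣ a ∣) ≡ t → 0 ℕ.< greatestExponent≤ (suc b) 3 a
  by-cases b true e = subst (0 ℕ.<_) (sym (value b true e)) (s≤s z≤n)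
  by-cases zero false e = contradiction (trans (sym e) (dec-true (3 ℕ.^ 1 ℕ.∣? ∣ a ∣) 3∣a)) λ ()
  by-cases (suc b) false e = subst (0 ℕ.<_) (sym (value (suc b) false e)) (greatestExponent-∣ b {a} 3∣a)

ord-3∤ : ∀ {a b} → b ≢ 0ℤ → ¬ + 3 ∣ a → ord 3 a ≥ ord 3 b → ¬ + 3 ∣ b
ord-3∤ {a} {b} b≢0 3∤a ord≥ 3∣b = positive ∣ b ∣ refl
  where
  positive : ∀ n → ∣ b ∣ ≡ n → ⊥
  positive zero e = b≢0 (ℤ.∣i∣≡0⇒i≡0 e)
  positive (suc n) e = ℕ.<⇒≱ (greatestExponent-∣ n {b} 3∣b) (subst₂ ℕ._≤_ (cong (λ k → greatestExponent≤ k 3 b) e) (greatestExponent-∤ ∣ a ∣ {a} 3∤a) ord≥)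

module Cases {d m n : ℤ} (squarefree : SquareFree d) (pell : m * m - d * (n * n) ≡ + 4) where
  private module M = ℤ/ (+ 3)

  d*n² : d * (n * n) ≡ m * m - + 4
  d*n² = trans (lem (m * m) (d * (n * n))) (cong (_-_ (m * m)) pell)
    where
    lem : ∀ m d → d ≡ m - (m - d)
    lem = ℤ-solve

  n²≋1⇒d : ¬ n ≋ 0ℤ [ + 3 ] → d * (n * n) ≋ d [ + 3 ]
  n²≋1⇒d 3∤n = M.trans (M.*-cong (M.refl {d}) (unit-square 3∤n)) (M.reflexive (ℤ.*-identityʳ d))

  3∣d : ∀ {v} → ¬ n ≋ 0ℤ [ + 3 ] → d * (n * n) ≡ + 3 * v → d ≋ 0ℤ [ + 3 ]
  3∣d {v} 3∤n e = M.trans (M.sym (n²≋1⇒d 3∤n)) (M.trans (M.reflexive e) (multiple-≋0 {+ 3} v))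

  -- If n were prime to 3, both factors 3 would pass to d, which is squarefree.
  nine-divides : ∀ {v} → d * (n * n) ≡ + 9 * v → n ≋ 0ℤ [ + 3 ]
  nine-divides {v} e = decide (_≋?_ prime-3 n 0ℤ)
    where
    lem : ∀ v → + 9 * v ≡ + 3 * (+ 3 * v)
    lem = ℤ-solve
    lem₂ : ∀ d n → + 3 * (d * n) ≡ (+ 3 * d) * n
    lem₂ = ℤ-solve
    lem₃ : ∀ d → + 3 * (+ 3 * d) ≡ 0ℤ + + 9 * d
    lem₃ = ℤ-solve
    decide : Dec (n ≋ 0ℤ [ + 3 ]) → n ≋ 0ℤ [ + 3 ]
    decide (yes h) = h
    decide (no 3∤n) = first (3∣d {+ 3 * v} 3∤n (trans e (lem v)))
      where
      first : d ≋ 0ℤ [ + 3 ] → n ≋ 0ℤ [ + 3 ]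
      first (d′ by ed) = second (M.trans (M.sym (M.trans (M.*-cong (M.refl {d′}) (unit-square 3∤n)) (M.reflexive (ℤ.*-identityʳ d′)))) (M.trans (M.reflexive d′n²) (multiple-≋0 {+ 3} v)))
        where
        d≡ : d ≡ + 3 * d′
        d≡ = trans ed (ℤ.+-identityˡ _)
        d′n² : d′ * (n * n) ≡ + 3 * v
        d′n² = ℤ.*-cancelˡ-≡ (+ 3) _ _ (trans (lem₂ d′ (n * n)) (trans (cong (_* (n * n)) (sym d≡)) (trans e (lem v))))
        second : d′ ≋ 0ℤ [ + 3 ] → n ≋ 0ℤ [ + 3 ]
        second (d″ by e′) = contradiction (squarefree (+ 3) (≋0⇒∣ {+ 9} {d} (d″ by trans d≡ (trans (cong (+ 3 *_) (trans e′ (ℤ.+-identityˡ _))) (lem₃ d″))))) λ ()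

  3∤n-from : ∀ {v} → d * (n * n) ≡ + 3 * v → ¬ v ≋ 0ℤ [ + 3 ] → ¬ n ≋ 0ℤ [ + 3 ]
  3∤n-from {v} e 3∤v (n′ by en) = 3∤v ((d * (n′ * n′)) by trans (ℤ.*-cancelˡ-≡ (+ 3) v (+ 3 * (d * (n′ * n′)))
    (trans (sym e) (trans (cong (λ n → d * (n * n)) (trans en (ℤ.+-identityˡ (+ 3 * n′)))) (lem d n′)))) (sym (ℤ.+-identityˡ (+ 3 * (d * (n′ * n′))))))
    where
    lem : ∀ d n → d * (+ 3 * n * (+ 3 * n)) ≡ + 3 * (+ 3 * (d * (n * n)))
    lem = ℤ-solve

  module _ {p : ℕ} (pr : Prime p) (0<d : 0ℤ < d) {x y : ℤ} (p≡ : + p ≡ x * x + + 3 * d * (y * y))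
           (3∤x : ¬ x ≋ 0ℤ [ + 3 ]) (3∤y : ¬ y ≋ 0ℤ [ + 3 ]) (x≋y : x ≋ y [ + 3 ]) (p∤n : ¬ n ≋ 0ℤ [ + p ])
           {s ½ i : ℤ} (s² : s * s ≋ d [ + p ]) (half : + 2 * ½ ≋ 1ℤ [ + p ]) (dyi : d * y * i ≋ 1ℤ [ + p ]) where

    Residue : ℤ → Set
    Residue L = ((m + n * s) * ½) ^ ((p ∸ 1) ℕ./ 3) ≋ ½ * (- 1ℤ + L * (x * i) * s) [ + p ]

    by-unit : ∀ {τ l c} → τ * τ ≡ 1ℤ → ¬ m + + 2 * τ ≋ 0ℤ [ + 3 ] → ¬ n ≋ 0ℤ [ + 3 ] →
      (m + + 2 * τ) * (m + + 2 * τ) ≡ 1ℤ + + 3 * l → - (n * (m + + 2 * τ)) * (1ℤ + l + + 2 * d) ≋ c [ + 3 ] →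
      ¬ c ≋ 0ℤ [ + 3 ] → Residue (legendre c 3)
    by-unit {τ} {l} {c} τ² 3∤u 3∤n u² hc 3∤c = Conclusion.conclude-unit {m = m} {τ = τ} pr 0<d p≡ 3∤x 3∤y τ² pell 3∤u p∤n x≋y s² half dyi
      {l} {c} 3∤n u² hc (legendre-3 3∤c)

    product-unit : ∀ t v → ¬ t ≋ 0ℤ [ + 3 ] → ¬ v ≋ 0ℤ [ + 3 ] → ¬ t * v ≋ 0ℤ [ + 3 ]
    product-unit t v 3∤t 3∤v h = [ 3∤t , 3∤v ]′ (prime-cancel prime-3 t v h)

    -- It reads a class modulo 3 off a polynomial identity; e carries what is known of d and is d, d
    -- + 1 or d - t according to the case.
    absorb : ∀ {v c e} Q R → v ≡ c + + 3 * Q + e * R → e ≋ 0ℤ [ + 3 ] → v ≋ c [ + 3 ]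
    absorb {v} {c} {e} Q R eq he = M.trans (M.reflexive eq) (M.trans (M.+-cong (M.+-cong (M.refl {c}) (multiple-≋0 {+ 3} Q)) (≋-mul0ˡ R he)) (M.reflexive (lem c)))
      where
      lem : ∀ c → c + 0ℤ + 0ℤ ≡ c
      lem = ℤ-solve

    -- Here u = m + 2 ≡ 1, and d n² = m² - 4 = 3 t (4 + 3 t) gives 3 ∤ n and then 3 ∣ d. So 1 + l +
    -- 2 d ≡ 2 t, and - n u · 2 t ≡ t n.
    case-2 : ∀ t → m ≡ + 2 + + 3 * t → ¬ t ≋ 0ℤ [ + 3 ] → Residue (legendre (((m - + 2) * n) / + 3) 3)
    case-2 t m≡ 3∤t = subst (λ c → Residue (legendre c 3)) (sym (exact-quotient {c = t * n} 3 (trans (cong (λ m → (m - + 2) * n) m≡) (l₀ t n))))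
      (by-unit {1ℤ} {+ 5 + + 8 * t + + 3 * (t * t)} refl (unit≋⇒3∤ {e = 1ℤ} refl ((1ℤ + t) by trans (cong (_+ + 2) m≡) (l₁ t))) 3∤n
        (trans (cong (λ m → (m + + 2) * (m + + 2)) m≡) (l₂ t))
        (absorb (- n * (+ 8 + + 17 * t + + 12 * (t * t) + + 3 * (t * t * t))) (- + 2 * n * (+ 4 + + 3 * t)) (trans (cong (λ m → - (n * (m + + 2)) * (1ℤ + (+ 5 + + 8 * t + + 3 * (t * t)) + + 2 * d)) m≡) (l₃ n t d))
          (3∣d {t * (+ 4 + + 3 * t)} 3∤n dn²))
        (product-unit t n 3∤t 3∤n))
      where
      l₀ : ∀ t n → (+ 2 + + 3 * t - + 2) * n ≡ t * n * + 3
      l₀ = ℤ-solve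
      l₁ : ∀ t → + 2 + + 3 * t + + 2 ≡ 1ℤ + + 3 * (1ℤ + t)
      l₁ = ℤ-solve
      l₂ : ∀ t → (+ 2 + + 3 * t + + 2) * (+ 2 + + 3 * t + + 2) ≡ 1ℤ + + 3 * (+ 5 + + 8 * t + + 3 * (t * t))
      l₂ = ℤ-solve
      l₃ : ∀ n t d → - (n * (+ 2 + + 3 * t + + 2)) * (1ℤ + (+ 5 + + 8 * t + + 3 * (t * t)) + + 2 * d)
        ≡ t * n + + 3 * (- n * (+ 8 + + 17 * t + + 12 * (t * t) + + 3 * (t * t * t))) + d * (- + 2 * n * (+ 4 + + 3 * t))
      l₃ = ℤ-solve
      l₄ : ∀ t → (+ 2 + + 3 * t) * (+ 2 + + 3 * t) - + 4 ≡ + 3 * (t * (+ 4 + + 3 * t))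
      l₄ = ℤ-solve
      l₅ : ∀ t → + 4 + + 3 * t ≡ 1ℤ + + 3 * (1ℤ + t)
      l₅ = ℤ-solve
      dn² : d * (n * n) ≡ + 3 * (t * (+ 4 + + 3 * t))
      dn² = trans d*n² (trans (cong (λ m → m * m - + 4) m≡) (l₄ t))
      3∤n : ¬ n ≋ 0ℤ [ + 3 ]
      3∤n = 3∤n-from dn² (product-unit t (+ 4 + + 3 * t) 3∤t (unit≋⇒3∤ {e = 1ℤ} refl ((1ℤ + t) by l₅ t)))

    -- d n² = m² - 4 ≡ - 1 gives 3 ∤ n and d ≡ - 1. With u = m + 2 ≡ - 1 and 1 + l + 2 d ≡ t, the
    -- exponent - n u t is ≡ t n.
    case-0 : ∀ t → m ≡ + 3 * t → ¬ t ≋ 0ℤ [ + 3 ] → Residue (legendre ((m * n) / + 3) 3)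
    case-0 t m≡ 3∤t = subst (λ c → Residue (legendre c 3)) (sym (exact-quotient {c = t * n} 3 (trans (cong (_* n) m≡) (l₀ t n))))
      (by-unit {1ℤ} {1ℤ + + 4 * t + + 3 * (t * t)} refl (unit≋⇒3∤ {e = - 1ℤ} refl ((1ℤ + t) by trans (cong (_+ + 2) m≡) (l₁ t))) 3∤n
        (trans (cong (λ m → (m + + 2) * (m + + 2)) m≡) (l₂ t))
        (absorb (- n * (+ 3 * t + + 6 * (t * t) + + 3 * (t * t * t))) (- + 2 * n * (+ 2 + + 3 * t)) (trans (cong (λ m → - (n * (m + + 2)) * (1ℤ + (1ℤ + + 4 * t + + 3 * (t * t)) + + 2 * d)) m≡) (l₃ n t d)) d≋−1)
        (product-unit t n 3∤t 3∤n))
      where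
      l₀ : ∀ t n → + 3 * t * n ≡ t * n * + 3
      l₀ = ℤ-solve
      l₁ : ∀ t → + 3 * t + + 2 ≡ - 1ℤ + + 3 * (1ℤ + t)
      l₁ = ℤ-solve
      l₂ : ∀ t → (+ 3 * t + + 2) * (+ 3 * t + + 2) ≡ 1ℤ + + 3 * (1ℤ + + 4 * t + + 3 * (t * t))
      l₂ = ℤ-solve
      l₃ : ∀ n t d → - (n * (+ 3 * t + + 2)) * (1ℤ + (1ℤ + + 4 * t + + 3 * (t * t)) + + 2 * d)
        ≡ t * n + + 3 * (- n * (+ 3 * t + + 6 * (t * t) + + 3 * (t * t * t))) + (d - - 1ℤ) * (- + 2 * n * (+ 2 + + 3 * t))
      l₃ = ℤ-solve
      l₄ : ∀ t → + 3 * t * (+ 3 * t) - + 4 ≡ - 1ℤ + + 3 * (+ 3 * (t * t) - 1ℤ)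
      l₄ = ℤ-solve
      dn²≋ : d * (n * n) ≋ - 1ℤ [ + 3 ]
      dn²≋ = (+ 3 * (t * t) - 1ℤ) by trans d*n² (trans (cong (λ m → m * m - + 4) m≡) (l₄ t))
      3∤n : ¬ n ≋ 0ℤ [ + 3 ]
      3∤n h = unit≋⇒3∤ {e = - 1ℤ} refl dn²≋ (≋-mul0ʳ d (≋-mul0ˡ n h))
      d≋−1 : d - - 1ℤ ≋ 0ℤ [ + 3 ]
      d≋−1 = ≋-sub (M.trans (M.sym (n²≋1⇒d 3∤n)) dn²≋)

    -- As 3 divides m + 2, the choice is u = m - 2 ≡ - 1. From 3 ∤ n follow 3 ∣ d and, d being
    -- squarefree, 3 ∤ t. Then 1 + l + 2 d ≡ t, and - n u t ≡ t n.
    case-1 : ∀ t → m ≡ + 3 * t - + 2 → ¬ n ≋ 0ℤ [ + 3 ] → Residue (legendre (((m + + 2) * n) / + 3) 3)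
    case-1 t m≡ 3∤n = subst (λ c → Residue (legendre c 3)) (sym (exact-quotient {c = t * n} 3 (trans (cong (λ m → (m + + 2) * n) m≡) (l₀ t n))))
      (by-unit { - 1ℤ} {+ 5 - + 8 * t + + 3 * (t * t)} refl (unit≋⇒3∤ {e = - 1ℤ} refl ((t - 1ℤ) by trans (cong (_+ - + 2) m≡) (l₁ t))) 3∤n
        (trans (cong (λ m → (m + - + 2) * (m + - + 2)) m≡) (l₂ t))
        (absorb (- n * (- + 8 + + 17 * t - + 12 * (t * t) + + 3 * (t * t * t))) (- + 2 * n * (+ 3 * t - + 4)) (trans (cong (λ m → - (n * (m + - + 2)) * (1ℤ + (+ 5 - + 8 * t + + 3 * (t * t)) + + 2 * d)) m≡) (l₃ n t d))
          (3∣d {t * (+ 3 * t - + 4)} 3∤n (trans dn² (l₄ t))))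
        (product-unit t n 3∤t 3∤n))
      where
      l₀ : ∀ t n → (+ 3 * t - + 2 + + 2) * n ≡ t * n * + 3
      l₀ = ℤ-solve
      l₁ : ∀ t → + 3 * t - + 2 + - + 2 ≡ - 1ℤ + + 3 * (t - 1ℤ)
      l₁ = ℤ-solve
      l₂ : ∀ t → (+ 3 * t - + 2 + - + 2) * (+ 3 * t - + 2 + - + 2) ≡ 1ℤ + + 3 * (+ 5 - + 8 * t + + 3 * (t * t))
      l₂ = ℤ-solve
      l₃ : ∀ n t d → - (n * (+ 3 * t - + 2 + - + 2)) * (1ℤ + (+ 5 - + 8 * t + + 3 * (t * t)) + + 2 * d)
        ≡ t * n + + 3 * (- n * (- + 8 + + 17 * t - + 12 * (t * t) + + 3 * (t * t * t))) + d * (- + 2 * n * (+ 3 * t - + 4))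
      l₃ = ℤ-solve
      l₄ : ∀ t → (+ 3 * t - + 2) * (+ 3 * t - + 2) - + 4 ≡ + 3 * (t * (+ 3 * t - + 4))
      l₄ = ℤ-solve
      l₅ : ∀ t → (+ 3 * (+ 3 * t) - + 2) * (+ 3 * (+ 3 * t) - + 2) - + 4 ≡ + 9 * (t * (+ 9 * t - + 4))
      l₅ = ℤ-solve
      dn² : d * (n * n) ≡ (+ 3 * t - + 2) * (+ 3 * t - + 2) - + 4
      dn² = trans d*n² (cong (λ m → m * m - + 4) m≡)
      3∤t : ¬ t ≋ 0ℤ [ + 3 ]
      3∤t (t′ by e) = 3∤n (nine-divides {t′ * (+ 9 * t′ - + 4)} (trans dn² (trans (cong (λ t → (+ 3 * t - + 2) * (+ 3 * t - + 2) - + 4) (trans e (ℤ.+-identityˡ (+ 3 * t′)))) (l₅ t′))))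

    -- 9 ∣ d n² forces n = 3 n₃, and d n₃² = t (4 + 9 t) gives d ≡ t. With u ≡ 1 and 1 + l + 2 d ≡ 2
    -- t, the exponent n₃ u · 2 t is ≡ - t n₃, where t n₃ = (m - 2) n / 27.
    case-2-mod-9 : ∀ t → m ≡ + 2 + + 9 * t → ¬ t ≋ 0ℤ [ + 3 ] → Residue (- legendre (((m - + 2) * n) / + 27) 3)
    case-2-mod-9 t m≡ 3∤t = split (nine-divides dn²)
      where
      l₀ : ∀ t n → (+ 2 + + 9 * t - + 2) * (+ 3 * n) ≡ t * n * + 27
      l₀ = ℤ-solve
      l₁ : ∀ t → + 2 + + 9 * t + + 2 ≡ 1ℤ + + 3 * (1ℤ + + 3 * t)
      l₁ = ℤ-solve
      l₂ : ∀ t → (+ 2 + + 9 * t + + 2) * (+ 2 + + 9 * t + + 2) ≡ 1ℤ + + 3 * (+ 5 + + 24 * t + + 27 * (t * t))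
      l₂ = ℤ-solve
      l₃ : ∀ n t d → (n * (+ 2 + + 9 * t + + 2)) * (1ℤ + (+ 5 + + 24 * t + + 27 * (t * t)) + + 2 * d)
        ≡ - (t * n) + + 3 * (n * (+ 8 + + 53 * t + + 114 * (t * t) + + 81 * (t * t * t))) + (d - t) * (+ 2 * n * (+ 4 + + 9 * t))
      l₃ = ℤ-solve
      l₄ : ∀ t → (+ 2 + + 9 * t) * (+ 2 + + 9 * t) - + 4 ≡ + 9 * (t * (+ 4 + + 9 * t))
      l₄ = ℤ-solve
      l₅ : ∀ d n → d * (+ 3 * n * (+ 3 * n)) ≡ + 9 * (d * (n * n))
      l₅ = ℤ-solve
      l₆ : ∀ t → t * (+ 4 + + 9 * t) ≡ t + + 3 * (t + + 3 * (t * t))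
      l₆ = ℤ-solve
      dn² : d * (n * n) ≡ + 9 * (t * (+ 4 + + 9 * t))
      dn² = trans d*n² (trans (cong (λ m → m * m - + 4) m≡) (l₄ t))
      split : n ≋ 0ℤ [ + 3 ] → Residue (- legendre (((m - + 2) * n) / + 27) 3)
      split (n₃ by en) = subst (λ c → Residue (- legendre c 3)) (sym (exact-quotient {c = t * n₃} 27 (trans (cong₂ (λ m n → (m - + 2) * n) m≡ n≡) (l₀ t n₃))))
        (Conclusion.conclude-ramified {m = m} {τ = 1ℤ} pr 0<d p≡ 3∤x 3∤y refl pell (unit≋⇒3∤ {e = 1ℤ} refl ((1ℤ + + 3 * t) by trans (cong (_+ + 2) m≡) (l₁ t))) p∤n x≋y s² half dyi
          {n₃} {+ 5 + + 24 * t + + 27 * (t * t)} { - (t * n₃)} n≡ 3∤n₃ (trans (cong (λ m → (m + + 2) * (m + + 2)) m≡) (l₂ t))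
          (absorb (n₃ * (+ 8 + + 53 * t + + 114 * (t * t) + + 81 * (t * t * t))) (+ 2 * n₃ * (+ 4 + + 9 * t)) (trans (cong (λ m → (n₃ * (m + + 2)) * (1ℤ + (+ 5 + + 24 * t + + 27 * (t * t)) + + 2 * d)) m≡) (l₃ n₃ t d)) d≋t)
          (SignMod3-neg (legendre-3 (product-unit t n₃ 3∤t 3∤n₃))))
        where
        n≡ : n ≡ + 3 * n₃
        n≡ = trans en (ℤ.+-identityˡ _)
        dn₃²≋t : d * (n₃ * n₃) ≋ t [ + 3 ]
        dn₃²≋t = (t + + 3 * (t * t)) by trans (ℤ.*-cancelˡ-≡ (+ 9) _ _ (trans (sym (l₅ d n₃)) (trans (cong (λ n → d * (n * n)) (sym n≡)) dn²))) (l₆ t)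
        3∤n₃ : ¬ n₃ ≋ 0ℤ [ + 3 ]
        3∤n₃ h = 3∤t (M.trans (M.sym dn₃²≋t) (≋-mul0ʳ d (≋-mul0ˡ n₃ h)))
        d≋t : d - t ≋ 0ℤ [ + 3 ]
        d≋t = ≋-sub (M.trans (M.sym (M.trans (M.*-cong (M.refl {d}) (unit-square 3∤n₃)) (M.reflexive (ℤ.*-identityʳ d)))) dn₃²≋t)


theorem8p2 : (d : ℤ) → 1ℤ < d → SquareFree d →
    (m n : ℤ) → m ≢ 0ℤ → n ≢ 0ℤ →
    m * m - d * (n * n) ≡ + 4 →
    ¬ (+ 9 ∣ m) →
    ¬ (+ 27 ∣ m - + 2) →
    ord 3 (m - + 2) ≥ ord 3 n →
    (p : ℕ) → Prime p → ¬ (+ p ∣ n) →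
    (x y : ℤ) → + p ≡ x * x + + 3 * d * (y * y) →
    ¬ (+ 3 ∣ y) → x ≡ y [mod 3 ] →
    (s : ℤ) → s * s ≡ d [mod p ] →
    (½ : ℤ) → IsInverseMod p (+ 2) ½ →
    (1/dy : ℤ) → IsInverseMod p (d * y) 1/dy →
    (m ≡ + 5 [mod 9 ] ⊎ m ≡ + 8 [mod 9 ] →
    ((m + n * s) * ½) ^ ((p ∸ 1) ℕ./ 3)
    ≡ ½ * (- 1ℤ + legendre (((m - + 2) * n) / + 3) 3 * (x * 1/dy) * s) [mod p ])
    × (m ≡ + 11 [mod 27 ] ⊎ m ≡ + 20 [mod 27 ] →
    ((m + n * s) * ½) ^ ((p ∸ 1) ℕ./ 3)
    ≡ ½ * (- 1ℤ - legendre (((m - + 2) * n) / + 27) 3 * (x * 1/dy) * s) [mod p ])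
    × (m ≡ 0ℤ [mod 3 ] →
    ((m + n * s) * ½) ^ ((p ∸ 1) ℕ./ 3)
    ≡ ½ * (- 1ℤ + legendre ((m * n) / + 3) 3 * (x * 1/dy) * s) [mod p ])
    × (m ≡ 1ℤ [mod 3 ] →
    ((m + n * s) * ½) ^ ((p ∸ 1) ℕ./ 3)
    ≡ ½ * (- 1ℤ + legendre (((m + + 2) * n) / + 3) 3 * (x * 1/dy) * s) [mod p ])
theorem8p2 d 1<d squarefree m n _ n≢0 pell 9∤m _ ord≥ p pr p∤n x y p≡ 3∤y x≡y s s²≡d ½ half 1/dy dy-inverse =
    (λ h → ≋⇒∣- ([ from-5 , from-8 ]′ h)) , (λ h → ≋⇒∣- ([ from-11 , from-20 ]′ h))
  , (λ h → ≋⇒∣- (from-0 (∣-⇒≋ {+ 3} {m} {0ℤ} h))) , (λ h → ≋⇒∣- (from-1 (∣-⇒≋ {+ 3} {m} {1ℤ} h)))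
  where
  module M = ℤ/ (+ 3)
  x≋y : x ≋ y [ + 3 ]
  x≋y = ∣-⇒≋ x≡y
  3∤y′ : ¬ y ≋ 0ℤ [ + 3 ]
  3∤y′ h = 3∤y (≋0⇒∣ h)
  3∤x : ¬ x ≋ 0ℤ [ + 3 ]
  3∤x h = 3∤y′ (M.trans (M.sym x≋y) h)
  p∤n′ : ¬ n ≋ 0ℤ [ + p ]
  p∤n′ h = p∤n (≋0⇒∣ h)
  0<d : 0ℤ < d
  0<d = ℤ.<-trans (ℤ.+<+ (s≤s z≤n)) 1<d
  module C = Cases {d} {m} {n} squarefree pell

  Residue : ℤ → Set
  Residue L = ((m + n * s) * ½) ^ ((p ∸ 1) ℕ./ 3) ≋ ½ * (- 1ℤ + L * (x * 1/dy) * s) [ + p ]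
  Residue⁻ : ℤ → Set
  Residue⁻ L = ((m + n * s) * ½) ^ ((p ∸ 1) ℕ./ 3) ≋ ½ * (- 1ℤ - L * (x * 1/dy) * s) [ + p ]

  1+3z : ∀ z → ¬ 1ℤ + + 3 * z ≋ 0ℤ [ + 3 ]
  1+3z z = unit≋⇒3∤ {e = 1ℤ} refl (z by refl)
  2+3z : ∀ z → ¬ + 2 + + 3 * z ≋ 0ℤ [ + 3 ]
  2+3z z = unit≋⇒3∤ {e = - 1ℤ} refl ((1ℤ + z) by lem z)
    where
    lem : ∀ z → + 2 + + 3 * z ≡ - 1ℤ + + 3 * (1ℤ + z)
    lem = ℤ-solve

  case-2 : ∀ t → m ≡ + 2 + + 3 * t → ¬ t ≋ 0ℤ [ + 3 ] → Residue (legendre (((m - + 2) * n) / + 3) 3)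
  case-2 = C.case-2 pr 0<d p≡ 3∤x 3∤y′ x≋y p∤n′ (∣-⇒≋ s²≡d) (∣-⇒≋ half) (∣-⇒≋ dy-inverse)
  case-2-mod-9 : ∀ t → m ≡ + 2 + + 9 * t → ¬ t ≋ 0ℤ [ + 3 ] → Residue⁻ (legendre (((m - + 2) * n) / + 27) 3)
  case-2-mod-9 t m≡ 3∤t = subst (((m + n * s) * ½) ^ ((p ∸ 1) ℕ./ 3) ≋_[ + p ]) (lem ½ (legendre (((m - + 2) * n) / + 27) 3) (x * 1/dy) s)
    (C.case-2-mod-9 pr 0<d p≡ 3∤x 3∤y′ x≋y p∤n′ (∣-⇒≋ s²≡d) (∣-⇒≋ half) (∣-⇒≋ dy-inverse) t m≡ 3∤t)
    where
    lem : ∀ h L v s → h * (- 1ℤ + - L * v * s) ≡ h * (- 1ℤ - L * v * s)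
    lem = ℤ-solve

  from-5 : m ≡ + 5 [mod 9 ] → Residue (legendre (((m - + 2) * n) / + 3) 3)
  from-5 h = go (∣-⇒≋ {+ 9} {m} {+ 5} h)
    where
    lem : ∀ z → + 5 + + 9 * z ≡ + 2 + + 3 * (1ℤ + + 3 * z)
    lem = ℤ-solve
    go : m ≋ + 5 [ + 9 ] → Residue (legendre (((m - + 2) * n) / + 3) 3)
    go (z by e) = case-2 (1ℤ + + 3 * z) (trans e (lem z)) (1+3z z)
  from-8 : m ≡ + 8 [mod 9 ] → Residue (legendre (((m - + 2) * n) / + 3) 3)
  from-8 h = go (∣-⇒≋ {+ 9} {m} {+ 8} h)
    where
    lem : ∀ z → + 8 + + 9 * z ≡ + 2 + + 3 * (+ 2 + + 3 * z)
    lem = ℤ-solve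
    go : m ≋ + 8 [ + 9 ] → Residue (legendre (((m - + 2) * n) / + 3) 3)
    go (z by e) = case-2 (+ 2 + + 3 * z) (trans e (lem z)) (2+3z z)
  from-11 : m ≡ + 11 [mod 27 ] → Residue⁻ (legendre (((m - + 2) * n) / + 27) 3)
  from-11 h = go (∣-⇒≋ {+ 27} {m} {+ 11} h)
    where
    lem : ∀ z → + 11 + + 27 * z ≡ + 2 + + 9 * (1ℤ + + 3 * z)
    lem = ℤ-solve
    go : m ≋ + 11 [ + 27 ] → Residue⁻ (legendre (((m - + 2) * n) / + 27) 3)
    go (z by e) = case-2-mod-9 (1ℤ + + 3 * z) (trans e (lem z)) (1+3z z)
  from-20 : m ≡ + 20 [mod 27 ] → Residue⁻ (legendre (((m - + 2) * n) / + 27) 3)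
  from-20 h = go (∣-⇒≋ {+ 27} {m} {+ 20} h)
    where
    lem : ∀ z → + 20 + + 27 * z ≡ + 2 + + 9 * (+ 2 + + 3 * z)
    lem = ℤ-solve
    go : m ≋ + 20 [ + 27 ] → Residue⁻ (legendre (((m - + 2) * n) / + 27) 3)
    go (z by e) = case-2-mod-9 (+ 2 + + 3 * z) (trans e (lem z)) (2+3z z)
  from-0 : m ≋ 0ℤ [ + 3 ] → Residue (legendre ((m * n) / + 3) 3)
  from-0 (z by e) = C.case-0 pr 0<d p≡ 3∤x 3∤y′ x≋y p∤n′ (∣-⇒≋ s²≡d) (∣-⇒≋ half) (∣-⇒≋ dy-inverse) z m≡3z 3∤z
    where
    m≡3z : m ≡ + 3 * z
    m≡3z = trans e (ℤ.+-identityˡ (+ 3 * z))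
    lem : ∀ z → + 3 * (0ℤ + + 3 * z) ≡ 0ℤ + + 9 * z
    lem = ℤ-solve
    3∤z : ¬ z ≋ 0ℤ [ + 3 ]
    3∤z (z′ by e′) = 9∤m (≋0⇒∣ {+ 9} {m} (z′ by trans m≡3z (trans (cong (+ 3 *_) e′) (lem z′))))
  from-1 : m ≋ 1ℤ [ + 3 ] → Residue (legendre (((m + + 2) * n) / + 3) 3)
  -- `case-1` counts from - 2, and 1 + 3 z = 3 (1 + z) - 2, so that (m + 2) n / 3 becomes t n.
  from-1 (z by e) = C.case-1 pr 0<d p≡ 3∤x 3∤y′ x≋y p∤n′ (∣-⇒≋ s²≡d) (∣-⇒≋ half) (∣-⇒≋ dy-inverse) (1ℤ + z) (trans e (lem z)) 3∤n
    where
    lem : ∀ z → 1ℤ + + 3 * z ≡ + 3 * (1ℤ + z) - + 2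
    lem = ℤ-solve
    lem₂ : ∀ z → 1ℤ + + 3 * z - + 2 ≡ - 1ℤ + + 3 * z
    lem₂ = ℤ-solve
    3∤m-2 : ¬ + 3 ∣ m - + 2
    3∤m-2 h = unit≋⇒3∤ {a = m - + 2} {e = - 1ℤ} refl (z by trans (cong (_- + 2) e) (lem₂ z)) (∣⇒≋0 h)
    -- As m - 2 ≡ - 1, its 3-adic order is 0, and the hypothesis on orders passes this on to n.
    3∤n : ¬ n ≋ 0ℤ [ + 3 ]
    3∤n h = ord-3∤ {m - + 2} {n} n≢0 3∤m-2 ord≥ (≋0⇒∣ h)
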